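{- Let $t\ge2$, $\omega$ a primitive $t$-th root of unity, and $\lambda\in\mathcal P_t$. Let $(\lambda^{(0)},\dots,\lambda^{(t-1)})$, $n_i(\lambda)$, $\sigma_\lambda$ be the $t$-quotient, residue counts and sorting permutation computed from $\beta(\lambda,t)$. Then the symplectic character $\mathrm{sp}_\lambda(1,\omega,\dots,\omega^{t-1})$ is nonzero if and only if the $t$-core of $\lambda$ is symplectic. In that case, if the $t$-core has rank $r$, \[ \mathrm{sp}_\lambda(1,\omega,\dots,\omega^{t-1})=(-1)^{\epsilon}\operatorname{sgn}(\sigma_\lambda)\,(\lambda^{(t-1)}_1+1)\prod_{0\le i\le(t-3)/2}\big(\lambda^{(i)}_1+\lambda^{(t-2-i)}_1-\lambda^{(i)}_2-\lambda^{(t-2-i)}_2+1\big)\times\begin{cases}2\lambda^{(t/2-1)}_1+1 & t\text{ even},\\1 & t\text{ odd},\end{cases} \] where $\epsilon=-\sum_{i=\lfloor t/2\rfloor}^{t-2}\binom{n_i(\lambda)+1}{2}+\begin{cases}1+r & t\text{ even},\\0 & t\text{ odd},\end{cases}$ and $\mu_k$ denotes the $k$-th part of $\mu$ (zero if $k>\ell(\mu)$).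
   Context: Partitions $\lambda=(\lambda_1\ge\dots\ge0)$, $\ell$ = number of nonzero parts, $\mathcal P_m$ = partitions with $\ell\le m$. Beta-set $\beta(\lambda,m)=(\lambda_j+m-j)_{1\le j\le m}$; $n_i(\lambda)$ = number of its entries congruent to $i$ mod $t$. $t$-core: list the integers $tj+i$ ($0\le i\le t-1$, $0\le j\le n_i-1$) decreasingly as $b_1>\dots>b_m$; the $t$-core has parts $b_j-m+j$. $t$-quotient: writing entries congruent to $i$ decreasingly as $tc^{(i)}_1+i>\dots>tc^{(i)}_{n_i}+i$, $\lambda^{(i)}$ has parts $c^{(i)}_j-n_i+j$. $\sigma_\lambda\in S_m$: $(\beta_{\sigma_\lambda(1)},\dots,\beta_{\sigma_\lambda(m)})$ lists entries $\equiv0$ mod $t$ decreasingly, then $\equiv1$, ..., then $\equiv t-1$. Rank of $\nu$: largest $k$ with $\nu_k\ge k$; $\nu$ of rank $r$ is symplectic if $\nu'_i-i=\nu_i-i+1$ for $1\le i\le r$. $h_k$ complete homogeneous symmetric polynomial ($h_0=1$, $h_k=0$ for $k<0$). For $k$ variables $W$, $\overline W=(1/w_1,\dots,1/w_k)$ and $\lambda\in\mathcal P_k$: $\mathrm{sp}_\lambda(W)=\tfrac12\det(h_{\lambda_i-i+j}(W,\overline W)+h_{\lambda_i-i-j+2}(W,\overline W))_{1\le i,j\le k}$. -}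

module Defs where

open import Level using (Level)
open import Data.Bool using (Bool; true; false; if_then_else_)
open import Data.Nat as ℕ using (ℕ; zero; suc; _≤_; _∸_; _⊔_; _≤ᵇ_; _≡ᵇ_; NonZero)
open import Data.Nat.Properties using (≤-decTotalOrder)
open import Data.Nat.DivMod using (_/_; _%_)
open import Data.Nat.Combinatorics using (_C_)
open import Data.Integer as ℤ using (ℤ; +_; -[1+_])
open import Data.Fin as Fin using (Fin; toℕ; punchIn)
open import Data.Vec as Vec using (Vec; lookup)
open import Data.List as List using (List; []; _∷_; length; filter; map; upTo; foldr; zipWith; concatMap; reverse; _++_)
open import Data.List.Sort ≤-decTotalOrder using (sort)
open import Relation.Binary.PropositionalEquality using (_≡_)
open import Algebra.Bundles using (CommutativeRing)

-- 1-indexed part of a list of parts; 0 beyond the end (and at index 0).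
partAt : List ℕ → ℕ → ℕ
partAt []       _             = 0
partAt (x ∷ xs) zero          = 0
partAt (x ∷ xs) (suc zero)    = x
partAt (x ∷ xs) (suc (suc k)) = partAt xs (suc k)

oneTo : ℕ → List ℕ
oneTo n = map suc (upTo n)

-- λ ∈ P_m, given by its m parts λ_1 ≥ ... ≥ λ_m ≥ 0 (trailing zeros allowed)
IsPartition : {m : ℕ} → Vec ℕ m → Set
IsPartition {m} lam = (i j : Fin m) → i Fin.≤ j → lookup lam j ≤ lookup lam i

beta : (m : ℕ) → Vec ℕ m → List ℕ
beta m lam = Vec.toList (Vec.tabulate (λ j → lookup lam j ℕ.+ (m ∸ suc (toℕ j))))

module _ (t : ℕ) .{{_ : NonZero t}} where

  -- entries of β congruent to i mod t, in the order of β (i.e. decreasingly)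
  resEntries : List ℕ → ℕ → List ℕ
  resEntries β i = filter (λ x → x % t ℕ.≟ i) β

  resCount : List ℕ → ℕ → ℕ
  resCount β i = length (resEntries β i)

  -- parts of λ^{(i)}: c^{(i)}_j - n_i + j, where the entries ≡ i are t c_j + i
  quotientParts : List ℕ → ℕ → List ℕ
  quotientParts β i =
    zipWith (λ x j → (x / t) ℕ.+ suc j ∸ resCount β i) (resEntries β i) (upTo (resCount β i))

  quotPart : List ℕ → ℕ → ℕ → ℕ
  quotPart β i k = partAt (quotientParts β i) k

  coreBeta : List ℕ → List ℕ
  coreBeta β = reverse (sort (concatMap (λ i → map (λ j → t ℕ.* j ℕ.+ i) (upTo (resCount β i))) (upTo t)))

  core : List ℕ → List ℕ
  core β = zipWith (λ b j → b ℕ.+ suc j ∸ length β) (coreBeta β) (upTo (length β))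

  -- σ_λ as the list (σ(1), ..., σ(m)) of 1-based indices into β:
  -- first the indices of entries ≡ 0 (decreasing values), then ≡ 1, ...
  sortPerm : List ℕ → List ℕ
  sortPerm β = concatMap (λ i → filter (λ j → partAt β j % t ℕ.≟ i) (oneTo (length β))) (upTo t)

conj : List ℕ → ℕ → ℕ
conj ν i = length (filter (λ x → i ℕ.≤? x) ν)

rank : List ℕ → ℕ
rank ν = foldr _⊔_ 0 (map (λ k → if k ≤ᵇ partAt ν k then k else 0) (oneTo (length ν)))

Symplectic : List ℕ → Set
Symplectic ν = (i : ℕ) → 1 ≤ i → i ≤ rank ν →
  (+ conj ν i) ℤ.- (+ i) ≡ (+ partAt ν i) ℤ.- (+ i) ℤ.+ ℤ.1ℤ

inversions : List ℕ → ℕ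
inversions []       = 0
inversions (x ∷ xs) = length (filter (λ y → suc y ℕ.≤? x) xs) ℕ.+ inversions xs

negOnePow : ℕ → ℤ
negOnePow zero    = ℤ.1ℤ
negOnePow (suc n) = ℤ.- negOnePow n

sgn : List ℕ → ℤ
sgn σ = negOnePow (inversions σ)

negOnePowℤ : ℤ → ℤ
negOnePowℤ e = negOnePow ℤ.∣ e ∣

isEven : ℕ → Bool
isEven n = n % 2 ≡ᵇ 0

sumℤ : List ℤ → ℤ
sumℤ = foldr ℤ._+_ ℤ.0ℤ

productℤ : List ℤ → ℤ
productℤ = foldr ℤ._*_ ℤ.1ℤ

module _ (t : ℕ) .{{_ : NonZero t}} where

  epsilon : List ℕ → ℤ
  epsilon β =
    ℤ.- sumℤ (map (λ i → + (suc (resCount t β i) C 2))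
                  (filter (λ i → i ℕ.≤? t ∸ 2) (map (λ k → t / 2 ℕ.+ k) (upTo t))))
    ℤ.+ (if isEven t then + (suc (rank (core t β))) else ℤ.0ℤ)

  rhs : List ℕ → ℤ
  rhs β =
    negOnePowℤ (epsilon β) ℤ.* sgn (sortPerm t β)
      ℤ.* (+ quotPart t β (t ∸ 1) 1 ℤ.+ ℤ.1ℤ)
      ℤ.* productℤ (map (λ i → + quotPart t β i 1 ℤ.+ + quotPart t β (t ∸ 2 ∸ i) 1
                                 ℤ.- + quotPart t β i 2 ℤ.- + quotPart t β (t ∸ 2 ∸ i) 2 ℤ.+ ℤ.1ℤ)
                         (filter (λ i → 2 ℕ.* i ℕ.+ 3 ℕ.≤? t) (upTo t)))
      ℤ.* (if isEven t then + 2 ℤ.* + quotPart t β (t / 2 ∸ 1) 1 ℤ.+ ℤ.1ℤ else ℤ.1ℤ)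

-- Ring-valued part: symplectic characters in a commutative ring R
-- equipped with an inverse function `inv` (used only on nonzero elements).

module _ {c ℓ : Level} (R : CommutativeRing c ℓ) where
  open CommutativeRing R

  pow : Carrier → ℕ → Carrier
  pow x zero    = 1#
  pow x (suc n) = x * pow x n

  natR : ℕ → Carrier
  natR zero    = 0#
  natR (suc n) = 1# + natR n

  fromℤ : ℤ → Carrier
  fromℤ (+ n)     = natR n
  fromℤ -[1+ n ]  = - natR (suc n)

  sumR : List Carrier → Carrier
  sumR = foldr _+_ 0#

  -- complete homogeneous symmetric polynomial h_k evaluated at a list of values:
  -- h_k(x, xs) = Σ_{a=0}^{k} x^a h_{k-a}(xs),  h_0() = 1, h_k() = 0 for k > 0
  hN : ℕ → List Carrier → Carrier
  hN zero    []       = 1#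
  hN (suc k) []       = 0#
  hN k       (x ∷ xs) = sumR (map (λ a → pow x a * hN (k ∸ a) xs) (upTo (suc k)))

  h : ℤ → List Carrier → Carrier
  h (+ k)    xs = hN k xs
  h -[1+ k ] xs = 0#

  signed : ℕ → Carrier → Carrier
  signed zero    x = x
  signed (suc n) x = - signed n x

  sumFin : (n : ℕ) → (Fin n → Carrier) → Carrier
  sumFin zero    f = 0#
  sumFin (suc n) f = f Fin.zero + sumFin n (λ j → f (Fin.suc j))

  det : (n : ℕ) → (Fin n → Fin n → Carrier) → Carrier
  det zero    M = 1#
  det (suc n) M = sumFin (suc n) (λ j →
    signed (toℕ j) (M Fin.zero j * det n (λ a b → M (Fin.suc a) (punchIn j b))))

  module _ (inv : Carrier → Carrier) where

    sp : (k : ℕ) → Vec ℕ k → (Fin k → Carrier) → Carrier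
    sp k lam W = inv (1# + 1#) * det k (λ i j →
        h (+ lookup lam i ℤ.- + suc (toℕ i) ℤ.+ + suc (toℕ j)) vars
      + h (+ lookup lam i ℤ.- + suc (toℕ i) ℤ.- + suc (toℕ j) ℤ.+ + 2) vars)
      where
      vars : List Carrier
      vars = List.tabulate W ++ List.tabulate (λ i → inv (W i))

{-# OPTIONS --safe #-}

module Submission where

-- Since ∏ᵢ (1 - ωⁱ z) = 1 - z ^ t, h_k at all t-th roots of unity and their inverses is k / t + 1 if t divides k,
-- and 0 otherwise. Write a beta number as t c + ρ. In the first column only rows with ρ = t - 1 are nonzero (entry
-- 2 (c + 1)); numbering the remaining columns 0, ..., t - 2, row t c + ρ has the entry c in column ρ and c + 1 in
-- column t - 2 - ρ. So the matrix splits into blocks, one for each pair of residues {ρ , t - 2 - ρ}, and the determinant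
-- vanishes unless n (t - 1) = 1 and n ρ + n (t - 2 - ρ) = 2. Peeling off the extreme residues in pairs gives the values
-- of the blocks, and the inversions of the sequence of residues, which are those of σ, absorb the row moves.
--
-- The beta-set B of the core contains t j + ρ for j < n ρ. The k-th diagonal box of the core corresponds to the k-th
-- largest element t + a of B, and the core is symplectic there iff t - 2 - a is the k-th smallest number missing from B;
-- since B has t elements, this holds for all k iff the above conditions on the n ρ hold.

open import Defs
open import Level using (Level)
open import Data.Bool using (Bool; true; false; T; if_then_else_)
open import Data.Nat as ℕ hiding (_*_)
open import Data.Nat.Properties
open import Data.Nat.DivMod using (_/_; _%_; m%n<n; m≡m%n+[m/n]*n; [m+kn]%n≡m%n; m<n⇒m%n≡m; m/n≡1+[m∸n]/n)
open import Data.Nat.Combinatorics using (_C_)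
import Data.Nat.Tactic.RingSolver as ℕSolver
open import Data.Integer as ℤ using (ℤ; +_; -[1+_]; 0ℤ; 1ℤ)
import Data.Integer.Properties as ℤₚ
open import Data.Integer.Tactic.RingSolver using (solve-∀)
open import Data.Fin as Fin using (Fin; toℕ; punchIn)
import Data.Fin.Properties as Finₚ
open import Data.Vec as Vec using (Vec; lookup)
import Data.Vec.Properties as Vecₚ
open import Data.List as List using (List; []; _∷_; length; _++_; filter; map; concatMap; upTo; applyUpTo; zipWith; foldr; reverse)
import Data.List.Properties as Listₚ
open import Data.List.Membership.Propositional using (_∈_; _∉_; find; lose)
import Data.List.Membership.Propositional.Properties as ∈ₚ
open import Data.List.Membership.DecPropositional ℕ._≟_ using (_∈?_)
open import Data.List.Relation.Unary.Any using (here; there)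
open import Data.List.Relation.Unary.All as All using (All; []; _∷_)
import Data.List.Relation.Unary.All.Properties as Allₚ
open import Data.List.Relation.Unary.AllPairs as AllPairs using (AllPairs; []; _∷_)
import Data.List.Relation.Unary.AllPairs.Properties as AllPairsₚ
open import Data.List.Relation.Unary.Linked using (Linked; []; [-]; _∷_)
import Data.List.Relation.Unary.Linked.Properties as Linkedₚ
open import Data.List.Relation.Unary.Unique.Propositional using (Unique)
import Data.List.Relation.Unary.Unique.Propositional.Properties as Uniqueₚ
open import Data.List.Relation.Binary.Permutation.Propositional using (_↭_; ↭-trans; ↭-sym; ↭-reflexive; prep; ↭⇒↭ₛ)
import Data.List.Relation.Binary.Permutation.Propositional.Properties as ↭ₚ
import Data.List.Relation.Binary.Permutation.Setoid.Properties as ↭ₛₚ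
open import Data.List.Sort ≤-decTotalOrder using (sort; sort-↭; sort-↗)
import Data.Maybe as Maybe
open import Data.Product using (Σ; ∃; _×_; _,_; proj₁; proj₂)
open import Data.Sum using (_⊎_; inj₁; inj₂)
open import Function using (_∘_)
open import Function.Bundles using (_⇔_; mk⇔)
open import Relation.Nullary hiding (det)
open import Relation.Nullary.Decidable using (_⊎-dec_)
open import Relation.Unary using (Decidable)
open import Relation.Binary.Consequences using (dec⇒weaklyDec)
open import Relation.Binary.Definitions using (Tri; tri<; tri≈; tri>)
open import Relation.Binary.PropositionalEquality
import Relation.Binary.Reasoning.Setoid as SetoidReasoning
open import Algebra.Bundles using (CommutativeRing)
import Algebra.Properties.CommutativeSemigroup as CommutativeSemigroupProperties
import Algebra.Properties.Ring as RingProperties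
import Algebra.Solver.Ring
open import Algebra.Solver.Ring.AlmostCommutativeRing using (fromCommutativeRing; _-Raw-AlmostCommutative⟶_)

-- For the row with beta number `x`, the two `h` in the `j`-th column have indices `x - t + j` and
-- `x - t - j + 2`. They coincide for `j = 1`, whence the doubled first column, whose 2 cancels the
-- `1/2` in `sp`. For other `j` the residues of `x` that make them divisible by `t` add up to
-- `t - 2`; this is the origin of the pairing. All entries are images of integers, so the
-- determinant is computed in `ℤ`; its value carries over to the ring by the homomorphism, its
-- nonvanishing by characteristic 0. Since β mixes the residues arbitrarily, the induction is about
-- the determinant times the sign of the residue sequence, a product that depends only on the list
-- of rows of each residue. Three kinds of sign remain: `(-1)^(t-1)` from the first column; one
-- determined by the count of the larger residue of each pair, which is what the binomials in
-- `epsilon` record; and `(-1)^m` for a block whose two rows share a residue, `m` being the number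
-- of columns between the two of the block. For odd `t` the first and last are trivial. For even `t`
-- they are -1 and one -1 for each residue of count 2; there are as many such residues as the rank
-- of the core, which explains `1 + r`.

-- Finite sums of integers

sumTo : ℕ → (ℕ → ℤ) → ℤ
sumTo zero    f = 0ℤ
sumTo (suc n) f = sumTo n f ℤ.+ f n

sumTo-cong : ∀ n {f g} → (∀ j → j < n → f j ≡ g j) → sumTo n f ≡ sumTo n g
sumTo-cong zero    eq = refl
sumTo-cong (suc n) eq = cong₂ ℤ._+_ (sumTo-cong n (λ j j<n → eq j (m<n⇒m<1+n j<n))) (eq n (n<1+n n))

sumTo-zero : ∀ n {f} → (∀ j → j < n → f j ≡ 0ℤ) → sumTo n f ≡ 0ℤ
sumTo-zero zero    eq = refl
sumTo-zero (suc n) eq = cong₂ ℤ._+_ (sumTo-zero n (λ j j<n → eq j (m<n⇒m<1+n j<n))) (eq n (n<1+n n))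

sumTo-head : ∀ n f → sumTo (suc n) f ≡ f 0 ℤ.+ sumTo n (f ∘ suc)
sumTo-head zero    f = ℤₚ.+-comm 0ℤ (f 0)
sumTo-head (suc n) f = trans (cong (ℤ._+ f (suc n)) (sumTo-head n f)) (ℤₚ.+-assoc (f 0) _ _)

+-interchange : ∀ a b c d → (a ℤ.+ b) ℤ.+ (c ℤ.+ d) ≡ (a ℤ.+ c) ℤ.+ (b ℤ.+ d)
+-interchange = solve-∀

sumTo-+ : ∀ n f g → sumTo n (λ j → f j ℤ.+ g j) ≡ sumTo n f ℤ.+ sumTo n g
sumTo-+ zero    f g = refl
sumTo-+ (suc n) f g = trans (cong₂ ℤ._+_ (sumTo-+ n f g) refl) (+-interchange (sumTo n f) (sumTo n g) (f n) (g n))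

sumTo-* : ∀ n c f → c ℤ.* sumTo n f ≡ sumTo n (λ j → c ℤ.* f j)
sumTo-* zero    c f = ℤₚ.*-zeroʳ c
sumTo-* (suc n) c f = trans (ℤₚ.*-distribˡ-+ c (sumTo n f) (f n)) (cong₂ ℤ._+_ (sumTo-* n c f) refl)

sumTo-neg : ∀ n f → sumTo n (λ j → ℤ.- f j) ≡ ℤ.- sumTo n f
sumTo-neg zero    f = refl
sumTo-neg (suc n) f = trans (cong₂ ℤ._+_ (sumTo-neg n f) refl) (sym (ℤₚ.neg-distrib-+ (sumTo n f) (f n)))

-- The pairs (j , l) with l an index into the complement of j, grouped by the underlying two-element set {p < 1 + q}.
sumTo-triangle : ∀ m (G : ℕ → ℕ → ℤ) →
  sumTo (suc m) (λ j → sumTo m (G j)) ≡ sumTo m (λ q → sumTo (suc q) (λ p → G p q ℤ.+ G (suc q) p))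
sumTo-triangle zero    G = refl
sumTo-triangle (suc m) G = begin
  sumTo (suc m) (λ j → sumTo m (G j) ℤ.+ G j m) ℤ.+ sumTo (suc m) (G (suc m))
    ≡⟨ cong (ℤ._+ sumTo (suc m) (G (suc m))) (sumTo-+ (suc m) (λ j → sumTo m (G j)) (λ j → G j m)) ⟩
  sumTo (suc m) (λ j → sumTo m (G j)) ℤ.+ sumTo (suc m) (λ j → G j m) ℤ.+ sumTo (suc m) (G (suc m))
    ≡⟨ ℤₚ.+-assoc (sumTo (suc m) (λ j → sumTo m (G j))) (sumTo (suc m) (λ j → G j m)) (sumTo (suc m) (G (suc m))) ⟩
  sumTo (suc m) (λ j → sumTo m (G j)) ℤ.+ (sumTo (suc m) (λ j → G j m) ℤ.+ sumTo (suc m) (G (suc m)))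
    ≡⟨ cong₂ ℤ._+_ (sumTo-triangle m G) (sym (sumTo-+ (suc m) (λ j → G j m) (G (suc m)))) ⟩
  sumTo m (λ q → sumTo (suc q) (λ p → G p q ℤ.+ G (suc q) p)) ℤ.+ sumTo (suc m) (λ p → G p m ℤ.+ G (suc m) p) ∎
  where open ≡-Reasoning

sumTo-ends : ∀ n f → (∀ j → 0 < j → j < suc n → f j ≡ 0ℤ) → sumTo (2 + n) f ≡ f 0 ℤ.+ f (suc n)
sumTo-ends n f eq = cong (ℤ._+ f (suc n)) (begin
  sumTo (suc n) f              ≡⟨ sumTo-head n f ⟩
  f 0 ℤ.+ sumTo n (f ∘ suc)    ≡⟨ cong (λ u → f 0 ℤ.+ u) (sumTo-zero n (λ j j<n → eq (suc j) z<s (s<s j<n))) ⟩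
  f 0 ℤ.+ 0ℤ                   ≡⟨ ℤₚ.+-identityʳ (f 0) ⟩
  f 0                          ∎)
  where open ≡-Reasoning

-- Laplace determinants whose rows are listed by natural-number keys

-- `punchIn` on unbounded indices, so that no `Fin` bounds have to be transported when the size of a
-- minor is the length of a list.
skip : ℕ → ℕ → ℕ
skip zero    q       = suc q
skip (suc j) zero    = zero
skip (suc j) (suc q) = suc (skip j q)

skip-< : ∀ {j q} → q < j → skip j q ≡ q
skip-< {suc j} {zero}  _         = refl
skip-< {suc j} {suc q} (s<s q<j) = cong suc (skip-< q<j)

skip-≥ : ∀ {j q} → j ≤ q → skip j q ≡ suc q
skip-≥ {zero}          _         = refl
skip-≥ {suc j} {suc q} (s≤s j≤q) = cong suc (skip-≥ j≤q)

-- The cosimplicial identity of coface maps; it says that two columns can be deleted in either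
-- order.
skip-skip : ∀ {p q} x → p ≤ q → skip (suc q) (skip p x) ≡ skip p (skip q x)
skip-skip {zero}          x       _         = refl
skip-skip {suc p} {suc q} zero    _         = refl
skip-skip {suc p} {suc q} (suc x) (s≤s p≤q) = cong suc (skip-skip x p≤q)

skip-bound : ∀ j {q n} → q < n → skip j q < suc n
skip-bound zero    q<n                    = s<s q<n
skip-bound (suc j) {zero}  _              = z<s
skip-bound (suc j) {suc q} {suc n} (s<s q<n) = s<s (skip-bound j q<n)

toℕ-punchIn : ∀ {n} (j : Fin (suc n)) (b : Fin n) → toℕ (punchIn j b) ≡ skip (toℕ j) (toℕ b)
toℕ-punchIn Fin.zero    b           = refl
toℕ-punchIn (Fin.suc j) Fin.zero    = refl
toℕ-punchIn (Fin.suc j) (Fin.suc b) = cong suc (toℕ-punchIn j b)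

Entries : Set
Entries = ℕ → ℕ → ℤ

minor : ℕ → Entries → Entries
minor j E x q = E x (skip j q)

-- Only columns are addressed by position. Reordering or removing rows changes the list alone and
-- leaves the matrix `E` as it is.
D : Entries → List ℕ → ℤ
D E []       = 1ℤ
D E (r ∷ rs) = sumTo (suc (length rs)) (λ j → negOnePow j ℤ.* (E r j ℤ.* D (minor j E) rs))

D-cong : ∀ {E E'} rs → (∀ x q → x ∈ rs → q < length rs → E x q ≡ E' x q) → D E rs ≡ D E' rs
D-cong []       eq = refl
D-cong (r ∷ rs) eq = sumTo-cong (suc (length rs)) λ j j< →
  cong (negOnePow j ℤ.*_) (cong₂ ℤ._*_ (eq r j (here refl) j<)
    (D-cong rs (λ x q x∈ q< → eq x (skip j q) (there x∈) (skip-bound j q<))))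

-- In the expansion along the first two rows each pair of columns `p < suc q` occurs twice,
-- according to which row takes which column. Exchanging the rows exchanges the two terms and
-- changes their signs (`transpose`).
D-swap : ∀ E a b rs → D E (a ∷ b ∷ rs) ≡ ℤ.- D E (b ∷ a ∷ rs)
D-swap E a b rs = begin
  D E (a ∷ b ∷ rs)
    ≡⟨ expand a b ⟩
  sumTo (suc m) (λ q → sumTo (suc q) (λ p → G a b p q ℤ.+ G a b (suc q) p))
    ≡⟨ sumTo-cong (suc m) (λ q _ → trans (sumTo-cong (suc q) (λ p p< → anti p q (s≤s⁻¹ p<))) (sumTo-neg (suc q) _)) ⟩
  sumTo (suc m) (λ q → ℤ.- sumTo (suc q) (λ p → G b a p q ℤ.+ G b a (suc q) p))
    ≡⟨ sumTo-neg (suc m) _ ⟩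
  ℤ.- sumTo (suc m) (λ q → sumTo (suc q) (λ p → G b a p q ℤ.+ G b a (suc q) p))
    ≡⟨ cong ℤ.-_ (expand b a) ⟨
  ℤ.- D E (b ∷ a ∷ rs) ∎
  where
  open ≡-Reasoning
  m = length rs
  G : ℕ → ℕ → ℕ → ℕ → ℤ
  G a b j l = negOnePow j ℤ.* (E a j ℤ.* (negOnePow l ℤ.* (E b (skip j l) ℤ.* D (minor l (minor j E)) rs)))
  pull : ∀ a b j → negOnePow j ℤ.* (E a j ℤ.* D (minor j E) (b ∷ rs)) ≡ sumTo (suc m) (G a b j)
  pull a b j = trans (cong (negOnePow j ℤ.*_) (sumTo-* (suc m) (E a j) _)) (sumTo-* (suc m) (negOnePow j) _)
  expand : ∀ a b → D E (a ∷ b ∷ rs) ≡ sumTo (suc m) (λ q → sumTo (suc q) (λ p → G a b p q ℤ.+ G a b (suc q) p))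
  expand a b = trans (sumTo-cong (2 + m) (λ j _ → pull a b j)) (sumTo-triangle (suc m) (G a b))
  alg : ∀ e f x y d → ℤ.- e ℤ.* (x ℤ.* (f ℤ.* (y ℤ.* d))) ≡ ℤ.- (f ℤ.* (y ℤ.* (e ℤ.* (x ℤ.* d))))
  alg = solve-∀
  transpose : ∀ a b p q → p ≤ q → G a b (suc q) p ≡ ℤ.- G b a p q
  transpose a b p q p≤q = begin
    G a b (suc q) p
      ≡⟨ cong₂ (λ u v → negOnePow (suc q) ℤ.* (E a (suc q) ℤ.* (negOnePow p ℤ.* (E b u ℤ.* v))))
               (skip-< (s≤s p≤q)) (D-cong rs (λ x y _ _ → cong (E x) (skip-skip y p≤q))) ⟩
    negOnePow (suc q) ℤ.* (E a (suc q) ℤ.* (negOnePow p ℤ.* (E b p ℤ.* D (minor q (minor p E)) rs)))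
      ≡⟨ alg (negOnePow q) (negOnePow p) (E a (suc q)) (E b p) (D (minor q (minor p E)) rs) ⟩
    ℤ.- (negOnePow p ℤ.* (E b p ℤ.* (negOnePow q ℤ.* (E a (suc q) ℤ.* D (minor q (minor p E)) rs))))
      ≡⟨ cong (λ u → ℤ.- (negOnePow p ℤ.* (E b p ℤ.* (negOnePow q ℤ.* (E a u ℤ.* D (minor q (minor p E)) rs))))) (skip-≥ p≤q) ⟨
    ℤ.- G b a p q ∎
  anti : ∀ p q → p ≤ q → G a b p q ℤ.+ G a b (suc q) p ≡ ℤ.- (G b a p q ℤ.+ G b a (suc q) p)
  anti p q p≤q = begin
    G a b p q ℤ.+ G a b (suc q) p
      ≡⟨ cong₂ ℤ._+_ (ℤₚ.neg-involutive (G a b p q)) (sym (transpose a b p q p≤q)) ⟨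
    ℤ.- ℤ.- G a b p q ℤ.+ ℤ.- G b a p q
      ≡⟨ cong (λ u → ℤ.- u ℤ.+ ℤ.- G b a p q) (transpose b a p q p≤q) ⟨
    ℤ.- G b a (suc q) p ℤ.+ ℤ.- G b a p q
      ≡⟨ ℤₚ.+-comm (ℤ.- G b a (suc q) p) _ ⟩
    ℤ.- G b a p q ℤ.+ ℤ.- G b a (suc q) p
      ≡⟨ ℤₚ.neg-distrib-+ (G b a p q) _ ⟨
    ℤ.- (G b a p q ℤ.+ G b a (suc q) p) ∎

negOnePow-+ : ∀ m n → negOnePow (m + n) ≡ negOnePow m ℤ.* negOnePow n
negOnePow-+ zero    n = sym (ℤₚ.*-identityˡ _)
negOnePow-+ (suc m) n = trans (cong ℤ.-_ (negOnePow-+ m n)) (ℤₚ.neg-distribˡ-* (negOnePow m) _)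

negOnePow-square : ∀ n → negOnePow n ℤ.* negOnePow n ≡ 1ℤ
negOnePow-square zero    = refl
negOnePow-square (suc n) = trans (alg (negOnePow n)) (negOnePow-square n)
  where
  alg : ∀ x → ℤ.- x ℤ.* ℤ.- x ≡ x ℤ.* x
  alg = solve-∀

negOnePow-cancel : ∀ n x → negOnePow n ℤ.* negOnePow n ℤ.* x ≡ x
negOnePow-cancel n x = trans (cong (ℤ._* x) (negOnePow-square n)) (ℤₚ.*-identityˡ x)

length-insert : ∀ xs (r : ℕ) ys → length (xs ++ r ∷ ys) ≡ suc (length (xs ++ ys))
length-insert xs r ys = trans (Listₚ.length-++ xs) (trans (+-suc (length xs) (length ys)) (cong suc (sym (Listₚ.length-++ xs))))

-- Induction under the first row: in every minor `r` is moved to the front of the remaining rows,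
-- and one `D-swap` then carries it past `x`.
D-front : ∀ E xs r ys → D E (xs ++ r ∷ ys) ≡ negOnePow (length xs) ℤ.* D E (r ∷ xs ++ ys)
D-front E []       r ys = sym (ℤₚ.*-identityˡ _)
D-front E (x ∷ xs) r ys = begin
  D E (x ∷ xs ++ r ∷ ys)
    ≡⟨ cong (λ n → sumTo (suc n) (λ j → negOnePow j ℤ.* (E x j ℤ.* D (minor j E) (xs ++ r ∷ ys)))) (length-insert xs r ys) ⟩
  sumTo (2 + length (xs ++ ys)) (λ j → negOnePow j ℤ.* (E x j ℤ.* D (minor j E) (xs ++ r ∷ ys)))
    ≡⟨ sumTo-cong (2 + length (xs ++ ys)) (λ j _ → step j) ⟩
  sumTo (2 + length (xs ++ ys)) (λ j → negOnePow (length xs) ℤ.* (negOnePow j ℤ.* (E x j ℤ.* D (minor j E) (r ∷ xs ++ ys))))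
    ≡⟨ sumTo-* (2 + length (xs ++ ys)) (negOnePow (length xs)) _ ⟨
  negOnePow (length xs) ℤ.* D E (x ∷ r ∷ xs ++ ys)
    ≡⟨ cong (negOnePow (length xs) ℤ.*_) (D-swap E x r (xs ++ ys)) ⟩
  negOnePow (length xs) ℤ.* ℤ.- D E (r ∷ x ∷ xs ++ ys)
    ≡⟨ neg-move (negOnePow (length xs)) _ ⟩
  negOnePow (suc (length xs)) ℤ.* D E (r ∷ x ∷ xs ++ ys) ∎
  where
  open ≡-Reasoning
  alg : ∀ e x s d → e ℤ.* (x ℤ.* (s ℤ.* d)) ≡ s ℤ.* (e ℤ.* (x ℤ.* d))
  alg = solve-∀
  neg-move : ∀ a b → a ℤ.* ℤ.- b ≡ ℤ.- a ℤ.* b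
  neg-move = solve-∀
  step : ∀ j → negOnePow j ℤ.* (E x j ℤ.* D (minor j E) (xs ++ r ∷ ys)) ≡
               negOnePow (length xs) ℤ.* (negOnePow j ℤ.* (E x j ℤ.* D (minor j E) (r ∷ xs ++ ys)))
  step j = trans (cong (λ u → negOnePow j ℤ.* (E x j ℤ.* u)) (D-front (minor j E) xs r ys))
                 (alg (negOnePow j) (E x j) (negOnePow (length xs)) _)

term-zeroˡ : ∀ e {x} d → x ≡ 0ℤ → e ℤ.* (x ℤ.* d) ≡ 0ℤ
term-zeroˡ e d refl = ℤₚ.*-zeroʳ e

term-zeroʳ : ∀ e x {d} → d ≡ 0ℤ → e ℤ.* (x ℤ.* d) ≡ 0ℤ
term-zeroʳ e x refl = trans (cong (e ℤ.*_) (ℤₚ.*-zeroʳ x)) (ℤₚ.*-zeroʳ e)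

D-zero-row : ∀ {E} xs r ys → (∀ q → q < length (r ∷ xs ++ ys) → E r q ≡ 0ℤ) → D E (xs ++ r ∷ ys) ≡ 0ℤ
D-zero-row {E} xs r ys eq = trans (D-front E xs r ys) (trans (cong (negOnePow (length xs) ℤ.*_)
  (sumTo-zero (suc (length (xs ++ ys))) λ j j< → term-zeroˡ (negOnePow j) _ (eq j j<))) (ℤₚ.*-zeroʳ (negOnePow (length xs))))

-- In the minor without column `j`, the zero column keeps its index `k` if `k < j` and gets index
-- `pred k` if `j < k`; for `j ≡ k` the coefficient itself is zero.
D-zero-column : ∀ {E} rs k → k < length rs → All (λ x → E x k ≡ 0ℤ) rs → D E rs ≡ 0ℤ
D-zero-column {E} (r ∷ rs) k k< (Er ∷ Ers) = sumTo-zero (suc (length rs)) λ j j< → go j j< (<-cmp j k)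
  where
  go : ∀ j → j < suc (length rs) → Tri (j < k) (j ≡ k) (k < j) →
       negOnePow j ℤ.* (E r j ℤ.* D (minor j E) rs) ≡ 0ℤ
  go j j< (tri≈ _ refl _) = term-zeroˡ (negOnePow j) _ Er
  go j j< (tri> _ _ k<j) = term-zeroʳ (negOnePow j) (E r j) (D-zero-column rs k (<-≤-trans k<j (s≤s⁻¹ j<))
    (All.map (λ {x} eq → trans (cong (E x) (skip-< k<j)) eq) Ers))
  go j j< (tri< j<k _ _) = term-zeroʳ (negOnePow j) (E r j) (D-zero-column rs (pred k)
    (s≤s⁻¹ (subst (_< suc (length rs)) (sym suc-pred-k) k<))
    (All.map (λ {x} eq → trans (cong (E x) (trans (skip-≥ (<⇒≤pred j<k)) suc-pred-k)) eq) Ers))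
    where
    suc-pred-k : suc (pred k) ≡ k
    suc-pred-k = suc-pred k {{>-nonZero (≤-<-trans z≤n j<k)}}

-- Laplace expansion along two rows supported on the two outermost columns. The sign appears because
-- the last column has index `n` once column 0 is deleted.
D-corner : ∀ {E} n r s rs → length rs ≡ n →
  (∀ j → 0 < j → j < suc n → E r j ≡ 0ℤ) → (∀ j → 0 < j → j < suc n → E s j ≡ 0ℤ) →
  D E (r ∷ s ∷ rs) ≡ negOnePow n ℤ.* (E r 0 ℤ.* E s (suc n) ℤ.- E r (suc n) ℤ.* E s 0) ℤ.* D (λ x q → E x (suc q)) rs
D-corner {E} n r s rs refl Er Es = begin
  D E (r ∷ s ∷ rs)
    ≡⟨ sumTo-ends n _ (λ j 0<j j< → term-zeroˡ (negOnePow j) _ (Er j 0<j j<)) ⟩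
  1ℤ ℤ.* (E r 0 ℤ.* D (minor 0 E) (s ∷ rs)) ℤ.+ negOnePow (suc n) ℤ.* (E r (suc n) ℤ.* D (minor (suc n) E) (s ∷ rs))
    ≡⟨ cong₂ (λ u v → 1ℤ ℤ.* (E r 0 ℤ.* u) ℤ.+ negOnePow (suc n) ℤ.* (E r (suc n) ℤ.* v)) left right ⟩
  1ℤ ℤ.* (E r 0 ℤ.* (negOnePow n ℤ.* (E s (suc n) ℤ.* d))) ℤ.+ negOnePow (suc n) ℤ.* (E r (suc n) ℤ.* (E s 0 ℤ.* d))
    ≡⟨ alg (negOnePow n) (E r 0) (E s (suc n)) (E r (suc n)) (E s 0) d ⟩
  negOnePow n ℤ.* (E r 0 ℤ.* E s (suc n) ℤ.- E r (suc n) ℤ.* E s 0) ℤ.* d ∎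
  where
  open ≡-Reasoning
  d = D (λ x q → E x (suc q)) rs
  alg : ∀ e a b a' b' d → 1ℤ ℤ.* (a ℤ.* (e ℤ.* (b ℤ.* d))) ℤ.+ ℤ.- e ℤ.* (a' ℤ.* (b' ℤ.* d)) ≡
                          e ℤ.* (a ℤ.* b ℤ.- a' ℤ.* b') ℤ.* d
  alg = solve-∀
  left : D (minor 0 E) (s ∷ rs) ≡ negOnePow n ℤ.* (E s (suc n) ℤ.* d)
  left = begin
    sumTo n (λ j → negOnePow j ℤ.* (E s (suc j) ℤ.* D (minor j (minor 0 E)) rs)) ℤ.+ _
      ≡⟨ cong (ℤ._+ (negOnePow n ℤ.* (E s (suc n) ℤ.* D (minor n (minor 0 E)) rs)))
              (sumTo-zero n (λ j j<n → term-zeroˡ (negOnePow j) _ (Es (suc j) z<s (s<s j<n)))) ⟩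
    0ℤ ℤ.+ negOnePow n ℤ.* (E s (suc n) ℤ.* D (minor n (minor 0 E)) rs)
      ≡⟨ ℤₚ.+-identityˡ _ ⟩
    negOnePow n ℤ.* (E s (suc n) ℤ.* D (minor n (minor 0 E)) rs)
      ≡⟨ cong (λ u → negOnePow n ℤ.* (E s (suc n) ℤ.* u)) (D-cong rs (λ x q _ q< → cong (E x ∘ suc) (skip-< q<))) ⟩
    negOnePow n ℤ.* (E s (suc n) ℤ.* d) ∎
  right : D (minor (suc n) E) (s ∷ rs) ≡ E s 0 ℤ.* d
  right = begin
    D (minor (suc n) E) (s ∷ rs)
      ≡⟨ sumTo-head n _ ⟩
    1ℤ ℤ.* (E s 0 ℤ.* D (minor 0 (minor (suc n) E)) rs) ℤ.+
      sumTo n (λ j → negOnePow (suc j) ℤ.* (E s (suc (skip n j)) ℤ.* D (minor (suc j) (minor (suc n) E)) rs))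
      ≡⟨ cong₂ ℤ._+_ (cong (λ u → 1ℤ ℤ.* (E s 0 ℤ.* u)) (D-cong rs (λ x q _ q< → cong (E x ∘ suc) (skip-< q<))))
                     (sumTo-zero n λ j j<n → term-zeroˡ (negOnePow (suc j)) _
                       (trans (cong (E s ∘ suc) (skip-< j<n)) (Es (suc j) z<s (s<s j<n)))) ⟩
    1ℤ ℤ.* (E s 0 ℤ.* d) ℤ.+ 0ℤ
      ≡⟨ trans (ℤₚ.+-identityʳ _) (ℤₚ.*-identityˡ _) ⟩
    E s 0 ℤ.* d ∎

-- From `det` over the integers to `D`

ℤ-ring : CommutativeRing _ _
ℤ-ring = ℤₚ.+-*-commutativeRing

sumFin-sumTo : ∀ n f g → (∀ j → f j ≡ g (toℕ j)) → sumFin ℤ-ring n f ≡ sumTo n g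
sumFin-sumTo zero    f g eq = refl
sumFin-sumTo (suc n) f g eq = trans (cong₂ ℤ._+_ (eq Fin.zero) (sumFin-sumTo n _ (g ∘ suc) (eq ∘ Fin.suc))) (sym (sumTo-head n g))

signed-negOnePow : ∀ n x → signed ℤ-ring n x ≡ negOnePow n ℤ.* x
signed-negOnePow zero    x = sym (ℤₚ.*-identityˡ x)
signed-negOnePow (suc n) x = trans (cong ℤ.-_ (signed-negOnePow n x)) (ℤₚ.neg-distribˡ-* (negOnePow n) x)

det-D : ∀ n (v : Vec ℕ n) E (M : Fin n → Fin n → ℤ) → (∀ a b → M a b ≡ E (Vec.lookup v a) (toℕ b)) →
  det ℤ-ring n M ≡ D E (Vec.toList v)
det-D zero    Vec.[]       E M eq = refl
det-D (suc n) (x Vec.∷ v) E M eq = trans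
  (sumFin-sumTo (suc n) _ (λ j → negOnePow j ℤ.* (E x j ℤ.* D (minor j E) (Vec.toList v))) λ j →
    trans (signed-negOnePow (toℕ j) _) (cong (negOnePow (toℕ j) ℤ.*_) (cong₂ ℤ._*_ (eq Fin.zero j)
      (det-D n v (minor (toℕ j) E) _ λ a b → trans (eq (Fin.suc a) (punchIn j b)) (cong (E _) (toℕ-punchIn j b))))))
  (cong (λ m → sumTo (suc m) (λ j → negOnePow j ℤ.* (E x j ℤ.* D (minor j E) (Vec.toList v)))) (sym (len v)))
  where
  len : ∀ {n} (v : Vec ℕ n) → length (Vec.toList v) ≡ n
  len Vec.[]       = refl
  len (_ Vec.∷ v) = cong suc (len v)

-- Complete homogeneous symmetric polynomials at roots of unity

module OverRing {c ℓ : Level} (R : CommutativeRing c ℓ) where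
  open CommutativeRing R using (Carrier; _≈_; 0#; 1#; ring; distribˡ; distribʳ; -‿inverseʳ) renaming
    (_+_ to _⊞_; _*_ to _⊠_; -_ to ⊟_; refl to ≈-refl; sym to ≈-sym; trans to ≈-trans; reflexive to ≈-reflexive;
     +-cong to ⊞-cong; *-cong to ⊠-cong; -‿cong to ⊟-cong; +-identityˡ to ⊞-identityˡ; +-identityʳ to ⊞-identityʳ;
     *-identityˡ to ⊠-identityˡ; *-assoc to ⊠-assoc; +-assoc to ⊞-assoc; +-comm to ⊞-comm; zeroˡ to ⊠-zeroˡ; zeroʳ to ⊠-zeroʳ)
  open RingProperties ring using (-0#≈0#; -‿involutive; -‿+-comm; -‿distribˡ-*; -‿distribʳ-*)
  open CommutativeSemigroupProperties (CommutativeRing.+-commutativeSemigroup R) using (interchange)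
  open SetoidReasoning (CommutativeRing.setoid R)

  -- Images of integers in a commutative ring

  natR-+ : ∀ m n → natR R (m + n) ≈ natR R m ⊞ natR R n
  natR-+ zero    n = ≈-sym (⊞-identityˡ _)
  natR-+ (suc m) n = ≈-trans (⊞-cong ≈-refl (natR-+ m n)) (≈-sym (⊞-assoc 1# (natR R m) (natR R n)))

  natR-* : ∀ m n → natR R (m ℕ.* n) ≈ natR R m ⊠ natR R n
  natR-* zero    n = ≈-sym (⊠-zeroˡ _)
  natR-* (suc m) n = begin
    natR R (n + m ℕ.* n)                      ≈⟨ natR-+ n (m ℕ.* n) ⟩
    natR R n ⊞ natR R (m ℕ.* n)               ≈⟨ ⊞-cong (≈-sym (⊠-identityˡ _)) (natR-* m n) ⟩
    1# ⊠ natR R n ⊞ natR R m ⊠ natR R n     ≈⟨ distribʳ (natR R n) 1# (natR R m) ⟨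
    natR R (suc m) ⊠ natR R n               ∎

  fromℤ-neg : ∀ x → fromℤ R (ℤ.- x) ≈ ⊟ fromℤ R x
  fromℤ-neg (+ zero)  = ≈-sym -0#≈0#
  fromℤ-neg (+ suc n) = ≈-refl
  fromℤ-neg -[1+ n ]  = ≈-sym (-‿involutive (natR R (suc n)))

  fromℤ-⊖ : ∀ m n → fromℤ R (m ℤ.⊖ n) ≈ natR R m ⊞ ⊟ natR R n
  fromℤ-⊖ m zero = ≈-trans (≈-reflexive (cong (fromℤ R) (ℤₚ.⊖-≥ {m} z≤n))) (≈-sym (≈-trans (⊞-cong ≈-refl -0#≈0#) (⊞-identityʳ _)))
  fromℤ-⊖ zero (suc n) = ≈-sym (⊞-identityˡ _)
  fromℤ-⊖ (suc m) (suc n) = begin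
    fromℤ R (suc m ℤ.⊖ suc n)                       ≡⟨ cong (fromℤ R) (ℤₚ.[1+m]⊖[1+n]≡m⊖n m n) ⟩
    fromℤ R (m ℤ.⊖ n)                               ≈⟨ fromℤ-⊖ m n ⟩
    natR R m ⊞ ⊟ natR R n                           ≈⟨ ⊞-identityˡ _ ⟨
    0# ⊞ (natR R m ⊞ ⊟ natR R n)                    ≈⟨ ⊞-cong (-‿inverseʳ 1#) ≈-refl ⟨
    (1# ⊞ ⊟ 1#) ⊞ (natR R m ⊞ ⊟ natR R n)           ≈⟨ interchange 1# (⊟ 1#) (natR R m) (⊟ natR R n) ⟩
    (1# ⊞ natR R m) ⊞ (⊟ 1# ⊞ ⊟ natR R n)           ≈⟨ ⊞-cong ≈-refl (-‿+-comm 1# (natR R n)) ⟩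
    natR R (suc m) ⊞ ⊟ natR R (suc n)               ∎

  fromℤ-+ : ∀ x y → fromℤ R (x ℤ.+ y) ≈ fromℤ R x ⊞ fromℤ R y
  fromℤ-+ (+ m)    (+ n)    = natR-+ m n
  fromℤ-+ (+ m)    -[1+ n ] = fromℤ-⊖ m (suc n)
  fromℤ-+ -[1+ m ] (+ n)    = ≈-trans (fromℤ-⊖ n (suc m)) (⊞-comm _ _)
  fromℤ-+ -[1+ m ] -[1+ n ] = begin
    ⊟ natR R (suc (suc (m + n)))             ≡⟨ cong (λ k → ⊟ natR R (suc k)) (+-suc m n) ⟨
    ⊟ natR R (suc m + suc n)                 ≈⟨ ⊟-cong (natR-+ (suc m) (suc n)) ⟩
    ⊟ (natR R (suc m) ⊞ natR R (suc n))      ≈⟨ -‿+-comm _ _ ⟨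
    ⊟ natR R (suc m) ⊞ ⊟ natR R (suc n)      ∎

  fromℤ-pos-* : ∀ m y → fromℤ R (+ m ℤ.* y) ≈ natR R m ⊠ fromℤ R y
  fromℤ-pos-* m (+ n)    = ≈-trans (≈-reflexive (cong (fromℤ R) (sym (ℤₚ.pos-* m n)))) (natR-* m n)
  fromℤ-pos-* m -[1+ n ] = begin
    fromℤ R (+ m ℤ.* -[1+ n ])           ≡⟨ cong (fromℤ R) (ℤₚ.neg-distribʳ-* (+ m) (+ suc n)) ⟨
    fromℤ R (ℤ.- (+ m ℤ.* + suc n))      ≈⟨ fromℤ-neg (+ m ℤ.* + suc n) ⟩
    ⊟ fromℤ R (+ m ℤ.* + suc n)          ≈⟨ ⊟-cong (fromℤ-pos-* m (+ suc n)) ⟩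
    ⊟ (natR R m ⊠ natR R (suc n))        ≈⟨ -‿distribʳ-* (natR R m) (natR R (suc n)) ⟩
    natR R m ⊠ ⊟ natR R (suc n)          ∎

  fromℤ-* : ∀ x y → fromℤ R (x ℤ.* y) ≈ fromℤ R x ⊠ fromℤ R y
  fromℤ-* (+ m)    y = fromℤ-pos-* m y
  fromℤ-* -[1+ m ] y = begin
    fromℤ R (-[1+ m ] ℤ.* y)        ≡⟨ cong (fromℤ R) (ℤₚ.neg-distribˡ-* (+ suc m) y) ⟨
    fromℤ R (ℤ.- (+ suc m ℤ.* y))   ≈⟨ fromℤ-neg (+ suc m ℤ.* y) ⟩
    ⊟ fromℤ R (+ suc m ℤ.* y)       ≈⟨ ⊟-cong (fromℤ-pos-* (suc m) y) ⟩
    ⊟ (natR R (suc m) ⊠ fromℤ R y)  ≈⟨ -‿distribˡ-* (natR R (suc m)) (fromℤ R y) ⟩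
    ⊟ natR R (suc m) ⊠ fromℤ R y    ∎

  fromℤ-sumFin : ∀ n {f g} → (∀ j → f j ≈ fromℤ R (g j)) → sumFin R n f ≈ fromℤ R (sumFin ℤ-ring n g)
  fromℤ-sumFin zero    eq = ≈-refl
  fromℤ-sumFin (suc n) {g = g} eq = ≈-trans (⊞-cong (eq Fin.zero) (fromℤ-sumFin n {g = g ∘ Fin.suc} (eq ∘ Fin.suc)))
    (≈-sym (fromℤ-+ (g Fin.zero) _))

  fromℤ-signed : ∀ n {x y} → x ≈ fromℤ R y → signed R n x ≈ fromℤ R (signed ℤ-ring n y)
  fromℤ-signed zero    eq = eq
  fromℤ-signed (suc n) {y = y} eq = ≈-trans (⊟-cong (fromℤ-signed n {y = y} eq)) (≈-sym (fromℤ-neg (signed ℤ-ring n y)))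

  -- Lets the determinant be evaluated in `ℤ`, where equality with zero is decidable and products of
  -- nonzero factors are nonzero.
  fromℤ-det : ∀ n {M N} → (∀ a b → M a b ≈ fromℤ R (N a b)) → det R n M ≈ fromℤ R (det ℤ-ring n N)
  fromℤ-det zero    eq = ≈-sym (⊞-identityʳ 1#)
  fromℤ-det (suc n) {M} {N} eq = fromℤ-sumFin (suc n) {g = λ j → signed ℤ-ring (toℕ j) (N Fin.zero j ℤ.* det ℤ-ring n (λ a b → N (Fin.suc a) (punchIn j b)))} λ j → fromℤ-signed (toℕ j)
    (≈-trans (⊠-cong (eq Fin.zero j) (fromℤ-det n {N = λ a b → N (Fin.suc a) (punchIn j b)} (λ a b → eq (Fin.suc a) (punchIn j b)))) (≈-sym (fromℤ-* (N Fin.zero j) _)))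

  private
    -- fromℤ, except that the image of 1 is 1# on the nose (natR R 1 is 1# ⊞ 0#), as the solver needs it.
    ι : ℤ → Carrier
    ι (+ 1) = 1#
    ι x     = fromℤ R x

    ι≈fromℤ : ∀ x → ι x ≈ fromℤ R x
    ι≈fromℤ (+ 0)           = ≈-refl
    ι≈fromℤ (+ 1)           = ≈-sym (⊞-identityʳ 1#)
    ι≈fromℤ (+ suc (suc n)) = ≈-refl
    ι≈fromℤ -[1+ n ]        = ≈-refl

    ι-hom : ℤ.+-*-rawRing -Raw-AlmostCommutative⟶ fromCommutativeRing R
    ι-hom = record
      { ⟦_⟧    = ι
      ; +-homo = λ x y → ≈-trans (ι≈fromℤ (x ℤ.+ y)) (≈-trans (fromℤ-+ x y) (≈-sym (⊞-cong (ι≈fromℤ x) (ι≈fromℤ y))))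
      ; *-homo = λ x y → ≈-trans (ι≈fromℤ (x ℤ.* y)) (≈-trans (fromℤ-* x y) (≈-sym (⊠-cong (ι≈fromℤ x) (ι≈fromℤ y))))
      ; -‿homo = λ x → ≈-trans (ι≈fromℤ (ℤ.- x)) (≈-trans (fromℤ-neg x) (≈-sym (⊟-cong (ι≈fromℤ x))))
      ; 0-homo = ≈-refl
      ; 1-homo = ≈-refl
      }

  open Algebra.Solver.Ring ℤ.+-*-rawRing (fromCommutativeRing R) ι-hom
    (λ x y → Maybe.map (λ eq → ≈-reflexive (cong ι eq)) (dec⇒weaklyDec ℤ._≟_ x y))
    using (solve; _:=_; _:+_; _:*_; :-_; con)

  -- Formal power series as sequences of coefficients

  Seq : Set c
  Seq = ℕ → Carrier

  infix 4 _≋_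
  _≋_ : Seq → Seq → Set ℓ
  s ≋ s' = ∀ k → s k ≈ s' k

  ≋-trans : ∀ {s s' s''} → s ≋ s' → s' ≋ s'' → s ≋ s''
  ≋-trans p q k = ≈-trans (p k) (q k)

  ≋-sym : ∀ {s s'} → s ≋ s' → s' ≋ s
  ≋-sym p k = ≈-sym (p k)

  δ : Seq
  δ zero    = 1#
  δ (suc _) = 0#

  shift : Seq → Seq
  shift s zero    = 0#
  shift s (suc k) = s k

  -- Multiplication of the generating function of s by 1 - x z.
  mulBy : Carrier → Seq → Seq
  mulBy x s k = s k ⊞ ⊟ (x ⊠ shift s k)

  mulAll : List Carrier → Seq → Seq
  mulAll xs s = List.foldr mulBy s xs

  shift-cong : ∀ {s s'} → s ≋ s' → shift s ≋ shift s'
  shift-cong eq zero    = ≈-refl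
  shift-cong eq (suc k) = eq k

  mulBy-cong : ∀ {x y s s'} → x ≈ y → s ≋ s' → mulBy x s ≋ mulBy y s'
  mulBy-cong x≈y eq k = ⊞-cong (eq k) (⊟-cong (⊠-cong x≈y (shift-cong eq k)))

  mulAll-cong : ∀ xs {s s'} → s ≋ s' → mulAll xs s ≋ mulAll xs s'
  mulAll-cong []       eq = eq
  mulAll-cong (x ∷ xs) eq = mulBy-cong ≈-refl (mulAll-cong xs eq)

  mulBy-comm : ∀ x y s → mulBy x (mulBy y s) ≋ mulBy y (mulBy x s)
  mulBy-comm x y s zero    = alg x y (s 0)
    where
    alg : ∀ x y a → (a ⊞ ⊟ (y ⊠ 0#)) ⊞ ⊟ (x ⊠ 0#) ≈ (a ⊞ ⊟ (x ⊠ 0#)) ⊞ ⊟ (y ⊠ 0#)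
    alg = solve 3 (λ x y a → (a :+ :- (y :* con 0ℤ)) :+ :- (x :* con 0ℤ) := (a :+ :- (x :* con 0ℤ)) :+ :- (y :* con 0ℤ)) ≈-refl
  mulBy-comm x y s (suc k) = alg x y (s (suc k)) (s k) (shift s k)
    where
    alg : ∀ x y a b c → (a ⊞ ⊟ (y ⊠ b)) ⊞ ⊟ (x ⊠ (b ⊞ ⊟ (y ⊠ c))) ≈ (a ⊞ ⊟ (x ⊠ b)) ⊞ ⊟ (y ⊠ (b ⊞ ⊟ (x ⊠ c)))
    alg = solve 5 (λ x y a b c → (a :+ :- (y :* b)) :+ :- (x :* (b :+ :- (y :* c))) := (a :+ :- (x :* b)) :+ :- (y :* (b :+ :- (x :* c)))) ≈-refl

  mulBy-mulAll : ∀ x xs s → mulBy x (mulAll xs s) ≋ mulAll xs (mulBy x s)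
  mulBy-mulAll x []       s = λ _ → ≈-refl
  mulBy-mulAll x (y ∷ xs) s = ≋-trans (mulBy-comm x y (mulAll xs s)) (mulBy-cong ≈-refl (mulBy-mulAll x xs s))

  -- The factor `1 - x z` has constant term 1, so each coefficient of `s` is recovered from the
  -- product and the preceding coefficient.
  mulBy-injective : ∀ x {s s'} → mulBy x s ≋ mulBy x s' → s ≋ s'
  mulBy-injective x {s} {s'} eq k = begin
    s k                          ≈⟨ alg (s k) x (shift s k) ⟩
    mulBy x s k ⊞ x ⊠ shift s k   ≈⟨ ⊞-cong (eq k) (⊠-cong ≈-refl (prev k)) ⟩
    mulBy x s' k ⊞ x ⊠ shift s' k ≈⟨ alg (s' k) x (shift s' k) ⟨
    s' k                         ∎
    where
    alg : ∀ a x b → a ≈ (a ⊞ ⊟ (x ⊠ b)) ⊞ x ⊠ b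
    alg = solve 3 (λ a x b → a := (a :+ :- (x :* b)) :+ x :* b) ≈-refl
    prev : ∀ k → shift s k ≈ shift s' k
    prev zero    = ≈-refl
    prev (suc k) = mulBy-injective x eq k

  mulAll-injective : ∀ xs {s s'} → mulAll xs s ≋ mulAll xs s' → s ≋ s'
  mulAll-injective []       eq = eq
  mulAll-injective (x ∷ xs) eq = mulAll-injective xs (mulBy-injective x eq)

  sumR-scale : ∀ n x (f f' : ℕ → Carrier) g g' → (∀ a → f (g a) ≈ x ⊠ f' (g' a)) →
    sumR R (List.map f (List.applyUpTo g n)) ≈ x ⊠ sumR R (List.map f' (List.applyUpTo g' n))
  sumR-scale zero    x f f' g g' eq = ≈-sym (⊠-zeroʳ x)
  sumR-scale (suc n) x f f' g g' eq = ≈-trans (⊞-cong (eq 0) (sumR-scale n x f f' (g ∘ suc) (g' ∘ suc) (eq ∘ suc))) (≈-sym (distribˡ x _ _))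

  hSeq : List Carrier → Seq
  hSeq xs k = hN R k xs

  hN-∷ : ∀ k x xs → hN R k (x ∷ xs) ≡ sumR R (List.map (λ a → pow R x a ⊠ hN R (k ∸ a) xs) (List.upTo (suc k)))
  hN-∷ zero    x xs = refl
  hN-∷ (suc k) x xs = refl

  -- Splitting off the term `a = 0` in `hN` gives h_k(x, xs) = h_k(xs) + x h_{k-1}(x, xs).
  mulBy-hSeq : ∀ x xs → mulBy x (hSeq (x ∷ xs)) ≋ hSeq xs
  mulBy-hSeq x xs zero    = alg x (hN R 0 xs)
    where
    alg : ∀ x a → (1# ⊠ a ⊞ 0#) ⊞ ⊟ (x ⊠ 0#) ≈ a
    alg = solve 2 (λ x a → (con 1ℤ :* a :+ con 0ℤ) :+ :- (x :* con 0ℤ) := a) ≈-refl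
  mulBy-hSeq x xs (suc k) = ≈-trans
    (⊞-cong (⊞-cong ≈-refl (sumR-scale (suc k) x _ (λ a → pow R x a ⊠ hN R (k ∸ a) xs) suc (λ a → a) (λ a → ⊠-assoc x _ _))) (⊟-cong (⊠-cong ≈-refl (≈-reflexive (hN-∷ k x xs)))))
    (alg x (hN R (suc k) xs) (sumR R (List.map (λ a → pow R x a ⊠ hN R (k ∸ a) xs) (List.upTo (suc k)))))
    where
    alg : ∀ x a b → (1# ⊠ a ⊞ x ⊠ b) ⊞ ⊟ (x ⊠ b) ≈ a
    alg = solve 3 (λ x a b → (con 1ℤ :* a :+ x :* b) :+ :- (x :* b) := a) ≈-refl

  mulAll-hSeq : ∀ xs → mulAll xs (hSeq xs) ≋ δ
  mulAll-hSeq []       zero    = ≈-refl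
  mulAll-hSeq []       (suc k) = ≈-refl
  mulAll-hSeq (x ∷ xs) = ≋-trans (mulBy-mulAll x xs _) (≋-trans (mulAll-cong xs (mulBy-hSeq x xs)) (mulAll-hSeq xs))

  mulAll-zero : ∀ xs s → mulAll xs s 0 ≈ s 0
  mulAll-zero []       s = ≈-refl
  mulAll-zero (x ∷ xs) s = ≈-trans (alg x (mulAll xs s 0)) (mulAll-zero xs s)
    where
    alg : ∀ x a → a ⊞ ⊟ (x ⊠ 0#) ≈ a
    alg = solve 2 (λ x a → a :+ :- (x :* con 0ℤ) := a) ≈-refl

  mulAll-degree : ∀ xs k → length xs < k → mulAll xs δ k ≈ 0#
  mulAll-degree []       (suc k) _          = ≈-refl
  mulAll-degree (x ∷ xs) (suc k) (s<s len<) = ≈-trans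
    (⊞-cong (mulAll-degree xs (suc k) (m<n⇒m<1+n len<)) (⊟-cong (⊠-cong ≈-refl (mulAll-degree xs k len<)))) (alg x)
    where
    alg : ∀ x → 0# ⊞ ⊟ (x ⊠ 0#) ≈ 0#
    alg = solve 1 (λ x → con 0ℤ :+ :- (x :* con 0ℤ) := con 0ℤ) ≈-refl

  -- The substitution of `w z` for `z` in the generating function.
  scale : Carrier → Seq → Seq
  scale w s k = pow R w k ⊠ s k

  scale-mulBy : ∀ w x s → scale w (mulBy x s) ≋ mulBy (w ⊠ x) (scale w s)
  scale-mulBy w x s zero = alg w x (s 0)
    where
    alg : ∀ w x a → 1# ⊠ (a ⊞ ⊟ (x ⊠ 0#)) ≈ 1# ⊠ a ⊞ ⊟ ((w ⊠ x) ⊠ 0#)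
    alg = solve 3 (λ w x a → con 1ℤ :* (a :+ :- (x :* con 0ℤ)) := con 1ℤ :* a :+ :- ((w :* x) :* con 0ℤ)) ≈-refl
  scale-mulBy w x s (suc k) = alg w x (s (suc k)) (s k) (pow R w k)
    where
    alg : ∀ w x a b p → (w ⊠ p) ⊠ (a ⊞ ⊟ (x ⊠ b)) ≈ (w ⊠ p) ⊠ a ⊞ ⊟ ((w ⊠ x) ⊠ (p ⊠ b))
    alg = solve 5 (λ w x a b p → (w :* p) :* (a :+ :- (x :* b)) := (w :* p) :* a :+ :- ((w :* x) :* (p :* b))) ≈-refl

  range : ℕ → (ℕ → Carrier) → List Carrier
  range n g = List.tabulate {n = n} (λ i → g (toℕ i))

  scale-mulAll : ∀ w n g s → scale w (mulAll (range n g) s) ≋ mulAll (range n (λ i → w ⊠ g i)) (scale w s)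
  scale-mulAll w zero    g s = λ _ → ≈-refl
  scale-mulAll w (suc n) g s = ≋-trans (scale-mulBy w (g 0) _) (mulBy-cong ≈-refl (scale-mulAll w n (g ∘ suc) s))

  mulAll-range-cong : ∀ n {g g'} s → (∀ i → g i ≈ g' i) → mulAll (range n g) s ≋ mulAll (range n g') s
  mulAll-range-cong zero    s eq = λ _ → ≈-refl
  mulAll-range-cong (suc n) s eq = mulBy-cong (eq 0) (mulAll-range-cong n s (eq ∘ suc))

  mulAll-range-last : ∀ n g s → mulAll (range (suc n) g) s ≋ mulBy (g n) (mulAll (range n g) s)
  mulAll-range-last zero    g s = λ _ → ≈-refl
  mulAll-range-last (suc n) g s = ≋-trans (mulBy-cong ≈-refl (mulAll-range-last n (g ∘ suc) s))
    (mulBy-comm (g 0) (g (suc n)) (mulAll (range n (g ∘ suc)) s))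

  shiftBy : ℕ → Seq → Seq
  shiftBy zero    s = s
  shiftBy (suc n) s = shift (shiftBy n s)

  -- Multiplication of the generating function of s by 1 - z ^ t.
  cyc : ℕ → Seq → Seq
  cyc t s k = s k ⊞ ⊟ shiftBy t s k

  shiftBy-cong : ∀ t {s s'} → s ≋ s' → shiftBy t s ≋ shiftBy t s'
  shiftBy-cong zero    eq = eq
  shiftBy-cong (suc t) eq = shift-cong (shiftBy-cong t eq)

  shiftBy-< : ∀ {t k} s → k < t → shiftBy t s k ≈ 0#
  shiftBy-< {suc t} {zero}  s _         = ≈-refl
  shiftBy-< {suc t} {suc k} s (s<s k<t) = shiftBy-< s k<t

  shiftBy-+ : ∀ t s k → shiftBy t s (t + k) ≈ s k
  shiftBy-+ zero    s k = ≈-refl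
  shiftBy-+ (suc t) s k = shiftBy-+ t s k

  cyc-cong : ∀ t {s s'} → s ≋ s' → cyc t s ≋ cyc t s'
  cyc-cong t eq k = ⊞-cong (eq k) (⊟-cong (shiftBy-cong t eq k))

  mulBy-shift : ∀ x s → mulBy x (shift s) ≋ shift (mulBy x s)
  mulBy-shift x s zero    = alg x
    where
    alg : ∀ x → 0# ⊞ ⊟ (x ⊠ 0#) ≈ 0#
    alg = solve 1 (λ x → con 0ℤ :+ :- (x :* con 0ℤ) := con 0ℤ) ≈-refl
  mulBy-shift x s (suc k) = ≈-refl

  mulBy-shiftBy : ∀ t x s → mulBy x (shiftBy t s) ≋ shiftBy t (mulBy x s)
  mulBy-shiftBy zero    x s = λ _ → ≈-refl
  mulBy-shiftBy (suc t) x s = ≋-trans (mulBy-shift x _) (shift-cong (mulBy-shiftBy t x s))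

  mulBy-cyc : ∀ t x s → mulBy x (cyc t s) ≋ cyc t (mulBy x s)
  mulBy-cyc t x s k = ≈-trans (linear k) (⊞-cong ≈-refl (⊟-cong (mulBy-shiftBy t x s k)))
    where
    alg : ∀ x a b c d → (a ⊞ ⊟ b) ⊞ ⊟ (x ⊠ (c ⊞ ⊟ d)) ≈ (a ⊞ ⊟ (x ⊠ c)) ⊞ ⊟ (b ⊞ ⊟ (x ⊠ d))
    alg = solve 5 (λ x a b c d → (a :+ :- b) :+ :- (x :* (c :+ :- d)) := (a :+ :- (x :* c)) :+ :- (b :+ :- (x :* d))) ≈-refl
    alg₀ : ∀ x a b → (a ⊞ ⊟ b) ⊞ ⊟ (x ⊠ 0#) ≈ (a ⊞ ⊟ (x ⊠ 0#)) ⊞ ⊟ (b ⊞ ⊟ (x ⊠ 0#))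
    alg₀ = solve 3 (λ x a b → (a :+ :- b) :+ :- (x :* con 0ℤ) := (a :+ :- (x :* con 0ℤ)) :+ :- (b :+ :- (x :* con 0ℤ))) ≈-refl
    linear : ∀ k → mulBy x (cyc t s) k ≈ mulBy x s k ⊞ ⊟ mulBy x (shiftBy t s) k
    linear zero    = alg₀ x (s 0) (shiftBy t s 0)
    linear (suc k) = alg x (s (suc k)) (shiftBy t s (suc k)) (s k) (shiftBy t s k)

  mulAll-cyc : ∀ t xs s → mulAll xs (cyc t s) ≋ cyc t (mulAll xs s)
  mulAll-cyc t []       s = λ _ → ≈-refl
  mulAll-cyc t (x ∷ xs) s = ≋-trans (mulBy-cong ≈-refl (mulAll-cyc t xs s)) (mulBy-cyc t x (mulAll xs s))

  -- ∏ᵢ (1 - ωⁱ z) = 1 - z ^ t: the product is invariant under z ↦ ω z, which kills its coefficients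
  -- strictly between 0 and t, and the factor 1 - z determines the last one.
  module Primitive (n : ℕ) (ω : Carrier) (ωᵗ≈1 : pow R ω (suc n) ≈ 1#)
    (unit : ∀ k → 0 < k → k < suc n → Σ Carrier λ y → y ⊠ (1# ⊞ ⊟ pow R ω k) ≈ 1#) where

    private
      t = suc n
      p q : Seq
      p = mulAll (range t (pow R ω)) δ
      q = mulAll (range n (pow R ω ∘ suc)) δ

    scale-δ : scale ω δ ≋ δ
    scale-δ zero    = ⊠-identityˡ 1#
    scale-δ (suc k) = ⊠-zeroʳ _

    -- Scaling turns the roots `ω ^ 0, ..., ω ^ n` into `ω ^ 1, ..., ω ^ t`; the last of these is 1
    -- and can be moved to the front.
    rotate : scale ω p ≋ p
    rotate = ≋-trans (scale-mulAll ω t (pow R ω) δ) (≋-trans (mulAll-cong (range t (pow R ω ∘ suc)) scale-δ)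
      (≋-trans (mulAll-range-last n (pow R ω ∘ suc) δ) (mulBy-cong ωᵗ≈1 (λ _ → ≈-refl))))

    p-middle : ∀ k → 0 < k → k < t → p k ≈ 0#
    p-middle k 0<k k<t = begin
      p k                                    ≈⟨ ⊠-identityˡ (p k) ⟨
      1# ⊠ p k                               ≈⟨ ⊠-cong (proj₂ (unit k 0<k k<t)) ≈-refl ⟨
      (y ⊠ (1# ⊞ ⊟ pow R ω k)) ⊠ p k         ≈⟨ alg y (pow R ω k) (p k) ⟩
      y ⊠ (p k ⊞ ⊟ (pow R ω k ⊠ p k))        ≈⟨ ⊠-cong ≈-refl (⊞-cong ≈-refl (⊟-cong (rotate k))) ⟩
      y ⊠ (p k ⊞ ⊟ p k)                      ≈⟨ ⊠-cong ≈-refl (-‿inverseʳ (p k)) ⟩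
      y ⊠ 0#                                 ≈⟨ ⊠-zeroʳ y ⟩
      0#                                     ∎
      where
      y = proj₁ (unit k 0<k k<t)
      alg : ∀ y w a → (y ⊠ (1# ⊞ ⊟ w)) ⊠ a ≈ y ⊠ (a ⊞ ⊟ (w ⊠ a))
      alg = solve 3 (λ y w a → (y :* (con 1ℤ :+ :- w)) :* a := y :* (a :+ :- (w :* a))) ≈-refl

    -- `p` is `q` multiplied by `1 - z`, so the vanishing middle coefficients of `p` make
    -- consecutive coefficients of `q` equal.
    q-one : ∀ k → k < t → q k ≈ 1#
    q-one zero    _   = mulAll-zero (range n (pow R ω ∘ suc)) δ
    q-one (suc k) k<t = begin
      q (suc k)        ≈⟨ alg (q (suc k)) (q k) ⟩
      p (suc k) ⊞ q k  ≈⟨ ⊞-cong (p-middle (suc k) z<s k<t) (q-one k (<-trans (n<1+n k) k<t)) ⟩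
      0# ⊞ 1#          ≈⟨ ⊞-identityˡ 1# ⟩
      1#               ∎
      where
      alg : ∀ a b → a ≈ (a ⊞ ⊟ (1# ⊠ b)) ⊞ b
      alg = solve 2 (λ a b → a := (a :+ :- (con 1ℤ :* b)) :+ b) ≈-refl

    p-cyc : p ≋ cyc t δ
    p-cyc k with k <? t
    p-cyc zero    | yes k<t = ≈-trans (mulAll-zero (range t (pow R ω)) δ) (≈-sym (≈-trans (⊞-cong ≈-refl -0#≈0#) (⊞-identityʳ 1#)))
    p-cyc (suc k) | yes k<t = ≈-trans (p-middle (suc k) z<s k<t)
      (≈-sym (≈-trans (⊞-cong ≈-refl (⊟-cong (shiftBy-< δ k<t))) (-‿inverseʳ 0#)))
    ... | no k≮t = subst (λ k → p k ≈ cyc t δ k) (m+[n∸m]≡n (≮⇒≥ k≮t)) (high (k ∸ t))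
      where
      len : ∀ n (g : ℕ → Carrier) → length (range n g) ≡ n
      len n g = Listₚ.length-tabulate {n = n} (λ i → g (toℕ i))
      high : ∀ l → p (t + l) ≈ cyc t δ (t + l)
      -- The coefficient of degree `t` is `q t - q n`; here `q` has degree at most `n`, and `q n` is
      -- 1.
      high zero rewrite +-identityʳ n = ⊞-cong (mulAll-degree (range n (pow R ω ∘ suc)) t (≤-reflexive (cong suc (len n (pow R ω ∘ suc)))))
        (⊟-cong (≈-trans (⊠-identityˡ _) (≈-trans (q-one n ≤-refl) (≈-sym (subst (λ m → shiftBy n δ m ≈ 1#) (+-identityʳ n) (shiftBy-+ n δ 0))))))
      high (suc l) = ≈-trans
        (mulAll-degree (range t (pow R ω)) (t + suc l) (≤-trans (≤-reflexive (cong suc (len t (pow R ω)))) (≤-trans (≤-reflexive (+-comm 1 t)) (+-monoʳ-≤ t (s≤s z≤n)))))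
        (≈-sym (≈-trans (⊞-cong ≈-refl (⊟-cong (shiftBy-+ t δ (suc l)))) (-‿inverseʳ 0#)))

  -- The generating function of `hSeq (xs ++ ys)` is `1 / (1 - z ^ t) ^ 2`: every root of unity
  -- occurs once among the variables and once among their inverses. The two poles are resolved one
  -- at a time, by `cyc-H` and then by `hN-value`.
  module DoublePole (n : ℕ) (xs ys : List Carrier) 
    (xs-cyc : mulAll xs δ ≋ cyc (suc n) δ) (ys-cyc : mulAll ys δ ≋ cyc (suc n) δ) where

    private
      t = suc n
      H : Seq
      H = hSeq (xs ++ ys)

    mulAll-++ : ∀ xs ys s → mulAll (xs ++ ys) s ≋ mulAll xs (mulAll ys s)
    mulAll-++ xs ys s k = ≈-reflexive (cong (λ f → f k) (Listₚ.foldr-++ mulBy s xs ys))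

    cyc²-H : cyc t (cyc t H) ≋ δ
    cyc²-H = mulAll-injective (xs ++ ys)
      (≋-trans (mulAll-cyc t (xs ++ ys) (cyc t H))
      (≋-trans (cyc-cong t (mulAll-cyc t (xs ++ ys) H))
      (≋-trans (cyc-cong t (cyc-cong t (mulAll-hSeq (xs ++ ys))))
      (≋-sym (≋-trans (mulAll-++ xs ys δ)
      (≋-trans (mulAll-cong xs ys-cyc)
      (≋-trans (mulAll-cyc t xs δ) (cyc-cong t xs-cyc))))))))

    cyc-< : ∀ s {k} → k < t → cyc t s k ≈ s k
    cyc-< s {k} k<t = ≈-trans (⊞-cong ≈-refl (≈-trans (⊟-cong (shiftBy-< s k<t)) -0#≈0#)) (⊞-identityʳ _)

    cyc-step : ∀ s k → s (t + k) ≈ s k ⊞ cyc t s (t + k)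
    cyc-step s k = ≈-trans (alg (s (t + k)) (s k)) (⊞-cong ≈-refl (⊞-cong ≈-refl (⊟-cong (≈-sym (shiftBy-+ t s k)))))
      where
      alg : ∀ a b → a ≈ b ⊞ (a ⊞ ⊟ b)
      alg = solve 2 (λ a b → a := b :+ (a :+ :- b)) ≈-refl

    cyc-H : ∀ m {r} → r < t → cyc t H (m ℕ.* t + r) ≈ δ r
    cyc-H zero    {r} r<t = ≈-trans (≈-sym (cyc-< (cyc t H) r<t)) (cyc²-H r)
    cyc-H (suc m) {r} r<t = ≈-trans (≈-reflexive (cong (cyc t H) (+-assoc t (m ℕ.* t) r))) (≈-trans (cyc-step (cyc t H) (m ℕ.* t + r))
      (≈-trans (⊞-cong (cyc-H m r<t) (cyc²-H (t + (m ℕ.* t + r)))) (⊞-identityʳ _)))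

    hN-value : ∀ m {r} → r < t → hN R (m ℕ.* t + r) (xs ++ ys) ≈ natR R (suc m) ⊠ δ r
    hN-value zero {r} r<t = ≈-trans (≈-sym (cyc-< H r<t)) (≈-trans (cyc-H 0 r<t) (alg (δ r)))
      where
      alg : ∀ a → a ≈ (1# ⊞ 0#) ⊠ a
      alg = solve 1 (λ a → a := (con 1ℤ :+ con 0ℤ) :* a) ≈-refl
    hN-value (suc m) {r} r<t = begin
      H (suc m ℕ.* t + r)                            ≡⟨ cong H (+-assoc t (m ℕ.* t) r) ⟩
      H (t + (m ℕ.* t + r))                          ≈⟨ cyc-step H (m ℕ.* t + r) ⟩
      H (m ℕ.* t + r) ⊞ cyc t H (t + (m ℕ.* t + r))     ≡⟨ cong (λ k → H (m ℕ.* t + r) ⊞ cyc t H k) (+-assoc t (m ℕ.* t) r) ⟨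
      H (m ℕ.* t + r) ⊞ cyc t H (suc m ℕ.* t + r)       ≈⟨ ⊞-cong (hN-value m r<t) (cyc-H (suc m) r<t) ⟩
      natR R (suc m) ⊠ δ r ⊞ δ r                   ≈⟨ alg (natR R (suc m)) (δ r) ⟩
      natR R (suc (suc m)) ⊠ δ r                   ∎
      where
      alg : ∀ a b → a ⊠ b ⊞ b ≈ (1# ⊞ a) ⊠ b
      alg = solve 2 (λ a b → a :* b :+ b := (con 1ℤ :+ a) :* b) ≈-refl

-- Block decomposition of the determinant

countBelow countAbove : ℕ → List ℕ → ℕ
countBelow v xs = length (filter (λ y → suc y ≤? v) xs)
countAbove v xs = length (filter (λ y → suc v ≤? y) xs)

filter-length-++ : ∀ {P : ℕ → Set} (P? : Decidable P) xs ys →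
  length (filter P? (xs ++ ys)) ≡ length (filter P? xs) + length (filter P? ys)
filter-length-++ P? xs ys = trans (cong length (Listₚ.filter-++ P? xs ys)) (Listₚ.length-++ (filter P? xs))

filter-length-all : ∀ {P : ℕ → Set} (P? : Decidable P) {xs} → All P xs → length (filter P? xs) ≡ length xs
filter-length-all P? all = cong length (Listₚ.filter-all P? all)

filter-length-none : ∀ {P : ℕ → Set} (P? : Decidable P) {xs} → All (¬_ ∘ P) xs → length (filter P? xs) ≡ 0
filter-length-none P? none = cong length (Listₚ.filter-none P? none)

inversions-insert : ∀ xs v ys → inversions (xs ++ v ∷ ys) ≡ countAbove v xs + (countBelow v ys + inversions (xs ++ ys))
inversions-insert []       v ys = refl
inversions-insert (x ∷ xs) v ys = begin
  countBelow x (xs ++ v ∷ ys) + inversions (xs ++ v ∷ ys)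
    ≡⟨ cong₂ _+_ below (inversions-insert xs v ys) ⟩
  δ + b + (a + (c + i))
    ≡⟨ alg δ b a c i ⟩
  δ + a + (c + (b + i))
    ≡⟨ cong (_+ (c + (b + i))) above ⟨
  countAbove v (x ∷ xs) + (c + (b + i)) ∎
  where
  open ≡-Reasoning
  δ = length (filter (λ y → suc y ≤? x) (v ∷ []))
  b = countBelow x (xs ++ ys)
  a = countAbove v xs
  c = countBelow v ys
  i = inversions (xs ++ ys)
  alg : ∀ δ b a c i → δ + b + (a + (c + i)) ≡ δ + a + (c + (b + i))
  alg = ℕSolver.solve-∀
  alg' : ∀ p d q → p + (d + q) ≡ d + (p + q)
  alg' = ℕSolver.solve-∀
  below : countBelow x (xs ++ v ∷ ys) ≡ δ + b
  below = begin
    countBelow x (xs ++ v ∷ ys)                                ≡⟨ filter-length-++ _ xs (v ∷ ys) ⟩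
    countBelow x xs + countBelow x ((v ∷ []) ++ ys)            ≡⟨ cong (λ u → countBelow x xs + u) (filter-length-++ (λ y → suc y ≤? x) (v ∷ []) ys) ⟩
    countBelow x xs + (δ + countBelow x ys)                    ≡⟨ alg' (countBelow x xs) δ (countBelow x ys) ⟩
    δ + (countBelow x xs + countBelow x ys)                    ≡⟨ cong (λ u → δ + u) (filter-length-++ _ xs ys) ⟨
    δ + b                                                      ∎
  above : countAbove v (x ∷ xs) ≡ δ + a
  above with v <ᵇ x
  ... | true  = refl
  ... | false = refl

inversions-insert₂ : ∀ a v b w c → inversions (a ++ v ∷ b ++ w ∷ c) ≡
  countAbove v a + (countBelow v (b ++ w ∷ c) + (countAbove w (a ++ b) + (countBelow w c + inversions ((a ++ b) ++ c))))
inversions-insert₂ a v b w c = trans (inversions-insert a v (b ++ w ∷ c))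
  (cong (λ i → countAbove v a + (countBelow v (b ++ w ∷ c) + i))
    (trans (cong inversions (sym (Listₚ.++-assoc a b (w ∷ c)))) (inversions-insert (a ++ b) w c)))

negOnePow-+₄ : ∀ m n o p q → negOnePow (m + (n + (o + (p + q)))) ≡
  negOnePow m ℤ.* (negOnePow n ℤ.* (negOnePow o ℤ.* (negOnePow p ℤ.* negOnePow q)))
negOnePow-+₄ m n o p q = trans (negOnePow-+ m _) (cong (negOnePow m ℤ.*_) (trans (negOnePow-+ n _)
  (cong (negOnePow n ℤ.*_) (trans (negOnePow-+ o _) (cong (negOnePow o ℤ.*_) (negOnePow-+ p q))))))

-- All other entries lie strictly between `lo` and `hi`, so the parity of the inversions lost with
-- the two extreme entries depends only on the lengths of `a`, `b`, `c`. These signs are to be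
-- matched with those of the row moves in `D-front₂` and of `D-corner`.
module Extremes (lo hi : ℕ) (lo<hi : lo < hi) (a b c : List ℕ)
  (ina : All (λ x → lo < x × x < hi) a) (inb : All (λ x → lo < x × x < hi) b) (inc : All (λ x → lo < x × x < hi) c) where

  private
    X = negOnePow (length a)
    Y = negOnePow (length b)
    Z = negOnePow (length c)
    I = negOnePow (inversions ((a ++ b) ++ c))

    inab : All (λ x → lo < x × x < hi) (a ++ b)
    inab = Allₚ.++⁺ ina inb

    len-ab : negOnePow (length (a ++ b)) ≡ X ℤ.* Y
    len-ab = trans (cong negOnePow (Listₚ.length-++ a)) (negOnePow-+ (length a) (length b))

    above-lo : ∀ {l} → All (λ x → lo < x × x < hi) l → countAbove lo l ≡ length l
    above-lo inl = filter-length-all _ (All.map proj₁ inl)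

    above-hi : ∀ {l} → All (λ x → lo < x × x < hi) l → countAbove hi l ≡ 0
    above-hi inl = filter-length-none _ (All.map (λ p → <-asym (proj₂ p)) inl)

    below-lo : ∀ {l} → All (λ x → lo ≤ x) l → countBelow lo l ≡ 0
    below-lo inl = filter-length-none _ (All.map ≤⇒≯ inl)

    below-hi : ∀ {l} → All (λ x → lo < x × x < hi) l → countBelow hi l ≡ length l
    below-hi inl = filter-length-all _ (All.map proj₂ inl)

    weaken : ∀ {l} → All (λ x → lo < x × x < hi) l → All (λ x → lo ≤ x) l
    weaken = All.map (<⇒≤ ∘ proj₁)

    expand : ∀ {v w m n o p} → countAbove v a ≡ m → countBelow v (b ++ w ∷ c) ≡ n → countAbove w (a ++ b) ≡ o → countBelow w c ≡ p →
      negOnePow (inversions (a ++ v ∷ b ++ w ∷ c)) ≡ negOnePow m ℤ.* (negOnePow n ℤ.* (negOnePow o ℤ.* (negOnePow p ℤ.* I)))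
    expand {v} {w} refl refl refl refl = trans (cong negOnePow (inversions-insert₂ a v b w c))
      (negOnePow-+₄ (countAbove v a) (countBelow v (b ++ w ∷ c)) (countAbove w (a ++ b)) (countBelow w c) (inversions ((a ++ b) ++ c)))

  sign-lo-lo : negOnePow (inversions (a ++ lo ∷ b ++ lo ∷ c)) ≡ Y ℤ.* I
  sign-lo-lo = trans (expand (above-lo ina) (below-lo (Allₚ.++⁺ (weaken inb) (≤-refl ∷ weaken inc))) (above-lo inab) (below-lo (weaken inc)))
    (trans (cong (λ u → X ℤ.* (1ℤ ℤ.* (u ℤ.* (1ℤ ℤ.* I)))) len-ab) (trans (alg X Y I) (negOnePow-cancel (length a) _)))
    where
    alg : ∀ X Y I → X ℤ.* (1ℤ ℤ.* ((X ℤ.* Y) ℤ.* (1ℤ ℤ.* I))) ≡ X ℤ.* X ℤ.* (Y ℤ.* I)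
    alg = solve-∀

  sign-lo-hi : negOnePow (inversions (a ++ lo ∷ b ++ hi ∷ c)) ≡ X ℤ.* Z ℤ.* I
  sign-lo-hi = trans (expand (above-lo ina) (below-lo (Allₚ.++⁺ (weaken inb) (<⇒≤ lo<hi ∷ weaken inc))) (above-hi inab) (below-hi inc)) (alg X Z I)
    where
    alg : ∀ X Z I → X ℤ.* (1ℤ ℤ.* (1ℤ ℤ.* (Z ℤ.* I))) ≡ X ℤ.* Z ℤ.* I
    alg = solve-∀

  sign-hi-lo : negOnePow (inversions (a ++ hi ∷ b ++ lo ∷ c)) ≡ ℤ.- (X ℤ.* Z ℤ.* I)
  sign-hi-lo = trans (expand (above-hi ina) below (above-lo inab) (below-lo (weaken inc)))
    (trans (cong₂ (λ u v → 1ℤ ℤ.* (u ℤ.* (v ℤ.* (1ℤ ℤ.* I)))) (negOnePow-+ (length b) (suc (length c))) len-ab)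
      (trans (alg X Y Z I) (negOnePow-cancel (length b) _)))
    where
    below : countBelow hi (b ++ lo ∷ c) ≡ length b + suc (length c)
    below = trans (filter-length-++ _ b (lo ∷ c)) (cong₂ _+_ (below-hi inb)
      (trans (cong length (Listₚ.filter-accept (λ y → suc y ≤? hi) lo<hi)) (cong suc (below-hi inc))))
    alg : ∀ X Y Z I → 1ℤ ℤ.* ((Y ℤ.* ℤ.- Z) ℤ.* ((X ℤ.* Y) ℤ.* (1ℤ ℤ.* I))) ≡ Y ℤ.* Y ℤ.* ℤ.- (X ℤ.* Z ℤ.* I)
    alg = solve-∀

  sign-hi-hi : negOnePow (inversions (a ++ hi ∷ b ++ hi ∷ c)) ≡ Y ℤ.* I
  sign-hi-hi = trans (expand (above-hi ina) below (above-hi inab) (below-hi inc))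
    (trans (cong (λ u → 1ℤ ℤ.* (u ℤ.* (1ℤ ℤ.* (Z ℤ.* I)))) (negOnePow-+ (length b) (length c)))
      (trans (alg Y Z I) (negOnePow-cancel (length c) _)))
    where
    below : countBelow hi (b ++ hi ∷ c) ≡ length b + length c
    below = trans (filter-length-++ _ b (hi ∷ c)) (cong₂ _+_ (below-hi inb)
      (trans (cong length (Listₚ.filter-reject (λ y → suc y ≤? hi) {xs = c} (<-irrefl refl))) (below-hi inc)))
    alg : ∀ Y Z I → 1ℤ ℤ.* ((Y ℤ.* Z) ℤ.* (1ℤ ℤ.* (Z ℤ.* I))) ≡ Z ℤ.* Z ℤ.* (Y ℤ.* I)
    alg = solve-∀

split-first : ∀ {P : ℕ → Set} (P? : Decidable P) rs →
  All (¬_ ∘ P) rs ⊎ (∃ λ xs → ∃ λ r → ∃ λ ys → rs ≡ xs ++ r ∷ ys × All (¬_ ∘ P) xs × P r)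
split-first P? []       = inj₁ []
split-first P? (x ∷ rs) with P? x
... | yes px = inj₂ ([] , x , rs , refl , [] , px)
... | no ¬px with split-first P? rs
...   | inj₁ none = inj₁ (¬px ∷ none)
...   | inj₂ (xs , r , ys , refl , none , pr) = inj₂ (x ∷ xs , r , ys , refl , ¬px ∷ none , pr)

-- Row `r` crosses `xs`, and row `s` crosses `xs` and `ys`; the two crossings of `xs` cancel.
D-front₂ : ∀ E xs r ys s zs →
  D E (xs ++ r ∷ ys ++ s ∷ zs) ≡ negOnePow (length ys) ℤ.* D E (r ∷ s ∷ (xs ++ ys) ++ zs)
D-front₂ E xs r ys s zs = begin
  D E (xs ++ r ∷ ys ++ s ∷ zs)
    ≡⟨ D-front E xs r (ys ++ s ∷ zs) ⟩
  X ℤ.* D E (r ∷ xs ++ (ys ++ s ∷ zs))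
    ≡⟨ cong (λ l → X ℤ.* D E (r ∷ l)) (Listₚ.++-assoc xs ys (s ∷ zs)) ⟨
  X ℤ.* D E ((r ∷ xs ++ ys) ++ s ∷ zs)
    ≡⟨ cong (X ℤ.*_) (D-front E (r ∷ xs ++ ys) s zs) ⟩
  X ℤ.* (ℤ.- negOnePow (length (xs ++ ys)) ℤ.* D E (s ∷ r ∷ (xs ++ ys) ++ zs))
    ≡⟨ cong₂ (λ e d → X ℤ.* (ℤ.- e ℤ.* d)) (trans (cong negOnePow (Listₚ.length-++ xs)) (negOnePow-+ (length xs) (length ys)))
             (D-swap E s r ((xs ++ ys) ++ zs)) ⟩
  X ℤ.* (ℤ.- (X ℤ.* Y) ℤ.* ℤ.- d)
    ≡⟨ alg X Y d ⟩
  X ℤ.* X ℤ.* (Y ℤ.* d)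
    ≡⟨ cong (ℤ._* (Y ℤ.* d)) (negOnePow-square (length xs)) ⟩
  1ℤ ℤ.* (Y ℤ.* d)
    ≡⟨ ℤₚ.*-identityˡ _ ⟩
  Y ℤ.* d ∎
  where
  open ≡-Reasoning
  X = negOnePow (length xs)
  Y = negOnePow (length ys)
  d = D E (r ∷ s ∷ (xs ++ ys) ++ zs)
  alg : ∀ X Y d → X ℤ.* (ℤ.- (X ℤ.* Y) ℤ.* ℤ.- d) ≡ X ℤ.* X ℤ.* (Y ℤ.* d)
  alg = solve-∀

interval-ends : ∀ {S} lo m → lo + lo + (2 + m) ≡ suc S → lo + (lo + suc m) ≡ S
interval-ends lo m eq = suc-injective (trans (alg lo m) eq)
  where
  alg : ∀ lo m → suc (lo + (lo + suc m)) ≡ lo + lo + (2 + m)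
  alg = ℕSolver.solve-∀

interval-inner : ∀ {S} lo m → lo + lo + (2 + m) ≡ suc S → suc lo + suc lo + m ≡ suc S
interval-inner lo m eq = trans (alg lo m) eq
  where
  alg : ∀ lo m → suc lo + suc lo + m ≡ lo + lo + (2 + m)
  alg = ℕSolver.solve-∀

when : ∀ {P : Set} → Dec P → ℤ → ℤ
when (yes _) x = x
when (no _)  x = 0ℤ

when-yes : ∀ {P : Set} (d : Dec P) {x} → P → when d x ≡ x
when-yes (yes _) p = refl
when-yes (no ¬p) p = contradiction p ¬p

when-no : ∀ {P : Set} (d : Dec P) {x} → ¬ P → when d x ≡ 0ℤ
when-no (yes p) ¬p = contradiction p ¬p
when-no (no _)  ¬p = refl

-- A row with key x has residue ρ x and height κ x; its nonzero entries lie in the columns ρ x and S - ρ x.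
module Blocks (ρ κ : ℕ → ℕ) (S : ℕ) where

  entry : Entries
  entry x q = when (ρ x + q ≟ S) (+ suc (κ x)) ℤ.+ when (ρ x ≟ q) (+ κ x)

  entry-same : ∀ {x q} → ρ x ≡ q → ρ x + q ≢ S → entry x q ≡ + κ x
  entry-same {x} {q} p ¬p = cong₂ ℤ._+_ (when-no (ρ x + q ≟ S) ¬p) (when-yes (ρ x ≟ q) p)

  entry-dual : ∀ {x q} → ρ x ≢ q → ρ x + q ≡ S → entry x q ≡ + suc (κ x)
  entry-dual {x} {q} ¬p p = trans (cong₂ ℤ._+_ (when-yes (ρ x + q ≟ S) p) (when-no (ρ x ≟ q) ¬p)) (ℤₚ.+-identityʳ _)

  entry-none : ∀ {x q} → ρ x ≢ q → ρ x + q ≢ S → entry x q ≡ 0ℤ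
  entry-none {x} {q} ¬p ¬p' = cong₂ ℤ._+_ (when-no (ρ x + q ≟ S) ¬p') (when-no (ρ x ≟ q) ¬p)

  entry-both : ∀ {x q} → ρ x ≡ q → ρ x + q ≡ S → entry x q ≡ + suc (κ x) ℤ.+ + κ x
  entry-both {x} {q} p p' = cong₂ ℤ._+_ (when-yes (ρ x + q ≟ S) p') (when-yes (ρ x ≟ q) p)

  -- Columns renumbered so that the leftmost column left after `lo` peelings has index 0.
  E : ℕ → Entries
  E lo x q = entry x (lo + q)

  res : List ℕ → ℕ → List ℕ
  res rs i = filter (λ x → ρ x ≟ i) rs

  -- The 2 by 2 minor on two dual columns with `n` columns between them, including the sign left
  -- over from moving its rows. The lists hold the rows of the smaller and of the larger residue;
  -- any total other than two rows makes the determinant vanish.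
  block : ℕ → List ℕ → List ℕ → ℤ
  block n (x ∷ y ∷ []) []           = negOnePow n ℤ.* (+ κ x ℤ.- + κ y)
  block n (x ∷ [])     (y ∷ [])     = ℤ.- (+ κ x ℤ.+ + κ y ℤ.+ 1ℤ)
  block n []           (x ∷ y ∷ []) = negOnePow n ℤ.* (+ κ y ℤ.- + κ x)
  block _ _            _            = 0ℤ

  -- An odd number of columns leaves a middle one that is its own dual, and both terms of `entry`
  -- land in it.
  centre : List ℕ → ℤ
  centre (x ∷ []) = + suc (κ x) ℤ.+ + κ x
  centre _        = 0ℤ

  blocks : ℕ → ℕ → (ℕ → List ℕ) → ℤ
  blocks zero          lo A = 1ℤ
  blocks (suc zero)    lo A = centre (A lo)
  blocks (suc (suc n)) lo A = block n (A lo) (A (lo + suc n)) ℤ.* blocks n (suc lo) A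

  blocks-cong : ∀ n lo {A B} → (∀ i → lo ≤ i → i < lo + n → A i ≡ B i) → blocks n lo A ≡ blocks n lo B
  blocks-cong zero          lo eq = refl
  blocks-cong (suc zero)    lo eq = cong centre (eq lo ≤-refl (≤-reflexive (+-comm 1 lo)))
  blocks-cong (suc (suc n)) lo eq = cong₂ ℤ._*_
    (cong₂ (block n) (eq lo ≤-refl (m<m+n lo z<s)) (eq (lo + suc n) (m≤m+n lo _) (+-monoʳ-< lo ≤-refl)))
    (blocks-cong n (suc lo) (λ i lo<i i< → eq i (<⇒≤ lo<i) (<-trans i< (≤-reflexive (sym (trans (+-suc lo (suc n)) (cong suc (+-suc lo n))))))))

  block-zero : ∀ n A B → length A + length B ≢ 2 → block n A B ≡ 0ℤ
  block-zero n []              []              ≢2 = refl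
  block-zero n []              (_ ∷ [])        ≢2 = refl
  block-zero n []              (_ ∷ _ ∷ [])    ≢2 = contradiction refl ≢2
  block-zero n []              (_ ∷ _ ∷ _ ∷ _) ≢2 = refl
  block-zero n (_ ∷ [])        []              ≢2 = refl
  block-zero n (_ ∷ [])        (_ ∷ [])        ≢2 = contradiction refl ≢2
  block-zero n (_ ∷ [])        (_ ∷ _ ∷ _)     ≢2 = refl
  block-zero n (_ ∷ _ ∷ [])    []              ≢2 = contradiction refl ≢2
  block-zero n (_ ∷ _ ∷ [])    (_ ∷ _)         ≢2 = refl
  block-zero n (_ ∷ _ ∷ _ ∷ _) B               ≢2 = refl

  module Peel (n lo : ℕ) (S≡ : lo + (lo + suc n) ≡ S) where

    hi : ℕ
    hi = lo + suc n

    lo≢hi : lo ≢ hi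
    lo≢hi eq = 1+n≢0 (sym (+-cancelˡ-≡ lo 0 (suc n) (trans (+-identityʳ lo) eq)))

    Outer : ℕ → Set
    Outer x = ρ x ≡ lo ⊎ ρ x ≡ hi

    outer? : Decidable Outer
    outer? x = (ρ x ≟ lo) ⊎-dec (ρ x ≟ hi)

    Inner : ℕ → Set
    Inner x = ¬ Outer x

    entry-lo-first : ∀ {x} → ρ x ≡ lo → E lo x 0 ≡ + κ x
    entry-lo-first {x} eq = entry-same (trans eq (sym (+-identityʳ lo)))
      (λ eq' → lo≢hi (+-cancelˡ-≡ lo lo hi (trans (trans (cong₂ _+_ (sym eq) (sym (+-identityʳ lo))) eq') (sym S≡))))

    entry-lo-last : ∀ {x} → ρ x ≡ lo → E lo x (suc n) ≡ + suc (κ x)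
    entry-lo-last eq = entry-dual (λ eq' → lo≢hi (trans (sym eq) eq')) (trans (cong (_+ hi) eq) S≡)

    entry-hi-first : ∀ {x} → ρ x ≡ hi → E lo x 0 ≡ + suc (κ x)
    entry-hi-first eq = entry-dual (λ eq' → lo≢hi (trans (sym (+-identityʳ lo)) (trans (sym eq') eq)))
      (trans (cong₂ _+_ eq (+-identityʳ lo)) (trans (+-comm hi lo) S≡))

    entry-hi-last : ∀ {x} → ρ x ≡ hi → E lo x (suc n) ≡ + κ x
    entry-hi-last eq = entry-same eq
      (λ eq' → lo≢hi (+-cancelʳ-≡ hi lo hi (trans S≡ (trans (sym eq') (cong (_+ hi) eq)))))

    outer-middle : ∀ {x} → Outer x → ∀ j → 0 < j → j < suc n → E lo x j ≡ 0ℤ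
    outer-middle (inj₁ eq) j 0<j j< = entry-none
      (λ eq' → <⇒≢ 0<j (+-cancelˡ-≡ lo 0 j (trans (+-identityʳ lo) (trans (sym eq) eq'))))
      (λ eq' → <⇒≢ j< (+-cancelˡ-≡ lo j (suc n) (+-cancelˡ-≡ lo (lo + j) hi (trans (cong (_+ (lo + j)) (sym eq)) (trans eq' (sym S≡))))))
    outer-middle (inj₂ eq) j 0<j j< = entry-none
      (λ eq' → <⇒≢ j< (+-cancelˡ-≡ lo j (suc n) (trans (sym eq') eq)))
      (λ eq' → <⇒≢ 0<j (+-cancelˡ-≡ lo 0 j (trans (+-identityʳ lo) (+-cancelˡ-≡ hi lo (lo + j)
        (trans (+-comm hi lo) (trans S≡ (trans (sym eq') (cong (_+ (lo + j)) eq))))))))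

    inner-first : ∀ {x} → Inner x → E lo x 0 ≡ 0ℤ
    inner-first {x} inn = entry-none (λ eq → inn (inj₁ (trans eq (+-identityʳ lo))))
      (λ eq → inn (inj₂ (+-cancelʳ-≡ lo (ρ x) hi (trans (cong (λ u → ρ x + u) (sym (+-identityʳ lo))) (trans eq (trans (sym S≡) (+-comm lo hi)))))))

    inner-last : ∀ {x} → Inner x → E lo x (suc n) ≡ 0ℤ
    inner-last {x} inn = entry-none (inn ∘ inj₂) (λ eq → inn (inj₁ (+-cancelʳ-≡ hi (ρ x) lo (trans eq (sym S≡)))))

    res-inner : ∀ {i xs} → i ≡ lo ⊎ i ≡ hi → All Inner xs → res xs i ≡ []
    res-inner (inj₁ refl) inn = Listₚ.filter-none _ (All.map (λ i eq → i (inj₁ eq)) inn)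
    res-inner (inj₂ refl) inn = Listₚ.filter-none _ (All.map (λ i eq → i (inj₂ eq)) inn)

    cnt : List ℕ → ℕ
    cnt xs = length (res xs lo) + length (res xs hi)

    cnt-++ : ∀ xs ys → cnt (xs ++ ys) ≡ cnt xs + cnt ys
    cnt-++ xs ys = trans (cong₂ _+_ (filter-length-++ _ xs ys) (filter-length-++ _ xs ys))
      (alg (length (res xs lo)) (length (res ys lo)) (length (res xs hi)) (length (res ys hi)))
      where
      alg : ∀ a b c d → a + b + (c + d) ≡ a + c + (b + d)
      alg = ℕSolver.solve-∀

    cnt-inner : ∀ {xs} → All Inner xs → cnt xs ≡ 0
    cnt-inner inn = cong₂ (λ a b → length a + length b) (res-inner (inj₁ refl) inn) (res-inner (inj₂ refl) inn)

    cnt-outer : ∀ {r} ys → Outer r → cnt (r ∷ ys) ≡ suc (cnt ys)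
    cnt-outer {r} ys (inj₁ eq) = cong₂ _+_
      (cong length (Listₚ.filter-accept (λ x → ρ x ≟ lo) eq))
      (cong length (Listₚ.filter-reject (λ x → ρ x ≟ hi) {xs = ys} (λ eq' → lo≢hi (trans (sym eq) eq'))))
    cnt-outer {r} ys (inj₂ eq) = trans (cong₂ _+_
      (cong length (Listₚ.filter-reject (λ x → ρ x ≟ lo) {xs = ys} (λ eq' → lo≢hi (trans (sym eq') eq))))
      (cong length (Listₚ.filter-accept (λ x → ρ x ≟ hi) eq))) (+-suc _ _)

    blockOf : List ℕ → ℤ
    blockOf rs = block n (res rs lo) (res rs hi)

    none : ∀ rs → length rs ≡ 2 + n → All Inner rs → D (E lo) rs ≡ 0ℤ
    none rs len inn = D-zero-column rs 0 (subst (0 <_) (sym len) z<s) (All.map inner-first inn)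

    -- Whichever column is taken by the only outer row, one of the two extreme columns survives in
    -- the minor, where all its entries belong to inner rows.
    one : ∀ xs r ys → length (xs ++ ys) ≡ suc n → All Inner xs → All Inner ys → D (E lo) (xs ++ r ∷ ys) ≡ 0ℤ
    one xs r ys len inn inn' = trans (D-front (E lo) xs r ys)
      (trans (cong (negOnePow (length xs) ℤ.*_) (sumTo-zero (suc (length (xs ++ ys))) (λ j _ → go j))) (ℤₚ.*-zeroʳ (negOnePow (length xs))))
      where
      both : All Inner (xs ++ ys)
      both = Allₚ.++⁺ inn inn'
      go : ∀ j → negOnePow j ℤ.* (E lo r j ℤ.* D (minor j (E lo)) (xs ++ ys)) ≡ 0ℤ
      go zero    = term-zeroʳ 1ℤ (E lo r 0) (D-zero-column (xs ++ ys) n (≤-reflexive (sym len)) (All.map inner-last both))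
      go (suc j) = term-zeroʳ (negOnePow (suc j)) (E lo r (suc j)) (D-zero-column (xs ++ ys) 0 (subst (0 <_) (sym len) z<s) (All.map inner-first both))

    shift-E : ∀ rs → D (λ x q → E lo x (suc q)) rs ≡ D (E (suc lo)) rs
    shift-E rs = D-cong rs (λ x q _ _ → cong (entry x) (+-suc lo q))

    corner : ∀ xs r ys s zs → length ((xs ++ ys) ++ zs) ≡ n → Outer r → Outer s →
      D (E lo) (xs ++ r ∷ ys ++ s ∷ zs) ≡
      negOnePow (length ys) ℤ.* (negOnePow n ℤ.* (E lo r 0 ℤ.* E lo s (suc n) ℤ.- E lo r (suc n) ℤ.* E lo s 0) ℤ.* D (E (suc lo)) ((xs ++ ys) ++ zs))
    corner xs r ys s zs len out out' = trans (D-front₂ (E lo) xs r ys s zs)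
      (cong (negOnePow (length ys) ℤ.*_) (trans
        (D-corner n r s ((xs ++ ys) ++ zs) len (outer-middle out) (outer-middle out'))
        (cong ((negOnePow n ℤ.* (E lo r 0 ℤ.* E lo s (suc n) ℤ.- E lo r (suc n) ℤ.* E lo s 0)) ℤ.*_) (shift-E ((xs ++ ys) ++ zs)))))

    -- Two outer rows use up both extreme columns, and a third outer row is zero in all the others.
    three : ∀ xs r ys s zs u us → length ((xs ++ ys) ++ zs ++ u ∷ us) ≡ n → Outer r → Outer s → Outer u →
      D (E lo) (xs ++ r ∷ ys ++ s ∷ zs ++ u ∷ us) ≡ 0ℤ
    three xs r ys s zs u us len out out' out'' = trans (corner xs r ys s (zs ++ u ∷ us) len out out')
      (term-zeroʳ (negOnePow (length ys)) (negOnePow n ℤ.* (E lo r 0 ℤ.* E lo s (suc n) ℤ.- E lo r (suc n) ℤ.* E lo s 0)) zero-minor)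
      where
      assoc : (xs ++ ys) ++ zs ++ u ∷ us ≡ ((xs ++ ys) ++ zs) ++ u ∷ us
      assoc = sym (Listₚ.++-assoc (xs ++ ys) zs (u ∷ us))
      len' : length (u ∷ ((xs ++ ys) ++ zs) ++ us) ≡ n
      len' = trans (sym (trans (Listₚ.length-++ ((xs ++ ys) ++ zs) {u ∷ us}) (trans (+-suc _ _) (cong suc (sym (Listₚ.length-++ ((xs ++ ys) ++ zs)))))))
                   (trans (cong length (sym assoc)) len)
      zero-minor : D (E (suc lo)) ((xs ++ ys) ++ zs ++ u ∷ us) ≡ 0ℤ
      zero-minor = trans (cong (D (E (suc lo))) assoc) (D-zero-row ((xs ++ ys) ++ zs) u us
        (λ q q< → trans (cong (entry u) (sym (+-suc lo q))) (outer-middle out'' (suc q) z<s (s<s (subst (q <_) len' q<)))))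

    StrictInner : ℕ → Set
    StrictInner x = lo < ρ x × ρ x < hi

    strict⇒inner : ∀ {x} → StrictInner x → Inner x
    strict⇒inner (lo<ρ , ρ<hi) (inj₁ eq) = <-irrefl (sym eq) lo<ρ
    strict⇒inner (lo<ρ , ρ<hi) (inj₂ eq) = <-irrefl eq ρ<hi

    res-hit : ∀ {r i} → ρ r ≡ i → res (r ∷ []) i ≡ r ∷ []
    res-hit eq = Listₚ.filter-accept (λ x → ρ x ≟ _) eq

    res-miss : ∀ {r i} → ρ r ≢ i → res (r ∷ []) i ≡ []
    res-miss neq = Listₚ.filter-reject (λ x → ρ x ≟ _) neq

    res-split : ∀ xs r ys s zs i → res (xs ++ r ∷ ys ++ s ∷ zs) i ≡
      res xs i ++ res (r ∷ []) i ++ res ys i ++ res (s ∷ []) i ++ res zs i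
    res-split xs r ys s zs i = trans (Listₚ.filter-++ P? xs (r ∷ ys ++ s ∷ zs)) (cong (res xs i ++_)
      (trans (Listₚ.filter-++ P? (r ∷ []) (ys ++ s ∷ zs)) (cong (res (r ∷ []) i ++_)
      (trans (Listₚ.filter-++ P? ys (s ∷ zs)) (cong (res ys i ++_) (Listₚ.filter-++ P? (s ∷ []) zs))))))
      where P? = λ x → ρ x ≟ i

    module Two (xs : List ℕ) (r : ℕ) (ys : List ℕ) (s : ℕ) (zs : List ℕ) (len : length ((xs ++ ys) ++ zs) ≡ n)
      (inx : All StrictInner xs) (iny : All StrictInner ys) (inz : All StrictInner zs) where

      rs rest : List ℕ
      rs   = xs ++ r ∷ ys ++ s ∷ zs
      rest = (xs ++ ys) ++ zs

      private
        X = negOnePow (length xs)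
        Y = negOnePow (length ys)
        Z = negOnePow (length zs)
        I = negOnePow (inversions (map ρ rest))
        d = D (E (suc lo)) rest

      res-outer : ∀ {i A B} → i ≡ lo ⊎ i ≡ hi → res (r ∷ []) i ≡ A → res (s ∷ []) i ≡ B → res rs i ≡ A ++ B
      res-outer {i} i≡ refl refl = trans (res-split xs r ys s zs i) (trans
        (cong₂ (λ u v → u ++ res (r ∷ []) i ++ v ++ res (s ∷ []) i ++ res zs i) (inn inx) (inn iny))
        (cong (res (r ∷ []) i ++_) (trans (cong (res (s ∷ []) i ++_) (inn inz)) (Listₚ.++-identityʳ _))))
        where
        inn : ∀ {l} → All StrictInner l → res l i ≡ []
        inn inl = res-inner i≡ (All.map strict⇒inner inl)

      res-rest : ∀ i → lo < i → i < hi → Outer r → Outer s → res rs i ≡ res rest i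
      res-rest i lo<i i<hi out out' = trans (res-split xs r ys s zs i) (trans
        (cong₂ (λ u v → res xs i ++ u ++ res ys i ++ v ++ res zs i) (miss out) (miss out'))
        (sym (trans (Listₚ.filter-++ _ (xs ++ ys) zs) (trans (cong (_++ res zs i) (Listₚ.filter-++ _ xs ys)) (Listₚ.++-assoc (res xs i) (res ys i) (res zs i))))))
        where
        miss : ∀ {r} → Outer r → res (r ∷ []) i ≡ []
        miss (inj₁ eq) = res-miss (λ eq' → <⇒≢ lo<i (trans (sym eq) eq'))
        miss (inj₂ eq) = res-miss (λ eq' → <⇒≢ i<hi (trans (sym eq') eq))

      map-rs : map ρ rs ≡ map ρ xs ++ ρ r ∷ map ρ ys ++ ρ s ∷ map ρ zs
      map-rs = trans (Listₚ.map-++ ρ xs (r ∷ ys ++ s ∷ zs)) (cong (λ l → map ρ xs ++ ρ r ∷ l) (Listₚ.map-++ ρ ys (s ∷ zs)))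

      map-rest : (map ρ xs ++ map ρ ys) ++ map ρ zs ≡ map ρ rest
      map-rest = sym (trans (Listₚ.map-++ ρ (xs ++ ys) zs) (cong (_++ map ρ zs) (Listₚ.map-++ ρ xs ys)))

      N≡ : negOnePow n ≡ X ℤ.* Y ℤ.* Z
      N≡ = trans (cong negOnePow (sym len)) (trans (cong negOnePow (trans (Listₚ.length-++ (xs ++ ys)) (cong (_+ length zs) (Listₚ.length-++ xs))))
        (trans (negOnePow-+ (length xs + length ys) (length zs)) (cong (ℤ._* Z) (negOnePow-+ (length xs) (length ys)))))

      lo<hi : lo < hi
      lo<hi = m<m+n lo z<s

      open Extremes lo hi lo<hi (map ρ xs) (map ρ ys) (map ρ zs) (Allₚ.map⁺ inx) (Allₚ.map⁺ iny) (Allₚ.map⁺ inz)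

      signs : ∀ {v w} → ρ r ≡ v → ρ s ≡ w → inversions (map ρ rs) ≡ inversions (map ρ xs ++ v ∷ map ρ ys ++ w ∷ map ρ zs)
      signs refl refl = cong inversions map-rs

      lenX : negOnePow (length (map ρ xs)) ≡ X
      lenX = cong negOnePow (Listₚ.length-map ρ xs)
      lenY : negOnePow (length (map ρ ys)) ≡ Y
      lenY = cong negOnePow (Listₚ.length-map ρ ys)
      lenZ : negOnePow (length (map ρ zs)) ≡ Z
      lenZ = cong negOnePow (Listₚ.length-map ρ zs)
      I≡ : negOnePow (inversions ((map ρ xs ++ map ρ ys) ++ map ρ zs)) ≡ I
      I≡ = cong (negOnePow ∘ inversions) map-rest

      -- The common part of the four cases below: each supplies the sign of the residues, the four
      -- corner entries and the value of the block, together with one polynomial identity.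
      combine : ∀ {σ p q p' q'} {v : ℤ} → Outer r → Outer s → negOnePow (inversions (map ρ rs)) ≡ σ →
        E lo r 0 ≡ p → E lo r (suc n) ≡ q → E lo s 0 ≡ p' → E lo s (suc n) ≡ q' →
        σ ℤ.* (Y ℤ.* (negOnePow n ℤ.* (p ℤ.* q' ℤ.- q ℤ.* p') ℤ.* d)) ≡ v ℤ.* (I ℤ.* d) → blockOf rs ≡ v →
        negOnePow (inversions (map ρ rs)) ℤ.* D (E lo) rs ≡ blockOf rs ℤ.* (I ℤ.* d)
      combine out out' refl refl refl refl refl eq beq = trans
        (cong (negOnePow (inversions (map ρ rs)) ℤ.*_) (corner xs r ys s zs len out out'))
        (trans eq (cong (ℤ._* (I ℤ.* d)) (sym beq)))

      cancel₃ : ∀ {x} → X ℤ.* X ℤ.* (Y ℤ.* Y ℤ.* (Z ℤ.* Z ℤ.* x)) ≡ x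
      cancel₃ {x} = trans (negOnePow-cancel (length xs) _) (trans (negOnePow-cancel (length ys) _) (negOnePow-cancel (length zs) x))

      two : Outer r → Outer s →
        negOnePow (inversions (map ρ rs)) ℤ.* D (E lo) rs ≡ blockOf rs ℤ.* (I ℤ.* d)
      two (inj₁ er) (inj₁ es) = combine (inj₁ er) (inj₁ es)
        (trans (cong negOnePow (signs er es)) (trans sign-lo-lo (cong₂ ℤ._*_ lenY I≡)))
        (entry-lo-first er) (entry-lo-last er) (entry-lo-first es) (entry-lo-last es)
        (trans (alg Y I (negOnePow n) (+ κ r) (+ κ s) d) (negOnePow-cancel (length ys) _))
        (cong₂ (block n) (res-outer (inj₁ refl) (res-hit er) (res-hit es))
                         (res-outer (inj₂ refl) (res-miss (λ e → lo≢hi (trans (sym er) e))) (res-miss (λ e → lo≢hi (trans (sym es) e)))))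
        where
        alg : ∀ Y I N a b d → (Y ℤ.* I) ℤ.* (Y ℤ.* (N ℤ.* (a ℤ.* (1ℤ ℤ.+ b) ℤ.- (1ℤ ℤ.+ a) ℤ.* b) ℤ.* d)) ≡ Y ℤ.* Y ℤ.* (N ℤ.* (a ℤ.- b) ℤ.* (I ℤ.* d))
        alg = solve-∀
      two (inj₁ er) (inj₂ es) = combine (inj₁ er) (inj₂ es)
        (trans (cong negOnePow (signs er es)) (trans sign-lo-hi (cong₂ ℤ._*_ (cong₂ ℤ._*_ lenX lenZ) I≡)))
        (entry-lo-first er) (entry-lo-last er) (entry-hi-first es) (entry-hi-last es)
        (trans (cong (λ N → (X ℤ.* Z ℤ.* I) ℤ.* (Y ℤ.* (N ℤ.* (+ κ r ℤ.* + κ s ℤ.- (1ℤ ℤ.+ + κ r) ℤ.* (1ℤ ℤ.+ + κ s)) ℤ.* d))) N≡)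
          (trans (alg X Y Z I (+ κ r) (+ κ s) d) cancel₃))
        (cong₂ (block n) (res-outer (inj₁ refl) (res-hit er) (res-miss (λ e → lo≢hi (trans (sym e) es))))
                         (res-outer (inj₂ refl) (res-miss (λ e → lo≢hi (trans (sym er) e))) (res-hit es)))
        where
        alg : ∀ X Y Z I a b d → (X ℤ.* Z ℤ.* I) ℤ.* (Y ℤ.* ((X ℤ.* Y ℤ.* Z) ℤ.* (a ℤ.* b ℤ.- (1ℤ ℤ.+ a) ℤ.* (1ℤ ℤ.+ b)) ℤ.* d)) ≡
          X ℤ.* X ℤ.* (Y ℤ.* Y ℤ.* (Z ℤ.* Z ℤ.* (ℤ.- (a ℤ.+ b ℤ.+ 1ℤ) ℤ.* (I ℤ.* d))))
        alg = solve-∀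
      two (inj₂ er) (inj₁ es) = combine (inj₂ er) (inj₁ es)
        (trans (cong negOnePow (signs er es)) (trans sign-hi-lo (cong ℤ.-_ (cong₂ ℤ._*_ (cong₂ ℤ._*_ lenX lenZ) I≡))))
        (entry-hi-first er) (entry-hi-last er) (entry-lo-first es) (entry-lo-last es)
        (trans (cong (λ N → ℤ.- (X ℤ.* Z ℤ.* I) ℤ.* (Y ℤ.* (N ℤ.* ((1ℤ ℤ.+ + κ r) ℤ.* (1ℤ ℤ.+ + κ s) ℤ.- + κ r ℤ.* + κ s) ℤ.* d))) N≡)
          (trans (alg X Y Z I (+ κ r) (+ κ s) d) cancel₃))
        (cong₂ (block n) (res-outer (inj₁ refl) (res-miss (λ e → lo≢hi (trans (sym e) er))) (res-hit es))
                         (res-outer (inj₂ refl) (res-hit er) (res-miss (λ e → lo≢hi (trans (sym es) e)))))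
        where
        alg : ∀ X Y Z I a b d → ℤ.- (X ℤ.* Z ℤ.* I) ℤ.* (Y ℤ.* ((X ℤ.* Y ℤ.* Z) ℤ.* ((1ℤ ℤ.+ a) ℤ.* (1ℤ ℤ.+ b) ℤ.- a ℤ.* b) ℤ.* d)) ≡
          X ℤ.* X ℤ.* (Y ℤ.* Y ℤ.* (Z ℤ.* Z ℤ.* (ℤ.- (b ℤ.+ a ℤ.+ 1ℤ) ℤ.* (I ℤ.* d))))
        alg = solve-∀
      two (inj₂ er) (inj₂ es) = combine (inj₂ er) (inj₂ es)
        (trans (cong negOnePow (signs er es)) (trans sign-hi-hi (cong₂ ℤ._*_ lenY I≡)))
        (entry-hi-first er) (entry-hi-last er) (entry-hi-first es) (entry-hi-last es)
        (trans (alg Y I (negOnePow n) (+ κ r) (+ κ s) d) (negOnePow-cancel (length ys) _))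
        (cong₂ (block n) (res-outer (inj₁ refl) (res-miss (λ e → lo≢hi (trans (sym e) er))) (res-miss (λ e → lo≢hi (trans (sym e) es))))
                         (res-outer (inj₂ refl) (res-hit er) (res-hit es)))
        where
        alg : ∀ Y I N a b d → (Y ℤ.* I) ℤ.* (Y ℤ.* (N ℤ.* ((1ℤ ℤ.+ a) ℤ.* b ℤ.- a ℤ.* (1ℤ ℤ.+ b)) ℤ.* d)) ≡ Y ℤ.* Y ℤ.* (N ℤ.* (b ℤ.- a) ℤ.* (I ℤ.* d))
        alg = solve-∀

  -- The hypothesis `lo + lo + n ≡ suc S` says that the remaining columns `lo, ..., lo + n - 1` are
  -- symmetric under `q ↦ S - q`. The bounds on the residues make every inner row lie strictly
  -- between the extremes, as is needed for the signs in `Extremes` and for the next step.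
  signed-D : ∀ n lo rs → length rs ≡ n → lo + lo + n ≡ suc S → All (λ x → lo ≤ ρ x × ρ x < lo + n) rs →
    negOnePow (inversions (map ρ rs)) ℤ.* D (E lo) rs ≡ blocks n lo (res rs)
  signed-D zero lo [] len S≡ bounds = refl
  signed-D (suc zero) lo (x ∷ []) len S≡ ((lo≤ , <lo+1) ∷ []) = trans (alg (E lo x 0))
    (trans (entry-both (trans ρ≡lo (sym (+-identityʳ lo))) (trans (cong₂ _+_ ρ≡lo (+-identityʳ lo)) (suc-injective (trans (+-comm 1 (lo + lo)) S≡))))
      (cong centre (sym (Listₚ.filter-accept (λ x → ρ x ≟ lo) ρ≡lo))))
    where
    ρ≡lo : ρ x ≡ lo
    ρ≡lo = ≤-antisym (s≤s⁻¹ (subst (ρ x <_) (+-comm lo 1) <lo+1)) lo≤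
    alg : ∀ e → 1ℤ ℤ.* (0ℤ ℤ.+ 1ℤ ℤ.* (e ℤ.* 1ℤ)) ≡ e
    alg = solve-∀
  -- Search for a first, a second and a third outer row. Exactly two give a block; for any other
  -- number both sides vanish.
  signed-D (suc (suc n)) lo rs len S≡ bounds = go (split-first outer? rs)
    where
    open Peel n lo (interval-ends lo n S≡)
    Goal : List ℕ → Set
    Goal rs = negOnePow (inversions (map ρ rs)) ℤ.* D (E lo) rs ≡ blocks (2 + n) lo (res rs)
    vanish : ∀ rs → D (E lo) rs ≡ 0ℤ → cnt rs ≢ 2 → Goal rs
    vanish rs D≡0 c≢2 = trans (cong (negOnePow (inversions (map ρ rs)) ℤ.*_) D≡0)
      (trans (ℤₚ.*-zeroʳ (negOnePow (inversions (map ρ rs)))) (sym (cong (ℤ._* blocks n (suc lo) (res rs)) (block-zero n (res rs lo) (res rs hi) c≢2))))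
    cnt-first : ∀ xs {r} ys → All Inner xs → Outer r → cnt (xs ++ r ∷ ys) ≡ suc (cnt ys)
    cnt-first xs ys inn out = trans (cnt-++ xs _) (cong₂ _+_ (cnt-inner inn) (cnt-outer ys out))
    strict : ∀ {xs} → All (λ x → lo ≤ ρ x × ρ x < lo + (2 + n)) xs → All Inner xs → All StrictInner xs
    strict bs is = All.zipWith (λ { {x} ((lo≤ , <hi) , inn) →
      ≤∧≢⇒< lo≤ (λ eq → inn (inj₁ (sym eq))) ,
      ≤∧≢⇒< (s≤s⁻¹ (subst (ρ x <_) (+-suc lo (suc n)) <hi)) (λ eq → inn (inj₂ eq)) }) (bs , is)
    go : (All Inner rs ⊎ (∃ λ xs → ∃ λ r → ∃ λ ys → rs ≡ xs ++ r ∷ ys × All Inner xs × Outer r)) → Goal rs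
    go (inj₁ inn) = vanish rs (none rs len inn) (λ c≡2 → 0≢1+n (trans (sym (cnt-inner inn)) c≡2))
    go (inj₂ (xs , r , ys , refl , inx , outr)) = go₂ (split-first outer? ys)
      where
      len₁ : length (xs ++ ys) ≡ suc n
      len₁ = suc-injective (trans (sym (length-insert xs r ys)) len)
      go₂ : (All Inner ys ⊎ (∃ λ us → ∃ λ s → ∃ λ zs → ys ≡ us ++ s ∷ zs × All Inner us × Outer s)) → Goal rs
      go₂ (inj₁ iny) = vanish rs (one xs r ys len₁ inx iny)
        (λ c≡2 → 0≢1+n (suc-injective (trans (sym (trans (cnt-first xs ys inx outr) (cong suc (cnt-inner iny)))) c≡2)))
      go₂ (inj₂ (us , s , zs , refl , inu , outs)) = go₃ (split-first outer? zs)
        where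
        len₂ : length ((xs ++ us) ++ zs) ≡ n
        len₂ = suc-injective (trans (sym (length-insert (xs ++ us) s zs)) (trans (cong length (Listₚ.++-assoc xs us (s ∷ zs))) len₁))
        go₃ : (All Inner zs ⊎ (∃ λ vs → ∃ λ u → ∃ λ ws → zs ≡ vs ++ u ∷ ws × All Inner vs × Outer u)) → Goal rs
        go₃ (inj₂ (vs , u , ws , refl , inv , outu)) = vanish rs (three xs r us s vs u ws len₂ outr outs outu)
          (λ c≡2 → 0≢1+n (suc-injective (suc-injective (trans (sym c≡2)
            (trans (cnt-first xs _ inx outr) (cong suc (trans (cnt-first us _ inu outs) (cong suc (cnt-first vs ws inv outu)))))))))
        go₃ (inj₁ inz) = trans (two outr outs) (cong (blockOf rs ℤ.*_) (trans
          (signed-D n (suc lo) rest len₂ (interval-inner lo n S≡) bounds')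
          (blocks-cong n (suc lo) λ i lo<i i< → sym (res-rest i lo<i (<-≤-trans i< (≤-reflexive (sym (+-suc lo n)))) outr outs))))
          where
          bx : All (λ x → lo ≤ ρ x × ρ x < lo + (2 + n)) xs
          bx = Allₚ.++⁻ˡ xs bounds
          b₁ : All (λ x → lo ≤ ρ x × ρ x < lo + (2 + n)) (us ++ s ∷ zs)
          b₁ = All.tail (Allₚ.++⁻ʳ xs bounds)
          inx' = strict bx inx
          inu' = strict (Allₚ.++⁻ˡ us b₁) inu
          inz' = strict (All.tail (Allₚ.++⁻ʳ us b₁)) inz
          open Two xs r us s zs len₂ inx' inu' inz' using (rest; two; res-rest)
          bounds' : All (λ x → suc lo ≤ ρ x × ρ x < suc lo + n) rest
          bounds' = All.map (λ { {x} (lo<ρ , ρ<hi) → lo<ρ , subst (ρ x <_) (+-suc lo n) ρ<hi }) (Allₚ.++⁺ (Allₚ.++⁺ inx' inu') inz')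

filter-length-↭ : ∀ {P : ℕ → Set} (P? : Decidable P) {xs ys} → xs ↭ ys → length (filter P? xs) ≡ length (filter P? ys)
filter-length-↭ P? p = ↭ₚ.↭-length (↭ₚ.filter-↭ P? p)

-- `upTo` with a starting value, so that an induction can move the start instead of composing
-- functions as in `applyUpTo`.
segment : ℕ → ℕ → List ℕ
segment o zero    = []
segment o (suc n) = o ∷ segment (suc o) n

applyUpTo-segment : ∀ n o (g : ℕ → ℕ) → (∀ i → g i ≡ o + i) → applyUpTo g n ≡ segment o n
applyUpTo-segment zero    o g eq = refl
applyUpTo-segment (suc n) o g eq = cong₂ _∷_ (trans (eq 0) (+-identityʳ o))
  (applyUpTo-segment n (suc o) (g ∘ suc) (λ i → trans (eq (suc i)) (+-suc o i)))

upTo-segment : ∀ n → upTo n ≡ segment 0 n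
upTo-segment n = applyUpTo-segment n 0 (λ i → i) (λ _ → refl)

-- Stable bucket sort

module Buckets (κ : ℕ → ℕ) where

  bucket : List ℕ → ℕ → List ℕ
  bucket js i = filter (λ j → κ j ≟ i) js

  buckets : List ℕ → List ℕ → List ℕ
  buckets js is = concatMap (bucket js) is

  bucket-key : ∀ js i → All (λ j → κ j ≡ i) (bucket js i)
  bucket-key js i = Allₚ.all-filter (λ j → κ j ≟ i) js

  buckets-key : ∀ js o n → All (λ j → o ≤ κ j) (buckets js (segment o n))
  buckets-key js o zero    = []
  buckets-key js o (suc n) = Allₚ.++⁺ (All.map (≤-reflexive ∘ sym) (bucket-key js o)) (All.map (≤-trans (n≤1+n o)) (buckets-key js (suc o) n))

  buckets-miss : ∀ j js o n → κ j < o → buckets (j ∷ js) (segment o n) ≡ buckets js (segment o n)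
  buckets-miss j js o zero    κ<o = refl
  buckets-miss j js o (suc n) κ<o = cong₂ _++_ (Listₚ.filter-reject (λ j → κ j ≟ o) (<⇒≢ κ<o)) (buckets-miss j js (suc o) n (m<n⇒m<1+n κ<o))

  -- As `j` precedes `js`, stability puts it at the front of its own bucket: keys before it are
  -- strictly smaller, keys after it only weakly larger.
  buckets-insert : ∀ j js o n → o ≤ κ j → κ j < o + n → ∃ λ P → ∃ λ Q →
    buckets (j ∷ js) (segment o n) ≡ P ++ j ∷ Q × buckets js (segment o n) ≡ P ++ Q × All (λ y → κ y < κ j) P × All (λ y → κ j ≤ κ y) Q
  buckets-insert j js o zero    o≤ <o = contradiction (subst (κ j <_) (+-identityʳ o) <o) (≤⇒≯ o≤)
  buckets-insert j js o (suc n) o≤ <o with κ j ≟ o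
  ... | yes refl = [] , buckets js (segment o (suc n)) ,
    cong₂ _++_ (Listₚ.filter-accept (λ y → κ y ≟ κ j) refl) (buckets-miss j js (suc o) n ≤-refl) , refl , [] , buckets-key js o (suc n)
  ... | no κ≢o with buckets-insert j js (suc o) n (≤∧≢⇒< o≤ (κ≢o ∘ sym)) (subst (κ j <_) (+-suc o n) <o)
  ...   | P , Q , eq , eq' , allP , allQ = bucket js o ++ P , Q ,
    trans (cong₂ _++_ (Listₚ.filter-reject (λ y → κ y ≟ o) κ≢o) eq) (sym (Listₚ.++-assoc (bucket js o) P (j ∷ Q))) ,
    trans (cong (bucket js o ++_) eq') (sym (Listₚ.++-assoc (bucket js o) P Q)) ,
    Allₚ.++⁺ (All.map (λ eq → ≤-<-trans (≤-reflexive eq) (≤∧≢⇒< o≤ (κ≢o ∘ sym))) (bucket-key js o)) allP , allQ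

  buckets-[] : ∀ o n → buckets [] (segment o n) ≡ []
  buckets-[] o zero    = refl
  buckets-[] o (suc n) = buckets-[] (suc o) n

  buckets-↭ : ∀ js n → All (λ j → κ j < n) js → buckets js (segment 0 n) ↭ js
  buckets-↭ []       n []          = ↭-reflexive (buckets-[] 0 n)
  buckets-↭ (j ∷ js) n (κ< ∷ κs<) with buckets-insert j js 0 n z≤n κ<
  ... | P , Q , eq , eq' , _ = ↭-trans (↭-reflexive eq) (↭-trans (↭ₚ.shift j P Q) (prep j (↭-trans (↭-reflexive (sym eq')) (buckets-↭ js n κs<))))

  -- Remove the smallest index `j`. Its inversions in the sorted list are with all the entries
  -- before it, and these are exactly the indices of smaller key, that is, its inversions in the
  -- list of keys.
  buckets-inversions : ∀ js n → AllPairs _<_ js → All (λ j → κ j < n) js → inversions (buckets js (segment 0 n)) ≡ inversions (map κ js)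
  buckets-inversions []       n []          []         = cong inversions (buckets-[] 0 n)
  buckets-inversions (j ∷ js) n (j< ∷ inc) (κ< ∷ κs<) with buckets-insert j js 0 n z≤n κ<
  ... | P , Q , eq , eq' , allP , allQ = begin
    inversions (buckets (j ∷ js) (segment 0 n))
      ≡⟨ cong inversions eq ⟩
    inversions (P ++ j ∷ Q)
      ≡⟨ inversions-insert P j Q ⟩
    countAbove j P + (countBelow j Q + inversions (P ++ Q))
      ≡⟨ cong₂ _+_ (filter-length-all _ (Allₚ.++⁻ˡ P above)) (cong₂ _+_ (filter-length-none _ (All.map <-asym (Allₚ.++⁻ʳ P above))) (cong inversions (sym eq'))) ⟩
    length P + inversions (buckets js (segment 0 n))
      ≡⟨ cong₂ _+_ (sym below) (buckets-inversions js n inc κs<) ⟩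
    countBelow (κ j) (map κ js) + inversions (map κ js) ∎
    where
    open ≡-Reasoning
    perm : js ↭ P ++ Q
    perm = ↭-trans (↭-sym (buckets-↭ js n κs<)) (↭-reflexive eq')
    above : All (j <_) (P ++ Q)
    above = ↭ₚ.All-resp-↭ perm j<
    below : countBelow (κ j) (map κ js) ≡ length P
    below = begin
      countBelow (κ j) (map κ js)              ≡⟨ filter-length-↭ _ (↭ₚ.map⁺ κ perm) ⟩
      countBelow (κ j) (map κ (P ++ Q))        ≡⟨ cong (countBelow (κ j)) (Listₚ.map-++ κ P Q) ⟩
      countBelow (κ j) (map κ P ++ map κ Q)    ≡⟨ filter-length-++ _ (map κ P) (map κ Q) ⟩
      countBelow (κ j) (map κ P) + countBelow (κ j) (map κ Q)
        ≡⟨ cong₂ _+_ (filter-length-all _ (Allₚ.map⁺ allP)) (filter-length-none _ (Allₚ.map⁺ (All.map ≤⇒≯ allQ))) ⟩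
      length (map κ P) + 0                     ≡⟨ +-identityʳ _ ⟩
      length (map κ P)                         ≡⟨ Listₚ.length-map κ P ⟩
      length P                                 ∎

map-partAt : ∀ β → map (partAt β) (oneTo (length β)) ≡ β
map-partAt β = trans (sym (Listₚ.map-∘ (upTo (length β)))) (trans (Listₚ.map-upTo (partAt β ∘ suc) (length β)) (go β))
  where
  go : ∀ β → applyUpTo (partAt β ∘ suc) (length β) ≡ β
  go []      = refl
  go (x ∷ β) = cong (x ∷_) (go β)

oneTo-increasing : ∀ n → AllPairs _<_ (oneTo n)
oneTo-increasing n = subst (AllPairs _<_) (sym (trans (Listₚ.map-upTo suc n) (applyUpTo-segment n 1 suc (λ _ → refl)))) (segment-inc 1 n)
  where
  segment-≥ : ∀ o n → All (o ≤_) (segment o n)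
  segment-≥ o zero    = []
  segment-≥ o (suc n) = ≤-refl ∷ All.map <⇒≤ (segment-≥ (suc o) n)
  segment-inc : ∀ o n → AllPairs _<_ (segment o n)
  segment-inc o zero    = []
  segment-inc o (suc n) = segment-≥ (suc o) n ∷ segment-inc (suc o) n

sgn-sortPerm : ∀ t .{{_ : NonZero t}} β → sgn (sortPerm t β) ≡ negOnePow (inversions (map (_% t) β))
sgn-sortPerm t β = cong negOnePow (begin
  inversions (sortPerm t β)
    ≡⟨ cong (λ l → inversions (buckets (oneTo (length β)) l)) (upTo-segment t) ⟩
  inversions (buckets (oneTo (length β)) (segment 0 t))
    ≡⟨ buckets-inversions (oneTo (length β)) t (oneTo-increasing (length β)) (All.universal (λ j → m%n<n (partAt β j) t) _) ⟩
  inversions (map (λ j → partAt β j % t) (oneTo (length β)))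
    ≡⟨ cong inversions (Listₚ.map-∘ (oneTo (length β))) ⟩
  inversions (map (_% t) (map (partAt β) (oneTo (length β))))
    ≡⟨ cong (λ l → inversions (map (_% t) l)) (map-partAt β) ⟩
  inversions (map (_% t) β) ∎)
  where
  open ≡-Reasoning
  open Buckets (λ j → partAt β j % t)

-- The first column and the rows of residue `t - 1`

module Columns (S : ℕ) where
  t : ℕ
  t = suc (suc S)

  open Blocks (_% t) (_/ t) S public

  -- The first column is written as a sum of two equal terms because its two `h` have the same
  -- index.
  E₀ : Entries
  E₀ x zero    = when (x % t ≟ suc S) (+ suc (x / t)) ℤ.+ when (x % t ≟ suc S) (+ suc (x / t))
  E₀ x (suc q) = entry x q

  top : List ℕ → ℤ
  top (x ∷ []) = + suc (x / t)
  top _        = 0ℤ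

  -- Rows of residue `suc S` are supported on the first column and all other rows vanish there, so
  -- there must be exactly one of them. Moving it to the front crosses `xs`, its inversions are with
  -- all of `ys`, and together this gives the sign of the `suc S` other rows.
  signed-D₀ : ∀ β → length β ≡ t →
    negOnePow (inversions (map (_% t) β)) ℤ.* D E₀ β ≡ + 2 ℤ.* (negOnePow (suc S) ℤ.* (top (res β (suc S)) ℤ.* blocks (suc S) 0 (res β)))
  signed-D₀ β len = go (split-first last? β)
    where
    Last : ℕ → Set
    Last x = x % t ≡ suc S
    last? : Decidable Last
    last? x = x % t ≟ suc S
    Goal : List ℕ → Set
    Goal β = negOnePow (inversions (map (_% t) β)) ℤ.* D E₀ β ≡ + 2 ℤ.* (negOnePow (suc S) ℤ.* (top (res β (suc S)) ℤ.* blocks (suc S) 0 (res β)))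
    vanish : ∀ β → D E₀ β ≡ 0ℤ → top (res β (suc S)) ≡ 0ℤ → Goal β
    vanish β D≡0 top≡0 = trans (cong (negOnePow (inversions (map (_% t) β)) ℤ.*_) D≡0)
      (trans (ℤₚ.*-zeroʳ (negOnePow (inversions (map (_% t) β))))
        (sym (trans (cong (λ u → + 2 ℤ.* (negOnePow (suc S) ℤ.* (u ℤ.* blocks (suc S) 0 (res β)))) top≡0)
          (cong (+ 2 ℤ.*_) (ℤₚ.*-zeroʳ (negOnePow (suc S)))))))
    last-entry : ∀ {x} q → Last x → q < suc S → entry x q ≡ 0ℤ
    last-entry {x} q last q< = entry-none {x} (λ eq → <⇒≢ q< (trans (sym eq) last))
      (λ eq → <⇒≢ (≤-trans (≤-reflexive (sym last)) (m≤m+n _ q)) (sym eq))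
    E₀-first : ∀ {x} → Last x → E₀ x 0 ≡ + suc (x / t) ℤ.+ + suc (x / t)
    E₀-first {x} last = cong₂ ℤ._+_ (when-yes (x % t ≟ suc S) last) (when-yes (x % t ≟ suc S) last)
    E₀-zero : ∀ {x} → ¬ Last x → E₀ x 0 ≡ 0ℤ
    E₀-zero {x} ¬last = cong₂ ℤ._+_ (when-no (x % t ≟ suc S) ¬last) (when-no (x % t ≟ suc S) ¬last)
    res-first : ∀ xs {r} ys → All (¬_ ∘ Last) xs → Last r → res (xs ++ r ∷ ys) (suc S) ≡ r ∷ res ys (suc S)
    res-first xs {r} ys nox last = trans (Listₚ.filter-++ last? xs _) (cong₂ _++_ (Listₚ.filter-none last? nox) (Listₚ.filter-accept last? {r} last))
    go : (All (¬_ ∘ Last) β ⊎ (∃ λ xs → ∃ λ r → ∃ λ ys → β ≡ xs ++ r ∷ ys × All (¬_ ∘ Last) xs × Last r)) → Goal β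
    go (inj₁ noβ) = vanish β (D-zero-column β 0 (subst (0 <_) (sym len) z<s) (All.map (λ {x} → E₀-zero {x}) noβ)) (cong top (Listₚ.filter-none last? noβ))
    go (inj₂ (xs , r , ys , refl , nox , last)) = go₂ (split-first last? ys)
      where
      rest = xs ++ ys
      len₁ : length rest ≡ suc S
      len₁ = suc-injective (trans (sym (length-insert xs r ys)) len)
      X = negOnePow (length xs)
      Y = negOnePow (length ys)
      d = D (E 0) rest
      expand : D E₀ (xs ++ r ∷ ys) ≡ X ℤ.* (1ℤ ℤ.* (E₀ r 0 ℤ.* d))
      expand = trans (D-front E₀ xs r ys) (cong (X ℤ.*_) (trans (sumTo-head (length rest) _)
        (trans (cong (λ u → 1ℤ ℤ.* (E₀ r 0 ℤ.* d) ℤ.+ u) (sumTo-zero (length rest) (λ j j< → term-zeroˡ (negOnePow (suc j)) _ (last-entry {r} j last (subst (j <_) len₁ j<)))))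
          (ℤₚ.+-identityʳ _))))
      go₂ : (All (¬_ ∘ Last) ys ⊎ (∃ λ us → ∃ λ s → ∃ λ zs → ys ≡ us ++ s ∷ zs × All (¬_ ∘ Last) us × Last s)) → Goal (xs ++ r ∷ ys)
      go₂ (inj₂ (us , s , zs , refl , nou , last')) = vanish (xs ++ r ∷ ys)
        (trans expand (trans (cong (λ u → X ℤ.* (1ℤ ℤ.* (E₀ r 0 ℤ.* u))) d≡0) (term-zeroʳ X 1ℤ (ℤₚ.*-zeroʳ (E₀ r 0)))))
        (cong top (trans (res-first xs {r} ys nox last) (cong (r ∷_) (res-first us {s} zs nou last'))))
        where
        d≡0 : d ≡ 0ℤ
        d≡0 = trans (cong (D (E 0)) (sym (Listₚ.++-assoc xs us (s ∷ zs)))) (D-zero-row (xs ++ us) s zs (λ q q< → last-entry {s} q last' (subst (q <_)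
          (trans (sym (length-insert (xs ++ us) s zs)) (trans (cong length (Listₚ.++-assoc xs us (s ∷ zs))) len₁)) q<)))
      go₂ (inj₁ noy) = begin
        negOnePow (inversions (map (_% t) (xs ++ r ∷ ys))) ℤ.* D E₀ (xs ++ r ∷ ys)
          ≡⟨ cong₂ ℤ._*_ sign expand ⟩
        (Y ℤ.* I) ℤ.* (X ℤ.* (1ℤ ℤ.* (E₀ r 0 ℤ.* d)))
          ≡⟨ cong (λ u → (Y ℤ.* I) ℤ.* (X ℤ.* (1ℤ ℤ.* (u ℤ.* d)))) (E₀-first {r} last) ⟩
        (Y ℤ.* I) ℤ.* (X ℤ.* (1ℤ ℤ.* ((c ℤ.+ c) ℤ.* d)))
          ≡⟨ alg X Y I c d ⟩
        + 2 ℤ.* ((X ℤ.* Y) ℤ.* (c ℤ.* (I ℤ.* d)))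
          ≡⟨ cong₂ (λ u v → + 2 ℤ.* (u ℤ.* (c ℤ.* v))) XY (signed-D (suc S) 0 rest len₁ refl bounds) ⟩
        + 2 ℤ.* (negOnePow (suc S) ℤ.* (c ℤ.* blocks (suc S) 0 (res rest)))
          ≡⟨ cong₂ (λ u v → + 2 ℤ.* (negOnePow (suc S) ℤ.* (u ℤ.* v)))
               (cong top (sym (trans (res-first xs {r} ys nox last) (cong (r ∷_) (Listₚ.filter-none last? noy)))))
               (blocks-cong (suc S) 0 (λ i _ i< → sym (res-skip i i<))) ⟩
        + 2 ℤ.* (negOnePow (suc S) ℤ.* (top (res (xs ++ r ∷ ys) (suc S)) ℤ.* blocks (suc S) 0 (res (xs ++ r ∷ ys)))) ∎
        where
        open ≡-Reasoning
        I = negOnePow (inversions (map (_% t) rest))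
        c = + suc (r / t)
        alg : ∀ X Y I c d → (Y ℤ.* I) ℤ.* (X ℤ.* (1ℤ ℤ.* ((c ℤ.+ c) ℤ.* d))) ≡ + 2 ℤ.* ((X ℤ.* Y) ℤ.* (c ℤ.* (I ℤ.* d)))
        alg = solve-∀
        XY : X ℤ.* Y ≡ negOnePow (suc S)
        XY = trans (sym (negOnePow-+ (length xs) (length ys))) (cong negOnePow (trans (sym (Listₚ.length-++ xs)) len₁))
        small : ∀ {x} → ¬ Last x → x % t < suc S
        small {x} ¬last = ≤∧≢⇒< (s≤s⁻¹ (m%n<n x t)) ¬last
        bounds : All (λ x → 0 ≤ x % t × x % t < suc S) rest
        bounds = All.map (λ {x} ¬last → z≤n , small {x} ¬last) (Allₚ.++⁺ nox noy)
        res-skip : ∀ i → i < suc S → res (xs ++ r ∷ ys) i ≡ res rest i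
        res-skip i i< = trans (Listₚ.filter-++ (λ x → x % t ≟ i) xs (r ∷ ys)) (trans
          (cong (res xs i ++_) (Listₚ.filter-reject (λ x → x % t ≟ i) {r} (λ eq → <⇒≢ i< (trans (sym eq) last))))
          (sym (Listₚ.filter-++ (λ x → x % t ≟ i) xs ys)))
        sign : negOnePow (inversions (map (_% t) (xs ++ r ∷ ys))) ≡ Y ℤ.* I
        sign = trans (cong negOnePow (begin
          inversions (map (_% t) (xs ++ r ∷ ys))
            ≡⟨ cong inversions (Listₚ.map-++ (_% t) xs (r ∷ ys)) ⟩
          inversions (map (_% t) xs ++ r % t ∷ map (_% t) ys)
            ≡⟨ inversions-insert (map (_% t) xs) (r % t) (map (_% t) ys) ⟩
          countAbove (r % t) (map (_% t) xs) + (countBelow (r % t) (map (_% t) ys) + inversions (map (_% t) xs ++ map (_% t) ys))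
            ≡⟨ cong₂ _+_ (filter-length-none _ (Allₚ.map⁺ (All.map (λ {x} ¬l → <-asym (<-≤-trans (small {x} ¬l) (≤-reflexive (sym last)))) nox)))
                 (cong₂ _+_ (trans (filter-length-all _ (Allₚ.map⁺ (All.map (λ {x} ¬l → <-≤-trans (small {x} ¬l) (≤-reflexive (sym last))) noy))) (Listₚ.length-map (_% t) ys))
                            (cong inversions (sym (Listₚ.map-++ (_% t) xs ys)))) ⟩
          length ys + inversions (map (_% t) rest) ∎)) (negOnePow-+ (length ys) _)

-- Cores and their beta-sets

conj-accept : ∀ {x y} ys → x ≤ y → conj (y ∷ ys) x ≡ suc (conj ys x)
conj-accept {x} ys x≤y = cong length (Listₚ.filter-accept (x ≤?_) x≤y)

conj-reject : ∀ {x y} ys → y < x → conj (y ∷ ys) x ≡ conj ys x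
conj-reject {x} ys y<x = cong length (Listₚ.filter-reject (x ≤?_) (<⇒≱ y<x))

conj-zero : ∀ {x} ys → All (_< x) ys → conj ys x ≡ 0
conj-zero {x} ys ys<x = filter-length-none (x ≤?_) (All.map <⇒≱ ys<x)

conj-≤-length : ∀ ν x → conj ν x ≤ length ν
conj-≤-length ν x = Listₚ.length-filter (x ≤?_) ν

partAt-∈ : ∀ ν k → 1 ≤ k → k ≤ length ν → partAt ν k ∈ ν
partAt-∈ (y ∷ ν) (suc zero)    _ _         = here refl
partAt-∈ (y ∷ ν) (suc (suc k)) _ (s≤s k≤) = there (partAt-∈ ν (suc k) (s≤s z≤n) k≤)

-- With the converse below this is the adjunction between a partition and its conjugate. It is
-- applied both to the core and to its beta-set, as both are weakly decreasing.
≤-partAt⇒≤-conj : ∀ ν k x → AllPairs _≥_ ν → 1 ≤ k → k ≤ length ν → x ≤ partAt ν k → k ≤ conj ν x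
≤-partAt⇒≤-conj (y ∷ ν) (suc zero)    x (y≥ ∷ dec) _ _         x≤ = subst (1 ≤_) (sym (conj-accept ν x≤)) (s≤s z≤n)
≤-partAt⇒≤-conj (y ∷ ν) (suc (suc k)) x (y≥ ∷ dec) _ (s≤s k≤) x≤ = subst (2 + k ≤_)
  (sym (conj-accept ν (≤-trans x≤ (All.lookup y≥ (partAt-∈ ν (suc k) (s≤s z≤n) k≤)))))
  (s≤s (≤-partAt⇒≤-conj ν (suc k) x dec (s≤s z≤n) k≤ x≤))

≤-conj⇒≤-partAt : ∀ ν k x → AllPairs _≥_ ν → 1 ≤ k → k ≤ conj ν x → x ≤ partAt ν k
≤-conj⇒≤-partAt []      (suc k) x _ _ ()
≤-conj⇒≤-partAt (y ∷ ν) (suc k) x (y≥ ∷ dec) _ k≤ with x ≤? y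
≤-conj⇒≤-partAt (y ∷ ν) (suc zero)    x (y≥ ∷ dec) _ k≤ | yes x≤y = x≤y
≤-conj⇒≤-partAt (y ∷ ν) (suc (suc k)) x (y≥ ∷ dec) _ k≤ | yes x≤y =
  ≤-conj⇒≤-partAt ν (suc k) x dec (s≤s z≤n) (s≤s⁻¹ (subst (2 + k ≤_) (conj-accept ν x≤y) k≤))
... | no x≰y = contradiction (subst (suc k ≤_) (trans (conj-reject ν (≰⇒> x≰y)) (conj-zero ν (All.map (λ y≥z → ≤-<-trans y≥z (≰⇒> x≰y)) y≥))) k≤) (λ ())

-- A strictly decreasing list contains each value at most once, so the count drops by exactly one.
conj-∈ : ∀ b x → AllPairs _>_ b → x ∈ b → conj b x ≡ suc (conj b (suc x))
conj-∈ (y ∷ b) .y (y> ∷ dec) (here refl) = trans (conj-accept b ≤-refl)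
  (cong suc (trans (conj-zero b y>) (sym (trans (conj-reject b ≤-refl) (conj-zero b (All.map m<n⇒m<1+n y>))))))
conj-∈ (y ∷ b) x (y> ∷ dec) (there x∈) = trans (conj-accept b (<⇒≤ x<y)) (cong suc (trans (conj-∈ b x dec x∈) (sym (conj-accept b x<y))))
  where
  x<y : x < y
  x<y = All.lookup y> x∈

conj-∉ : ∀ b x → x ∉ b → conj b x ≡ conj b (suc x)
conj-∉ []      x x∉ = refl
conj-∉ (y ∷ b) x x∉ with x ≤? y
... | yes x≤y = trans (conj-accept b x≤y) (trans (cong suc (conj-∉ b x (x∉ ∘ there))) (sym (conj-accept b (≤∧≢⇒< x≤y (x∉ ∘ here)))))
... | no x≰y = trans (conj-reject b (≰⇒> x≰y)) (trans (conj-∉ b x (x∉ ∘ there)) (sym (conj-reject b (m<n⇒m<1+n (≰⇒> x≰y)))))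

conj-0 : ∀ b → conj b 0 ≡ length b
conj-0 b = filter-length-all (0 ≤?_) (All.universal (λ _ → z≤n) b)

foldr-⊔-upper : ∀ {r} xs → All (_≤ r) xs → foldr _⊔_ 0 xs ≤ r
foldr-⊔-upper []       []       = z≤n
foldr-⊔-upper (x ∷ xs) (p ∷ ps) = ⊔-lub p (foldr-⊔-upper xs ps)

foldr-⊔-lower : ∀ {x xs} → x ∈ xs → x ≤ foldr _⊔_ 0 xs
foldr-⊔-lower (here refl)           = m≤m⊔n _ _
foldr-⊔-lower {xs = y ∷ xs} (there x∈) = ≤-trans (foldr-⊔-lower x∈) (m≤n⊔m y _)

partAt-zipWith : ∀ (f : ℕ → ℕ → ℕ) b n g k → length b ≡ n → k < n →
  partAt (zipWith f b (applyUpTo g n)) (suc k) ≡ f (partAt b (suc k)) (g k)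
partAt-zipWith f (y ∷ b) (suc n) g zero    len _         = refl
partAt-zipWith f (y ∷ b) (suc n) g (suc k) len (s≤s k<n) = partAt-zipWith f b n (g ∘ suc) k (suc-injective len) k<n

-- b is the beta-set of ν, where ν has S + 2 parts, listed decreasingly.
module FromBeta (S : ℕ) (b : List ℕ) (dec : AllPairs _>_ b) (len : length b ≡ suc (suc S)) where

  t : ℕ
  t = suc (suc S)

  ν : List ℕ
  ν = zipWith (λ x j → x + suc j ∸ t) b (upTo t)

  -- `conj` applied to a beta-set: the number of beta numbers that are at least the argument.
  N : ℕ → ℕ
  N = conj b

  dec≥ : AllPairs _≥_ b
  dec≥ = AllPairs.map <⇒≤ dec

  length-ν : length ν ≡ t
  length-ν = trans (Listₚ.length-zipWith _ b (upTo t)) (trans (cong₂ _⊓_ len (Listₚ.length-upTo t)) (⊓-idem t))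

  ν-part : ∀ k → 1 ≤ k → k ≤ t → partAt ν k ≡ partAt b k + k ∸ t
  ν-part (suc k) _ k≤t = partAt-zipWith (λ x j → x + suc j ∸ t) b t (λ i → i) k len k≤t

  ν-dec : AllPairs _≥_ ν
  ν-dec = subst (λ l → AllPairs _≥_ (zipWith (λ x j → x + suc j ∸ t) b l)) (sym (upTo-segment t))
    (Linkedₚ.Linked⇒AllPairs (λ p q → ≤-trans q p) (go 0 t b (Linkedₚ.AllPairs⇒Linked dec)))
    where
    go : ∀ o n b → Linked _>_ b → Linked _≥_ (zipWith (λ x j → x + suc j ∸ t) b (segment o n))
    go o n             []          []         = []
    go o zero          (x ∷ b)     _          = []
    go o (suc zero)    (x ∷ [])    _          = [-]
    go o (suc (suc n)) (x ∷ [])    _          = [-]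
    go o (suc zero)    (x ∷ y ∷ b) _          = [-]
    go o (suc (suc n)) (x ∷ y ∷ b) (x>y ∷ l)  =
      ∸-monoˡ-≤ t (≤-trans (≤-reflexive (+-suc y (suc o))) (+-monoˡ-≤ (suc o) x>y)) ∷ go (suc o) (suc n) (y ∷ b) l

  ≤N⇒≤b : ∀ {k x} → 1 ≤ k → k ≤ N x → x ≤ partAt b k
  ≤N⇒≤b {k} {x} = ≤-conj⇒≤-partAt b k x dec≥

  ≤b⇒≤N : ∀ {k x} → 1 ≤ k → k ≤ t → x ≤ partAt b k → k ≤ N x
  ≤b⇒≤N {k} {x} 1≤k k≤t = ≤-partAt⇒≤-conj b k x dec≥ 1≤k (≤-trans k≤t (≤-reflexive (sym len)))

  N≤t : ∀ x → N x ≤ t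
  N≤t x = ≤-trans (conj-≤-length b x) (≤-reflexive len)

  -- A positive part shows that the subtraction in `ν-part` was not truncated; hence `1 ≤ x`.
  ν≥⇒b≥ : ∀ {k x} → 1 ≤ k → k ≤ t → 1 ≤ x → x ≤ partAt ν k → t + x ≤ partAt b k + k
  ν≥⇒b≥ {k} {x} 1≤k k≤t 1≤x x≤ = subst (t + x ≤_) (m+[n∸m]≡n t≤) (+-monoʳ-≤ t x≤')
    where
    x≤' : x ≤ partAt b k + k ∸ t
    x≤' = subst (x ≤_) (ν-part k 1≤k k≤t) x≤
    t≤ : t ≤ partAt b k + k
    t≤ = <⇒≤ (m∸n≢0⇒n<m (λ eq → <⇒≱ 1≤x (subst (x ≤_) eq x≤')))

  b≥⇒ν≥ : ∀ {k x} → 1 ≤ k → k ≤ t → t + x ≤ partAt b k + k → x ≤ partAt ν k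
  b≥⇒ν≥ {k} {x} 1≤k k≤t le = subst (x ≤_) (sym (ν-part k 1≤k k≤t)) (subst (_≤ partAt b k + k ∸ t) (m+n∸m≡n t x) (∸-monoˡ-≤ t le))

  -- The `k`-th part is `b_k + k - t`, so it is at least `k` exactly when `b_k` is at least `t`.
  rank-ν : rank ν ≡ N t
  rank-ν = trans (cong (λ n → foldr _⊔_ 0 (map g (oneTo n))) length-ν) (≤-antisym upper (lower (N t) refl))
    where
    g : ℕ → ℕ
    g k = if k ≤ᵇ partAt ν k then k else 0
    bound : ∀ k → 1 ≤ k → k ≤ t → g k ≤ N t
    bound k 1≤k k≤t with k ≤ᵇ partAt ν k in eq
    ... | false = z≤n
    ... | true  = ≤b⇒≤N 1≤k k≤t (+-cancelʳ-≤ k t (partAt b k) (ν≥⇒b≥ 1≤k k≤t 1≤k (≤ᵇ⇒≤ k _ (subst T (sym eq) _))))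
    upper : foldr _⊔_ 0 (map g (oneTo t)) ≤ N t
    upper = foldr-⊔-upper (map g (oneTo t)) (Allₚ.map⁺ {f = g} (Allₚ.map⁺ {f = suc} (All.tabulate (λ {i} i∈ → bound (suc i) (s≤s z≤n) (∈ₚ.∈-upTo⁻ i∈)))))
    hit : ∀ k → k ≤ partAt ν k → g k ≡ k
    hit k le with k ≤ᵇ partAt ν k in eq
    ... | true  = refl
    ... | false = contradiction (subst T eq (≤⇒≤ᵇ le)) (λ ())
    lower : ∀ r → N t ≡ r → N t ≤ foldr _⊔_ 0 (map g (oneTo t))
    lower zero    eq = subst (_≤ foldr _⊔_ 0 (map g (oneTo t))) (sym eq) z≤n
    lower (suc r) eq = subst (_≤ foldr _⊔_ 0 (map g (oneTo t))) (sym eq) (subst (_≤ foldr _⊔_ 0 (map g (oneTo t)))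
      (hit (suc r) (b≥⇒ν≥ (s≤s z≤n) r<t (+-monoˡ-≤ (suc r) (≤N⇒≤b (s≤s z≤n) (≤-reflexive (sym eq))))))
      (foldr-⊔-lower (∈ₚ.∈-map⁺ g (∈ₚ.∈-map⁺ suc (∈ₚ.∈-upTo⁺ r<t)))))
      where
      r<t : suc r ≤ t
      r<t = subst (_≤ t) eq (N≤t t)

  SymplecticAt : ℕ → Set
  SymplecticAt k = conj ν k ≡ suc (partAt ν k)

  symplectic-to : Symplectic ν → ∀ k → 1 ≤ k → k ≤ N t → SymplecticAt k
  symplectic-to sym-ν k 1≤k k≤N = ℤₚ.+-injective (trans (alg (+ conj ν k) (+ k)) (trans (cong (ℤ._+ + k) (sym-ν k 1≤k (subst (k ≤_) (sym rank-ν) k≤N))) (alg' (+ partAt ν k) (+ k))))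
    where
    alg : ∀ x k → x ≡ x ℤ.- k ℤ.+ k
    alg = solve-∀
    alg' : ∀ x k → x ℤ.- k ℤ.+ 1ℤ ℤ.+ k ≡ 1ℤ ℤ.+ x
    alg' = solve-∀

  symplectic-from : (∀ k → 1 ≤ k → k ≤ N t → SymplecticAt k) → Symplectic ν
  symplectic-from at k 1≤k k≤r = trans (cong (λ u → + u ℤ.- + k) (at k 1≤k (subst (k ≤_) rank-ν k≤r))) (alg (+ partAt ν k) (+ k))
    where
    alg : ∀ x k → (1ℤ ℤ.+ x) ℤ.- k ≡ x ℤ.- k ℤ.+ 1ℤ
    alg = solve-∀

  -- The beta-set is invariant under complementation composed with x ↦ 2 S + 2 - x, except at the centre S + 1.
  record Balanced : Set where
    field
      centre∈ : suc S ∈ b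
      exactly : ∀ a a' → a + a' ≡ S → (t + a ∈ b × a' ∉ b) ⊎ (t + a ∉ b × a' ∈ b)
      bounded : ∀ a → S < a → t + a ∉ b

  N-step-∈ : ∀ {x} → x ∈ b → N x ≡ suc (N (suc x))
  N-step-∈ {x} = conj-∈ b x dec

  N-step-∉ : ∀ {x} → x ∉ b → N x ≡ N (suc x)
  N-step-∉ {x} = conj-∉ b x

  module _ (bal : Balanced) where
    open Balanced bal

    -- Induction from the centre outwards: when `a` increases, the left side grows by one if the new
    -- `a'` is in `b`, the right side if `t + a` with the old `a` is not. Balance makes these
    -- conditions equivalent.
    N-reflect : ∀ a a' → a + a' ≡ suc S → N a' ≡ suc a + N (t + a)
    N-reflect zero    .(suc S) refl = trans (N-step-∈ centre∈) (cong (suc ∘ N) (sym (+-identityʳ t)))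
    N-reflect (suc a) a' eq with exactly a a' (suc-injective eq) | N-reflect a (suc a') (trans (+-suc a a') eq)
    ... | inj₁ (t+a∈ , a'∉) | IH = trans (N-step-∉ a'∉) (trans IH (trans (cong (λ u → suc a + u) (N-step-∈ t+a∈))
      (trans (+-suc (suc a) _) (cong (λ u → 2 + a + N u) (sym (+-suc t a))))))
    ... | inj₂ (t+a∉ , a'∈) | IH = trans (N-step-∈ a'∈) (cong suc (trans IH (cong (λ u → suc a + u) (trans (N-step-∉ t+a∉) (cong N (sym (+-suc t a)))))))

    -- If `b_k` is `t + a`, then the `k`-th part is `a + k` and the `k`-th column must have length
    -- `c = a + k + 1`. In terms of `b` with `a' = S - a`, this means `b_c ≥ a' + 1` and
    -- `b_{c+1} < a'`. Both hold because `N (suc a')` is `c` by `N-reflect` and `a'` is missing from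
    -- `b`.
    balanced⇒symplectic : Symplectic ν
    balanced⇒symplectic = symplectic-from at
      where
      at : ∀ k → 1 ≤ k → k ≤ N t → SymplecticAt k
      at k 1≤k k≤N = ≤-antisym upper lower
        where
        k≤t = ≤-trans k≤N (N≤t t)
        a = partAt b k ∸ t
        b≡ : partAt b k ≡ t + a
        b≡ = sym (m+[n∸m]≡n (≤N⇒≤b 1≤k k≤N))
        t+a∈ : t + a ∈ b
        t+a∈ = subst (_∈ b) b≡ (partAt-∈ b k 1≤k (≤-trans k≤t (≤-reflexive (sym len))))
        N≡k : N (t + a) ≡ k
        N≡k = ≤-antisym
          (subst (_≤ k) (sym (N-step-∈ t+a∈)) (≰⇒> λ k≤ → <-irrefl (sym b≡) (≤N⇒≤b 1≤k k≤)))
          (≤b⇒≤N 1≤k k≤t (≤-reflexive (sym b≡)))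
        a≤S : a ≤ S
        a≤S = ≮⇒≥ (λ S<a → bounded a S<a t+a∈)
        a' = S ∸ a
        a+a' : a + a' ≡ S
        a+a' = m+[n∸m]≡n a≤S
        a'∉ : a' ∉ b
        a'∉ with exactly a a' a+a'
        ... | inj₁ (_ , a'∉) = a'∉
        ... | inj₂ (t+a∉ , _) = contradiction t+a∈ t+a∉
        c = suc (a + k)
        N-suc-a' : N (suc a') ≡ c
        N-suc-a' = trans (N-reflect a (suc a') (trans (+-suc a a') (cong suc a+a'))) (cong (λ u → suc a + u) N≡k)
        N-a' : N a' ≡ c
        N-a' = trans (N-step-∉ a'∉) N-suc-a'
        ν≡ : partAt ν k ≡ a + k
        ν≡ = trans (ν-part k 1≤k k≤t) (trans (cong (λ u → u + k ∸ t) b≡) (trans (cong (_∸ t) (+-assoc t a k)) (m+n∸m≡n t (a + k))))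
        c≤t : c ≤ t
        c≤t = subst (_≤ t) N-a' (N≤t a')
        sums : ∀ a a' k → suc a' + suc (a + k) ≡ suc (suc (a + a')) + k
        sums = ℕSolver.solve-∀
        lower : suc (partAt ν k) ≤ conj ν k
        lower = subst (λ u → suc u ≤ conj ν k) (sym ν≡) (≤-partAt⇒≤-conj ν c k ν-dec (s≤s z≤n) (≤-trans c≤t (≤-reflexive (sym length-ν)))
          (b≥⇒ν≥ (s≤s z≤n) c≤t (≤-trans (≤-reflexive (sym (trans (sums a a' k) (cong (λ u → 2 + u + k) a+a'))))
            (+-monoˡ-≤ c (≤N⇒≤b (s≤s z≤n) (≤-reflexive (sym N-suc-a')))))))
        sums' : ∀ x a k → x + suc (suc (a + k)) ≡ suc (suc (a + x)) + k
        sums' = ℕSolver.solve-∀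
        upper : conj ν k ≤ suc (partAt ν k)
        upper = subst (λ u → conj ν k ≤ suc u) (sym ν≡) (≮⇒≥ λ c< →
          let c'≤t = ≤-trans c< (≤-trans (conj-≤-length ν k) (≤-reflexive length-ν))
              le = ν≥⇒b≥ (s≤s z≤n) c'≤t 1≤k (≤-conj⇒≤-partAt ν (suc c) k ν-dec (s≤s z≤n) c<)
              le' = s≤s⁻¹ (s≤s⁻¹ (+-cancelʳ-≤ k t _ (subst (t + k ≤_) (sums' (partAt b (suc c)) a k) le)))
              a'≤ = +-cancelˡ-≤ a a' (partAt b (suc c)) (subst (_≤ a + partAt b (suc c)) (sym a+a') le')
          in <-irrefl refl (subst (suc c ≤_) N-a' (≤b⇒≤N (s≤s z≤n) c'≤t a'≤)))

  module _ (symp : Symplectic ν) where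

    private
      -- If `t + a` is the `k`-th element, the `k`-th column has length `c = a + k + 1`. This is at
      -- most `t`, which bounds `a`. If `S - a` were in `b` too, `c + 1` elements would be at least
      -- `S - a`, and the column would be longer than `c`.
      excluded : ∀ a → t + a ∈ b → a ≤ S × (∀ a' → a + a' ≡ S → a' ∉ b)
      excluded a t+a∈ = a≤S , a'∉
        where
        k = suc (N (suc (t + a)))
        N≡k : N (t + a) ≡ k
        N≡k = N-step-∈ t+a∈
        1≤k : 1 ≤ k
        1≤k = s≤s z≤n
        k≤t : k ≤ t
        k≤t = subst (_≤ t) N≡k (N≤t (t + a))
        b≡ : partAt b k ≡ t + a
        b≡ = ≤-antisym (≮⇒≥ λ lt → <-irrefl refl (≤b⇒≤N 1≤k k≤t lt)) (≤N⇒≤b 1≤k (≤-reflexive (sym N≡k)))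
        at : SymplecticAt k
        at = symplectic-to symp k 1≤k (≤b⇒≤N 1≤k k≤t (≤-trans (m≤m+n t a) (≤-reflexive (sym b≡))))
        ν≡ : partAt ν k ≡ a + k
        ν≡ = trans (ν-part k 1≤k k≤t) (trans (cong (λ u → u + k ∸ t) b≡) (trans (cong (_∸ t) (+-assoc t a k)) (m+n∸m≡n t (a + k))))
        c = suc (a + k)
        conj≡ : conj ν k ≡ c
        conj≡ = trans at (cong suc ν≡)
        c≤t : c ≤ t
        c≤t = subst (_≤ t) conj≡ (≤-trans (conj-≤-length ν k) (≤-reflexive length-ν))
        a≤S : a ≤ S
        a≤S = s≤s⁻¹ (s≤s⁻¹ (≤-trans (s≤s (≤-trans (≤-reflexive (+-comm 1 a)) (+-monoʳ-≤ a 1≤k))) c≤t))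
        sums : ∀ x a k → x + suc (a + k) ≡ suc (a + x) + k
        sums = ℕSolver.solve-∀
        sums' : ∀ a' a k → suc (suc (a + a')) + k ≡ a' + suc (suc (a + k))
        sums' = ℕSolver.solve-∀
        a'∉ : ∀ a' → a + a' ≡ S → a' ∉ b
        a'∉ a' eq a'∈ = <-irrefl (sym conj≡) (≤-partAt⇒≤-conj ν (suc c) k ν-dec (s≤s z≤n) (≤-trans sc≤t (≤-reflexive (sym length-ν)))
          (b≥⇒ν≥ (s≤s z≤n) sc≤t (≤-trans (≤-reflexive (trans (cong (λ u → suc (suc u) + k) (sym eq)) (sums' a' a k))) (+-monoˡ-≤ (suc c) (≤N⇒≤b (s≤s z≤n) sc≤N)))))
          where
          le : t + k ≤ partAt b c + c
          le = ν≥⇒b≥ (s≤s z≤n) c≤t 1≤k (≤-conj⇒≤-partAt ν c k ν-dec (s≤s z≤n) (≤-reflexive (sym conj≡)))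
          suc-a'≤ : suc a' ≤ partAt b c
          suc-a'≤ = +-cancelˡ-≤ a (suc a') (partAt b c) (≤-trans (≤-reflexive (trans (+-suc a a') (cong suc eq)))
            (s≤s⁻¹ (+-cancelʳ-≤ k t _ (subst (t + k ≤_) (sums (partAt b c) a k) le))))
          sc≤N : suc c ≤ N a'
          sc≤N = subst (suc c ≤_) (sym (N-step-∈ a'∈)) (s≤s (≤b⇒≤N (s≤s z≤n) c≤t suc-a'≤))
          sc≤t : suc c ≤ t
          sc≤t = ≤-trans sc≤N (N≤t a')

      beyond : ∀ a → S < a → t + a ∉ b
      beyond a S<a t+a∈ = <⇒≱ S<a (proj₁ (excluded a t+a∈))

      N-beyond : N (t + suc S) ≡ 0
      N-beyond = conj-zero b (All.tabulate (λ {x} x∈ → ≰⇒> (λ le →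
        beyond (x ∸ t) (m+n≤o⇒m≤o∸n (suc S) (≤-trans (≤-reflexive (+-comm (suc S) t)) le)) (subst (_∈ b) (sym (m+[n∸m]≡n (m+n≤o⇒m≤o t le))) x∈))))

      -- The slack in N-upper is nondecreasing in a and vanishes at a = S + 1, hence everywhere.
      N-upper : ∀ a a' → a + a' ≡ suc S → N a' ≤ suc a + N (t + a)
      N-upper zero    .(suc S) refl with suc S ∈? b
      ... | yes ∈b = ≤-reflexive (trans (N-step-∈ ∈b) (cong (suc ∘ N) (sym (+-identityʳ t))))
      ... | no ∉b = ≤-trans (≤-reflexive (trans (N-step-∉ ∉b) (cong N (sym (+-identityʳ t))))) (n≤1+n _)
      N-upper (suc a) a' eq with N-upper a (suc a') (trans (+-suc a a') eq) | t + a ∈? b | a' ∈? b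
      ... | IH | yes t+a∈ | yes a'∈ = contradiction a'∈ (proj₂ (excluded a t+a∈) a' (suc-injective eq))
      ... | IH | yes t+a∈ | no a'∉ = ≤-trans (≤-reflexive (N-step-∉ a'∉)) (≤-trans IH (≤-reflexive (trans (cong (λ u → suc a + u) (N-step-∈ t+a∈))
        (trans (+-suc (suc a) _) (cong (λ u → 2 + a + N u) (sym (+-suc t a)))))))
      ... | IH | no t+a∉ | yes a'∈ = ≤-trans (≤-reflexive (N-step-∈ a'∈)) (s≤s (≤-trans IH (≤-reflexive (cong (λ u → suc a + u) (trans (N-step-∉ t+a∉) (cong N (sym (+-suc t a))))))))
      ... | IH | no t+a∉ | no a'∉ = ≤-trans (≤-reflexive (N-step-∉ a'∉)) (≤-trans IH
        (≤-trans (n≤1+n _) (≤-reflexive (cong (λ u → 2 + a + u) (trans (N-step-∉ t+a∉) (cong N (sym (+-suc t a))))))))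

      N-lower : ∀ a' a → a + a' ≡ suc S → suc a + N (t + a) ≤ N a'
      -- For `a = suc S` both sides are `t`: nothing in `b` reaches `t + suc S`, and all elements
      -- are at least 0. Here the size of `b` enters.
      N-lower zero a eq = ≤-reflexive (trans (cong₂ _+_ (cong suc a≡) (trans (cong (λ u → N (t + u)) a≡) N-beyond))
        (trans (+-identityʳ t) (sym (trans (conj-0 b) len))))
        where
        a≡ : a ≡ suc S
        a≡ = trans (sym (+-identityʳ a)) eq
      N-lower (suc a') a eq with N-lower a' (suc a) (trans (sym (+-suc a a')) eq) | t + a ∈? b | a' ∈? b
      ... | IH | yes t+a∈ | yes a'∈ = contradiction a'∈ (proj₂ (excluded a t+a∈) a' (suc-injective (trans (sym (+-suc a a')) eq)))
      ... | IH | yes t+a∈ | no a'∉ = ≤-trans (≤-reflexive (trans (cong (λ u → suc a + u) (trans (N-step-∈ t+a∈) (cong (suc ∘ N) (sym (+-suc t a))))) (+-suc (suc a) _)))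
        (≤-trans IH (≤-reflexive (N-step-∉ a'∉)))
      ... | IH | no t+a∉ | yes a'∈ = ≤-trans (≤-reflexive (cong (λ u → suc a + u) (trans (N-step-∉ t+a∉) (cong N (sym (+-suc t a)))))) (s≤s⁻¹ (≤-trans IH (≤-reflexive (N-step-∈ a'∈))))
      ... | IH | no t+a∉ | no a'∉ = ≤-trans (≤-reflexive (cong (λ u → suc a + u) (trans (N-step-∉ t+a∉) (cong N (sym (+-suc t a))))))
        (≤-trans (n≤1+n _) (≤-trans IH (≤-reflexive (N-step-∉ a'∉))))

      N-eq : ∀ a a' → a + a' ≡ suc S → N a' ≡ suc a + N (t + a)
      N-eq a a' eq = ≤-antisym (N-upper a a' eq) (N-lower a' a eq)

    -- `excluded` forbids that `t + a` and `S - a` both lie in `b`. If both were missing, two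
    -- neighbouring instances of `N-eq` would differ by one; a missing centre contradicts the
    -- instance `a = 0` in the same way.
    symplectic⇒balanced : Balanced
    symplectic⇒balanced = record { centre∈ = mid ; exactly = exact ; bounded = beyond }
      where
      mid : suc S ∈ b
      mid with suc S ∈? b
      ... | yes ∈b = ∈b
      ... | no ∉b = contradiction (trans (sym (N-eq 0 (suc S) refl)) (trans (N-step-∉ ∉b) (cong N (sym (+-identityʳ t))))) 1+n≢n
      exact : ∀ a a' → a + a' ≡ S → (t + a ∈ b × a' ∉ b) ⊎ (t + a ∉ b × a' ∈ b)
      exact a a' eq with t + a ∈? b | a' ∈? b
      ... | yes t+a∈ | _ = inj₁ (t+a∈ , proj₂ (excluded a t+a∈) a' eq)
      ... | no t+a∉ | yes a'∈ = inj₂ (t+a∉ , a'∈)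
      ... | no t+a∉ | no a'∉ = contradiction
        (trans (sym (N-eq (suc a) a' (cong suc eq))) (trans (N-step-∉ a'∉) (trans (N-eq a (suc a') (trans (+-suc a a') (cong suc eq)))
          (cong (λ u → suc a + u) (trans (N-step-∉ t+a∉) (cong N (sym (+-suc t a))))))))
        1+n≢n

AllPairs-reverse : ∀ {xs} → AllPairs _<_ xs → AllPairs _>_ (reverse xs)
AllPairs-reverse {[]}     []           = []
AllPairs-reverse {x ∷ xs} (x< ∷ inc) = subst (AllPairs _>_) (sym (Listₚ.unfold-reverse x xs))
  (AllPairsₚ.++⁺ (AllPairs-reverse inc) ([] ∷ []) (All.map (_∷ []) (↭ₚ.All-resp-↭ (↭-sym (↭ₚ.↭-reverse xs)) x<)))

module CoreBeta (t : ℕ) .{{nz : NonZero t}} (β : List ℕ) where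

  n : ℕ → ℕ
  n = resCount t β

  -- A runner of the `t`-abacus with its beads pushed to the lowest positions.
  runner : ℕ → List ℕ
  runner i = map (λ j → t ℕ.* j + i) (upTo (n i))

  runners : List ℕ
  runners = concatMap runner (upTo t)

  b : List ℕ
  b = coreBeta t β

  b↭runners : b ↭ runners
  b↭runners = ↭-trans (↭ₚ.↭-reverse (sort runners)) (sort-↭ runners)

  residue : ∀ j {i} → i < t → (t ℕ.* j + i) % t ≡ i
  residue j {i} i<t = trans (cong (_% t) (trans (+-comm (t ℕ.* j) i) (cong (λ u → i + u) (*-comm t j)))) (trans ([m+kn]%n≡m%n i j t) (m<n⇒m%n≡m i<t))

  ∈-runners⁺ : ∀ {i j} → i < t → j < n i → t ℕ.* j + i ∈ runners
  ∈-runners⁺ {i} i<t j< = ∈ₚ.∈-concatMap⁺ runner (lose (∈ₚ.∈-upTo⁺ i<t) (∈ₚ.∈-map⁺ (λ j → t ℕ.* j + i) (∈ₚ.∈-upTo⁺ j<)))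

  ∈-runner⁻ : ∀ {x} i → x ∈ runner i → ∃ λ j → j < n i × x ≡ t ℕ.* j + i
  ∈-runner⁻ i x∈ with ∈ₚ.∈-map⁻ (λ j → t ℕ.* j + i) x∈
  ... | j , j∈ , eq = j , ∈ₚ.∈-upTo⁻ j∈ , eq

  ∈-runners⁻ : ∀ {x} → x ∈ runners → ∃ λ i → i < t × (∃ λ j → j < n i × x ≡ t ℕ.* j + i)
  ∈-runners⁻ {x} x∈ with find (∈ₚ.∈-concatMap⁻ runner {xs = upTo t} x∈)
  ... | i , i∈ , x∈i = i , ∈ₚ.∈-upTo⁻ i∈ , ∈-runner⁻ i x∈i

  ∈-b⁺ : ∀ {i j} → i < t → j < n i → t ℕ.* j + i ∈ b
  ∈-b⁺ i<t j< = ↭ₚ.∈-resp-↭ (↭-sym b↭runners) (∈-runners⁺ i<t j<)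

  ∈-b⁻ : ∀ {i j} → i < t → t ℕ.* j + i ∈ b → j < n i
  ∈-b⁻ {i} {j} i<t x∈ with ∈-runners⁻ (↭ₚ.∈-resp-↭ b↭runners x∈)
  ... | i' , i'<t , j' , j'< , eq with trans (sym (residue j i<t)) (trans (cong (_% t) eq) (residue j' i'<t))
  ...   | refl = subst (_< n i) (sym (*-cancelˡ-≡ j j' t (+-cancelʳ-≡ i (t ℕ.* j) (t ℕ.* j') eq))) j'<

  runners-unique : Unique runners
  runners-unique = subst (Unique ∘ concatMap runner) (sym (upTo-segment t)) (go 0 t ≤-refl)
    where
    high : ∀ o k → o + k ≤ t → All (λ x → o ≤ x % t) (concatMap runner (segment o k))
    high o zero    _   = []
    high o (suc k) le = Allₚ.++⁺
      (All.tabulate (λ x∈ → let (j , _ , eq) = ∈-runner⁻ o x∈ in ≤-reflexive (sym (trans (cong (_% t) eq) (residue j (≤-trans (m<m+n o z<s) le))))))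
      (All.map (≤-trans (n≤1+n o)) (high (suc o) k (subst (_≤ t) (+-suc o k) le)))
    go : ∀ o k → o + k ≤ t → Unique (concatMap runner (segment o k))
    go o zero    _  = []
    go o (suc k) le = Uniqueₚ.++⁺
      (Uniqueₚ.map⁺ (λ {j} {j'} eq → *-cancelˡ-≡ j j' t (+-cancelʳ-≡ o (t ℕ.* j) (t ℕ.* j') eq)) (Uniqueₚ.upTo⁺ (n o)))
      (go (suc o) k le')
      (λ { (x∈ , x∈') → let (j , _ , eq) = ∈-runner⁻ o x∈ in
        <-irrefl (sym (trans (cong (_% t) eq) (residue j (≤-trans (m<m+n o z<s) le)))) (All.lookup (high (suc o) k le') x∈') })
      where
      le' : suc o + k ≤ t
      le' = subst (_≤ t) (+-suc o k) le

  b-dec : AllPairs _>_ b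
  b-dec = AllPairs-reverse (AllPairs.zipWith (λ { (le , ne) → ≤∧≢⇒< le ne })
    (Linkedₚ.Linked⇒AllPairs ≤-trans (sort-↗ runners) ,
     ↭ₛₚ.Unique-resp-↭ (setoid ℕ) (↭⇒↭ₛ (↭-sym (sort-↭ runners))) runners-unique))

  length-b : length b ≡ length β
  length-b = trans (↭ₚ.↭-length b↭runners) (trans (same (upTo t)) (trans
    (cong (λ l → length (buckets β l)) (upTo-segment t)) (↭ₚ.↭-length (buckets-↭ β t (All.universal (λ x → m%n<n x t) β)))))
    where
    open Buckets (_% t)
    same : ∀ is → length (concatMap runner is) ≡ length (buckets β is)
    same []       = refl
    same (i ∷ is) = trans (Listₚ.length-++ (runner i)) (trans (cong₂ _+_ (trans (Listₚ.length-map _ (upTo (n i))) (Listₚ.length-upTo (n i))) (same is))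
      (sym (Listₚ.length-++ (bucket β i))))

-- The common normal form for the products coming from the rank, from `epsilon` and from the blocks.
prodFrom : ℕ → ℕ → (ℕ → ℤ) → ℤ
prodFrom o zero    f = 1ℤ
prodFrom o (suc m) f = f o ℤ.* prodFrom (suc o) m f

-- Symplectic cores in terms of residue counts

module Core (S : ℕ) (β : List ℕ) (len-β : length β ≡ suc (suc S)) where

  open CoreBeta (suc (suc S)) β
  private module F = FromBeta S b b-dec (trans length-b len-β)
  open F using (t; ν; N; Balanced)

  core≡ν : core t β ≡ ν
  core≡ν = cong (λ m → zipWith (λ x j → x + suc j ∸ m) b (upTo m)) len-β

  record BalancedCounts : Set where
    field
      last  : n (suc S) ≡ 1
      pairs : ∀ a a' → a + a' ≡ S → n a + n a' ≡ 2

  private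
    ≤S⇒<t : ∀ {a} → a ≤ S → a < t
    ≤S⇒<t a≤S = s≤s (m≤n⇒m≤1+n a≤S)

    low⁺ : ∀ {i} → i < t → 0 < n i → i ∈ b
    low⁺ {i} i<t 0<n = subst (_∈ b) (cong (_+ i) (*-zeroʳ t)) (∈-b⁺ i<t 0<n)

    low⁻ : ∀ {i} → i < t → i ∈ b → 0 < n i
    low⁻ {i} i<t i∈ = ∈-b⁻ i<t (subst (_∈ b) (cong (_+ i) (sym (*-zeroʳ t))) i∈)

    high⁺ : ∀ {i} → i < t → 1 < n i → t + i ∈ b
    high⁺ {i} i<t 1<n = subst (_∈ b) (cong (_+ i) (*-identityʳ t)) (∈-b⁺ i<t 1<n)

    high⁻ : ∀ {i} → i < t → t + i ∈ b → 1 < n i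
    high⁻ {i} i<t i∈ = ∈-b⁻ i<t (subst (_∈ b) (cong (_+ i) (sym (*-identityʳ t))) i∈)

    left≤ : ∀ {a a'} → a + a' ≡ S → a ≤ S
    left≤ {a} {a'} eq = subst (a ≤_) eq (m≤m+n a a')

    right≤ : ∀ {a a'} → a + a' ≡ S → a' ≤ S
    right≤ {a} {a'} eq = subst (a' ≤_) eq (m≤n+m a' a)

  module _ (bal : BalancedCounts) where
    open BalancedCounts bal

    private
      n≤2 : ∀ {i} → i < t → n i ≤ 2
      n≤2 {i} i<t with i ≟ suc S
      ... | yes refl = subst (_≤ 2) (sym last) (s≤s z≤n)
      ... | no i≢ = subst (n i ≤_) (pairs i (S ∸ i) (m+[n∸m]≡n (s≤s⁻¹ (≤∧≢⇒< (s≤s⁻¹ i<t) i≢)))) (m≤m+n (n i) _)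

      beyond : ∀ a → S < a → t + a ∉ b
      beyond a S<a t+a∈ with a <? t
      ... | yes a<t with ≤-antisym (s≤s⁻¹ a<t) S<a
      ...   | refl = <⇒≱ (high⁻ a<t t+a∈) (≤-reflexive last)
      -- For `a ≥ t` the bead `t + a` has position at least 2 on its runner, which would then carry
      -- at least three beads.
      beyond a S<a t+a∈ | no a≮t = <⇒≱ (∈-b⁻ {a % t} {2 + (a ∸ t) / t} (m%n<n a t) (subst (_∈ b) eq t+a∈)) (≤-trans (n≤2 (m%n<n a t)) (s≤s (s≤s z≤n)))
        where
        a≡ : a ≡ t + (a ∸ t)
        a≡ = sym (m+[n∸m]≡n (≮⇒≥ a≮t))
        a%t : a % t ≡ (a ∸ t) % t
        a%t = trans (cong (_% t) (trans a≡ (trans (+-comm t (a ∸ t)) (cong (λ u → a ∸ t + u) (sym (*-identityˡ t)))))) ([m+kn]%n≡m%n (a ∸ t) 1 t)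
        eq : t + a ≡ t ℕ.* (2 + (a ∸ t) / t) + a % t
        eq = trans (cong (λ u → t + u) (trans a≡ (cong (λ u → t + u) (m≡m%n+[m/n]*n (a ∸ t) t))))
          (trans (alg t ((a ∸ t) % t) ((a ∸ t) / t)) (cong (λ u → t ℕ.* (2 + (a ∸ t) / t) + u) (sym a%t)))
          where
          alg : ∀ t r q → t + (t + (r + q ℕ.* t)) ≡ t ℕ.* (2 + q) + r
          alg = ℕSolver.solve-∀

    -- `t + a ∈ b` means `1 < n a`, and `a' ∈ b` means `0 < n a'`; if the two counts add up to 2,
    -- exactly one of these holds.
    counts⇒balanced : Balanced
    counts⇒balanced = record { centre∈ = low⁺ ≤-refl (≤-reflexive (sym last)) ; exactly = exact ; bounded = beyond }
      where
      exact : ∀ a a' → a + a' ≡ S → (t + a ∈ b × a' ∉ b) ⊎ (t + a ∉ b × a' ∈ b)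
      exact a a' eq with 1 <? n a
      ... | yes 1<na = inj₁ (high⁺ (≤S⇒<t (left≤ eq)) 1<na ,
        λ a'∈ → <⇒≱ (+-mono-≤ 1<na (low⁻ (≤S⇒<t (right≤ {a} eq)) a'∈)) (≤-reflexive (pairs a a' eq)))
      ... | no 1≮na = inj₂ ((λ t+a∈ → 1≮na (high⁻ (≤S⇒<t (left≤ eq)) t+a∈)) ,
        low⁺ (≤S⇒<t (right≤ {a} eq)) (+-cancelˡ-≤ (n a) 1 (n a') (≤-trans (+-monoˡ-≤ 1 (≮⇒≥ 1≮na)) (≤-reflexive (sym (pairs a a' eq))))))

    counts⇒symplectic : Symplectic (core t β)
    counts⇒symplectic = subst Symplectic (sym core≡ν) (F.balanced⇒symplectic counts⇒balanced)

    -- The rank counts the elements of `b` that are at least `t`, one for each residue of count 2.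
    -- As counts are at most 2, the truncated `n i ∸ 1` is the indicator of that; residue `suc S`
    -- has count 1 and contributes nothing.
    negOnePow-rank : negOnePow (rank (core t β)) ≡ prodFrom 0 (suc S) (λ i → negOnePow (n i ∸ 1))
    negOnePow-rank = trans (cong negOnePow (trans (cong rank core≡ν) (trans F.rank-ν (cong N (sym (+-identityʳ t)))))) (go (suc S) 0 refl)
      where
      N-end : N (t + suc S) ≡ 0
      N-end = conj-zero b (All.tabulate (λ {x} x∈ → ≰⇒> (λ le →
        beyond (x ∸ t) (m+n≤o⇒m≤o∸n (suc S) (≤-trans (≤-reflexive (+-comm (suc S) t)) le)) (subst (_∈ b) (sym (m+[n∸m]≡n (m+n≤o⇒m≤o t le))) x∈))))
      step : ∀ o → o ≤ S → N (t + o) ≡ n o ∸ 1 + N (t + suc o)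
      step o o≤S with 1 <? n o
      ... | yes 1<n = trans (F.N-step-∈ (high⁺ (≤S⇒<t o≤S) 1<n)) (cong₂ (λ u v → u ∸ 1 + N v) (sym (≤-antisym (n≤2 (≤S⇒<t o≤S)) 1<n)) (sym (+-suc t o)))
      ... | no 1≮n = trans (F.N-step-∉ (1≮n ∘ high⁻ (≤S⇒<t o≤S))) (cong₂ (λ u v → u + N v) (sym (m≤n⇒m∸n≡0 (≮⇒≥ 1≮n))) (sym (+-suc t o)))
      go : ∀ m o → o + m ≡ suc S → negOnePow (N (t + o)) ≡ prodFrom o m (λ i → negOnePow (n i ∸ 1))
      go zero    o eq = cong negOnePow (trans (cong (λ u → N (t + u)) (trans (sym (+-identityʳ o)) eq)) N-end)
      go (suc m) o eq = trans (cong negOnePow (step o (m+n≤o⇒m≤o o (≤-reflexive (suc-injective (trans (sym (+-suc o m)) eq)))))) (trans (negOnePow-+ (n o ∸ 1) _)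
        (cong (negOnePow (n o ∸ 1) ℤ.*_) (go m (suc o) (trans (sym (+-suc o m)) eq))))

  balanced⇒counts : Balanced → BalancedCounts
  balanced⇒counts bal = record
    { last = ≤-antisym (≮⇒≥ (λ 1<n → bounded (suc S) ≤-refl (high⁺ ≤-refl 1<n))) (low⁻ ≤-refl centre∈)
    ; pairs = pair }
    where
    open Balanced bal
    n≤2 : ∀ {a} → a ≤ S → n a ≤ 2
    n≤2 {a} a≤S = ≮⇒≥ (λ 2<n → bounded (t + a) (≤-trans (n≤1+n (suc S)) (m≤m+n t a))
      (subst (_∈ b) (trans (cong (_+ a) (alg t)) (+-assoc t t a)) (∈-b⁺ (≤S⇒<t a≤S) 2<n)))
      where
      alg : ∀ t → t ℕ.* 2 ≡ t + t
      alg = ℕSolver.solve-∀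
    pair : ∀ a a' → a + a' ≡ S → n a + n a' ≡ 2
    -- One order detects the counts 2 and 0, the reverse order the counts 0 and 2. If both fail,
    -- neither count is 2 and both are positive.
    pair a a' eq with exactly a a' eq | exactly a' a (trans (+-comm a' a) eq)
    ... | inj₁ (t+a∈ , a'∉) | _ = cong₂ _+_ (≤-antisym (n≤2 (left≤ eq)) (high⁻ (≤S⇒<t (left≤ eq)) t+a∈)) (n≤0⇒n≡0 (≮⇒≥ (a'∉ ∘ low⁺ (≤S⇒<t (right≤ {a} eq)))))
    ... | inj₂ _ | inj₁ (t+a'∈ , a∉) = cong₂ _+_ (n≤0⇒n≡0 (≮⇒≥ (a∉ ∘ low⁺ (≤S⇒<t (left≤ eq))))) (≤-antisym (n≤2 (right≤ {a} eq)) (high⁻ (≤S⇒<t (right≤ {a} eq)) t+a'∈))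
    ... | inj₂ (t+a∉ , a'∈) | inj₂ (t+a'∉ , a∈) = cong₂ _+_
      (≤-antisym (≮⇒≥ (t+a∉ ∘ high⁺ (≤S⇒<t (left≤ eq)))) (low⁻ (≤S⇒<t (left≤ eq)) a∈))
      (≤-antisym (≮⇒≥ (t+a'∉ ∘ high⁺ (≤S⇒<t (right≤ {a} eq)))) (low⁻ (≤S⇒<t (right≤ {a} eq)) a'∈))

  symplectic⇒counts : Symplectic (core t β) → BalancedCounts
  symplectic⇒counts symp = balanced⇒counts (F.symplectic⇒balanced (subst Symplectic core≡ν symp))

-- Comparison with the product formula

negOnePowℤ-⊖ : ∀ m n → negOnePowℤ (m ℤ.⊖ n) ≡ negOnePow m ℤ.* negOnePow n
negOnePowℤ-⊖ m zero = trans (cong negOnePowℤ (ℤₚ.⊖-≥ {m} z≤n)) (sym (ℤₚ.*-identityʳ (negOnePow m)))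
negOnePowℤ-⊖ zero (suc n) = sym (ℤₚ.*-identityˡ (negOnePow (suc n)))
negOnePowℤ-⊖ (suc m) (suc n) = trans (cong negOnePowℤ (ℤₚ.[1+m]⊖[1+n]≡m⊖n m n)) (trans (negOnePowℤ-⊖ m n) (alg (negOnePow m) (negOnePow n)))
  where
  alg : ∀ x y → x ℤ.* y ≡ ℤ.- x ℤ.* ℤ.- y
  alg = solve-∀

negOnePowℤ-+ : ∀ x y → negOnePowℤ (x ℤ.+ y) ≡ negOnePowℤ x ℤ.* negOnePowℤ y
negOnePowℤ-+ (+ m)    (+ n)    = negOnePow-+ m n
negOnePowℤ-+ (+ m)    -[1+ n ] = negOnePowℤ-⊖ m (suc n)
negOnePowℤ-+ -[1+ m ] (+ n)    = trans (negOnePowℤ-⊖ n (suc m)) (ℤₚ.*-comm (negOnePow n) (negOnePow (suc m)))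
negOnePowℤ-+ -[1+ m ] -[1+ n ] = trans (cong negOnePow (cong suc (sym (+-suc m n)))) (negOnePow-+ (suc m) (suc n))

negOnePowℤ-neg : ∀ x → negOnePowℤ (ℤ.- x) ≡ negOnePowℤ x
negOnePowℤ-neg x = cong negOnePow (ℤₚ.∣-i∣≡∣i∣ x)

negOnePowℤ-sum : ∀ (f : ℕ → ℕ) o m → negOnePowℤ (sumℤ (map (λ i → + f i) (segment o m))) ≡ prodFrom o m (negOnePow ∘ f)
negOnePowℤ-sum f o zero    = refl
negOnePowℤ-sum f o (suc m) = trans (negOnePowℤ-+ (+ f o) (sumℤ (map (λ i → + f i) (segment (suc o) m)))) (cong (negOnePow (f o) ℤ.*_) (negOnePowℤ-sum f (suc o) m))

prodFrom-last : ∀ o m f → prodFrom o (suc m) f ≡ prodFrom o m f ℤ.* f (o + m)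
prodFrom-last o zero    f = trans (ℤₚ.*-comm (f o) 1ℤ) (cong (λ u → 1ℤ ℤ.* f u) (sym (+-identityʳ o)))
prodFrom-last o (suc m) f = trans (cong (f o ℤ.*_) (trans (prodFrom-last (suc o) m f) (cong (λ u → prodFrom (suc o) m f ℤ.* f u) (sym (+-suc o m)))))
  (sym (ℤₚ.*-assoc (f o) (prodFrom (suc o) m f) (f (o + suc m))))

filter-segment : ∀ {P : ℕ → Set} (P? : Decidable P) o k n → k ≤ n → (∀ i → P i → i < o + k) → (∀ i → o ≤ i → i < o + k → P i) →
  filter P? (segment o n) ≡ segment o k
filter-segment P? o zero    zero    _ to from = refl
filter-segment P? o zero    (suc n) _ to from = trans (Listₚ.filter-reject P? (λ p → <-irrefl refl (subst (o <_) (+-identityʳ o) (to o p))))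
  (filter-segment P? (suc o) zero n z≤n (λ i p → m<n⇒m<1+n (to i p)) (λ i o<i i< → contradiction (subst (i <_) (+-identityʳ (suc o)) i<) (≤⇒≯ o<i)))
filter-segment P? o (suc k) (suc n) (s≤s k≤n) to from = trans (Listₚ.filter-accept P? (from o ≤-refl (m<m+n o z<s)))
  (cong (o ∷_) (filter-segment P? (suc o) k n k≤n (λ i p → subst (i <_) (+-suc o k) (to i p)) (λ i o<i i< → from i (<⇒≤ o<i) (subst (i <_) (sym (+-suc o k)) i<))))

n/2≡⌊n/2⌋ : ∀ n → n / 2 ≡ ⌊ n /2⌋
n/2≡⌊n/2⌋ zero          = refl
n/2≡⌊n/2⌋ (suc zero)    = refl
n/2≡⌊n/2⌋ (suc (suc n)) = trans (m/n≡1+[m∸n]/n {2 + n} {2} (s≤s (s≤s z≤n))) (cong suc (n/2≡⌊n/2⌋ n))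

-- Products over lo, ..., lo + m - 1 taken from the two ends towards the centre.
outerProd : ℕ → ℕ → (ℕ → ℤ) → ℤ
outerProd zero          lo f = 1ℤ
outerProd (suc zero)    lo f = f lo
outerProd (suc (suc m)) lo f = f lo ℤ.* f (lo + suc m) ℤ.* outerProd m (suc lo) f

-- Only the larger residue of each pair, without the centre: these are the residues in the sum that
-- defines `epsilon`.
upperProd : ℕ → ℕ → (ℕ → ℤ) → ℤ
upperProd zero          lo f = 1ℤ
upperProd (suc zero)    lo f = 1ℤ
upperProd (suc (suc m)) lo f = f (lo + suc m) ℤ.* upperProd m (suc lo) f

outerProd-prodFrom : ∀ m lo f → outerProd m lo f ≡ prodFrom lo m f
outerProd-prodFrom zero          lo f = refl
outerProd-prodFrom (suc zero)    lo f = sym (ℤₚ.*-identityʳ (f lo))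
outerProd-prodFrom (suc (suc m)) lo f = begin
  f lo ℤ.* f (lo + suc m) ℤ.* outerProd m (suc lo) f       ≡⟨ cong (f lo ℤ.* f (lo + suc m) ℤ.*_) (outerProd-prodFrom m (suc lo) f) ⟩
  f lo ℤ.* f (lo + suc m) ℤ.* prodFrom (suc lo) m f        ≡⟨ alg (f lo) (f (lo + suc m)) (prodFrom (suc lo) m f) ⟩
  f lo ℤ.* (prodFrom (suc lo) m f ℤ.* f (lo + suc m))      ≡⟨ cong (λ u → f lo ℤ.* (prodFrom (suc lo) m f ℤ.* f u)) (+-suc lo m) ⟩
  f lo ℤ.* (prodFrom (suc lo) m f ℤ.* f (suc lo + m))      ≡⟨ cong (f lo ℤ.*_) (prodFrom-last (suc lo) m f) ⟨
  prodFrom lo (suc (suc m)) f                              ∎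
  where
  open ≡-Reasoning
  alg : ∀ x y z → x ℤ.* y ℤ.* z ≡ x ℤ.* (z ℤ.* y)
  alg = solve-∀

upperProd-prodFrom : ∀ m lo f → upperProd m lo f ≡ prodFrom (lo + ⌈ m /2⌉) ⌊ m /2⌋ f
upperProd-prodFrom zero          lo f = refl
upperProd-prodFrom (suc zero)    lo f = refl
upperProd-prodFrom (suc (suc m)) lo f = begin
  f (lo + suc m) ℤ.* upperProd m (suc lo) f
    ≡⟨ cong₂ (λ u v → f u ℤ.* v) (sym middle) (upperProd-prodFrom m (suc lo) f) ⟩
  f (suc lo + ⌈ m /2⌉ + ⌊ m /2⌋) ℤ.* prodFrom (suc lo + ⌈ m /2⌉) ⌊ m /2⌋ f
    ≡⟨ ℤₚ.*-comm (f (suc lo + ⌈ m /2⌉ + ⌊ m /2⌋)) _ ⟩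
  prodFrom (suc lo + ⌈ m /2⌉) ⌊ m /2⌋ f ℤ.* f (suc lo + ⌈ m /2⌉ + ⌊ m /2⌋)
    ≡⟨ prodFrom-last (suc lo + ⌈ m /2⌉) ⌊ m /2⌋ f ⟨
  prodFrom (suc lo + ⌈ m /2⌉) (suc ⌊ m /2⌋) f
    ≡⟨ cong (λ u → prodFrom u (suc ⌊ m /2⌋) f) (+-suc lo ⌈ m /2⌉) ⟨
  prodFrom (lo + suc ⌈ m /2⌉) (suc ⌊ m /2⌋) f ∎
  where
  open ≡-Reasoning
  middle : suc lo + ⌈ m /2⌉ + ⌊ m /2⌋ ≡ lo + suc m
  middle = trans (+-assoc (suc lo) ⌈ m /2⌉ ⌊ m /2⌋) (trans (cong (λ u → suc lo + u) (trans (+-comm ⌈ m /2⌉ ⌊ m /2⌋) (⌊n/2⌋+⌈n/2⌉≡n m))) (sym (+-suc lo m)))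

negOnePow-parity : ∀ n → negOnePow n ≡ (if isEven n then 1ℤ else ℤ.- 1ℤ)
negOnePow-parity zero          = refl
negOnePow-parity (suc zero)    = refl
negOnePow-parity (suc (suc n)) = trans (ℤₚ.neg-involutive (negOnePow n)) (negOnePow-parity n)

*-nonzero : ∀ {x y} → x ≢ 0ℤ → y ≢ 0ℤ → x ℤ.* y ≢ 0ℤ
*-nonzero {x} {y} x≢0 y≢0 eq with ℤₚ.i*j≡0⇒i≡0∨j≡0 x {y} eq
... | inj₁ x≡0 = x≢0 x≡0
... | inj₂ y≡0 = y≢0 y≡0

negOnePow-nonzero : ∀ n → negOnePow n ≢ 0ℤ
negOnePow-nonzero n eq with trans (sym (negOnePow-square n)) (cong (ℤ._* negOnePow n) eq)
... | ()

outerProd-one : ∀ m lo {f} → (∀ i → f i ≡ 1ℤ) → outerProd m lo f ≡ 1ℤ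
outerProd-one zero          lo f≡1 = refl
outerProd-one (suc zero)    lo f≡1 = f≡1 lo
outerProd-one (suc (suc m)) lo f≡1 = cong₂ ℤ._*_ (cong₂ ℤ._*_ (f≡1 lo) (f≡1 (lo + suc m))) (outerProd-one m (suc lo) f≡1)

<⌊/2⌋⇒ : ∀ i m → i < ⌊ m /2⌋ → 2 ℕ.* i + 2 ≤ m
<⌊/2⌋⇒ i m i< = ≤-trans (≤-reflexive (alg i)) (≤-trans (+-mono-≤ i< (≤-trans i< (⌊n/2⌋≤⌈n/2⌉ m))) (≤-reflexive (⌊n/2⌋+⌈n/2⌉≡n m)))
  where
  alg : ∀ i → 2 ℕ.* i + 2 ≡ suc i + suc i
  alg = ℕSolver.solve-∀

⇒<⌊/2⌋ : ∀ i m → 2 ℕ.* i + 2 ≤ m → i < ⌊ m /2⌋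
⇒<⌊/2⌋ i m le = ≤-trans (≤-reflexive (trans (n≡⌊n+n/2⌋ (suc i)) (cong ⌊_/2⌋ (alg i)))) (⌊n/2⌋-mono le)
  where
  alg : ∀ i → suc i + suc i ≡ 2 ℕ.* i + 2
  alg = ℕSolver.solve-∀

⌊suc/2⌋-even : ∀ n → isEven n ≡ true → ⌊ suc n /2⌋ ≡ ⌊ n /2⌋
⌊suc/2⌋-even zero          _  = refl
⌊suc/2⌋-even (suc (suc n)) ev = cong suc (⌊suc/2⌋-even n ev)

module Evaluate (S : ℕ) (β : List ℕ) (len-β : length β ≡ suc (suc S)) (dec-β : AllPairs _>_ β) where

  open Columns S
  open Core S β len-β
  open CoreBeta (suc (suc S)) β using (n)

  κ : ℕ → ℕ
  κ x = x / t

  A : ℕ → List ℕ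
  A = res β

  Desc : List ℕ → Set
  Desc = AllPairs (λ x y → κ y < κ x)

  A-desc : ∀ i → Desc (A i)
  A-desc i = go (Allₚ.all-filter (λ x → x % t ≟ i) β) (AllPairsₚ.filter⁺ (λ x → x % t ≟ i) dec-β)
    where
    mono : ∀ {x y} → x % t ≡ i → y % t ≡ i → y < x → κ y < κ x
    mono {x} {y} x≡ y≡ y<x = ≰⇒> λ le → <⇒≱ y<x (≤-trans (≤-reflexive (trans (m≡m%n+[m/n]*n x t) (cong (_+ κ x ℕ.* t) (trans x≡ (sym y≡)))))
      (≤-trans (+-monoʳ-≤ (y % t) (*-monoˡ-≤ t le)) (≤-reflexive (sym (m≡m%n+[m/n]*n y t)))))
    go : ∀ {l} → All (λ x → x % t ≡ i) l → AllPairs _>_ l → Desc l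
    go []        []          = []
    go (p ∷ ps) (q ∷ qs) = All.zipWith (λ { {y} (y≡ , y<) → mono p y≡ y< }) (ps , q) ∷ go ps qs

  -- `quotPart t β i` is `quot (A i)` by definition; having the list as an argument permits case
  -- analysis on its length.
  quot : List ℕ → ℕ → ℕ
  quot L = partAt (zipWith (λ x j → x / t + suc j ∸ length L) L (upTo (length L)))

  pairValue : List ℕ → List ℕ → ℤ
  pairValue L L' = + quot L 1 ℤ.+ + quot L' 1 ℤ.- + quot L 2 ℤ.- + quot L' 2 ℤ.+ 1ℤ

  private
    first-of-two : ∀ {k l} → l < k → + (k + 1 ∸ 2) ≡ + k ℤ.- 1ℤ
    first-of-two {suc k} _ = cong +_ (m+n∸n≡m k 1)

    second-of-two : ∀ k → + (k + 2 ∸ 2) ≡ + k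
    second-of-two k = cong +_ (m+n∸n≡m k 2)

    only-one : ∀ k → + (k + 1 ∸ 1) ≡ + k
    only-one k = cong +_ (m+n∸n≡m k 1)

  pairFactor : ℕ → ℤ
  pairFactor i = pairValue (A i) (A (S ∸ i))

  centreFactor : ℕ → ℕ → ℤ
  centreFactor m lo = if isEven (suc m) then + 2 ℤ.* + quot (A (lo + ⌊ m /2⌋)) 1 ℤ.+ 1ℤ else 1ℤ

  upperSign : ℕ → ℤ
  upperSign i = negOnePow (suc (n i) C 2)

  module _ (u : ℕ → ℤ) (u1 : u 1 ≡ 1ℤ) where

    -- The binomials for counts 0, 1, 2 of the larger residue are 0, 1, 3, which gives the signs +,
    -- -, -. The sign `(-1)^m`, present only when both rows share a residue, is `u 2` times `u 0`.
    -- Two rows `x`, `y` of one residue give the parts `κ x - 1` and `κ y`, so the `+ 1` in the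
    -- factor restores `κ x - κ y`.
    block-value : ∀ m L L' → u 2 ℤ.* u 0 ≡ negOnePow m → Desc L → Desc L' → length L + length L' ≡ 2 →
      block m L L' ≡ negOnePow (suc (length L') C 2) ℤ.* (u (length L) ℤ.* u (length L')) ℤ.* pairValue L L'
    block-value m [] (x ∷ y ∷ []) u20 _ ((κ< ∷ []) ∷ _) _ = sym (trans
      (cong₂ (λ p q → negOnePow 3 ℤ.* (u 0 ℤ.* u 2) ℤ.* (0ℤ ℤ.+ p ℤ.- 0ℤ ℤ.- q ℤ.+ 1ℤ)) (first-of-two κ<) (second-of-two (κ y)))
      (trans (alg (u 0) (u 2) (+ κ x) (+ κ y)) (cong (ℤ._* (+ κ y ℤ.- + κ x)) u20)))
      where
      alg : ∀ u₀ u₂ x y → ℤ.- 1ℤ ℤ.* (u₀ ℤ.* u₂) ℤ.* (0ℤ ℤ.+ (x ℤ.- 1ℤ) ℤ.- 0ℤ ℤ.- y ℤ.+ 1ℤ) ≡ u₂ ℤ.* u₀ ℤ.* (y ℤ.- x)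
      alg = solve-∀
    block-value m (x ∷ []) (y ∷ []) u20 _ _ _ = sym (trans
      (cong₂ (λ p q → negOnePow 1 ℤ.* (u 1 ℤ.* u 1) ℤ.* (p ℤ.+ q ℤ.- 0ℤ ℤ.- 0ℤ ℤ.+ 1ℤ)) (only-one (κ x)) (only-one (κ y)))
      (trans (cong (λ v → negOnePow 1 ℤ.* (v ℤ.* v) ℤ.* (+ κ x ℤ.+ + κ y ℤ.- 0ℤ ℤ.- 0ℤ ℤ.+ 1ℤ)) u1) (alg (+ κ x) (+ κ y))))
      where
      alg : ∀ x y → ℤ.- 1ℤ ℤ.* (1ℤ ℤ.* 1ℤ) ℤ.* (x ℤ.+ y ℤ.- 0ℤ ℤ.- 0ℤ ℤ.+ 1ℤ) ≡ ℤ.- (x ℤ.+ y ℤ.+ 1ℤ)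
      alg = solve-∀
    block-value m (x ∷ y ∷ []) [] u20 ((κ< ∷ []) ∷ _) _ _ = sym (trans
      (cong₂ (λ p q → 1ℤ ℤ.* (u 2 ℤ.* u 0) ℤ.* (p ℤ.+ 0ℤ ℤ.- q ℤ.- 0ℤ ℤ.+ 1ℤ)) (first-of-two κ<) (second-of-two (κ y)))
      (trans (alg (u 0) (u 2) (+ κ x) (+ κ y)) (cong (ℤ._* (+ κ x ℤ.- + κ y)) u20)))
      where
      alg : ∀ u₀ u₂ x y → 1ℤ ℤ.* (u₂ ℤ.* u₀) ℤ.* ((x ℤ.- 1ℤ) ℤ.+ 0ℤ ℤ.- y ℤ.- 0ℤ ℤ.+ 1ℤ) ≡ u₂ ℤ.* u₀ ℤ.* (x ℤ.- y)
      alg = solve-∀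
    block-value m []               []               _ _ _ ()
    block-value m []               (_ ∷ [])         _ _ _ ()
    block-value m []               (_ ∷ _ ∷ _ ∷ _)  _ _ _ ()
    block-value m (_ ∷ [])         []               _ _ _ ()
    block-value m (_ ∷ [])         (_ ∷ _ ∷ _)      _ _ _ ()
    block-value m (_ ∷ _ ∷ [])     (_ ∷ _)          _ _ _ ()
    block-value m (_ ∷ _ ∷ _ ∷ _)  _                _ _ _ ()

    module _ (bal : BalancedCounts) where
      open BalancedCounts bal

      centre-value : ∀ L → length L ≡ 1 → centre L ≡ + 2 ℤ.* + quot L 1 ℤ.+ 1ℤ
      centre-value (x ∷ []) _ = trans (alg (+ κ x)) (cong (λ p → + 2 ℤ.* p ℤ.+ 1ℤ) (sym (only-one (κ x))))
        where
        alg : ∀ x → (1ℤ ℤ.+ x) ℤ.+ x ≡ + 2 ℤ.* x ℤ.+ 1ℤ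
        alg = solve-∀

      blocks-value : ∀ m lo → lo + lo + m ≡ suc S → u 2 ℤ.* u 0 ≡ negOnePow m →
        blocks m lo A ≡ upperProd m lo upperSign ℤ.* outerProd m lo (u ∘ n) ℤ.*
          (productℤ (map pairFactor (segment lo ⌊ m /2⌋)) ℤ.* centreFactor m lo)
      blocks-value zero lo eq u20 = refl
      blocks-value (suc zero) lo eq u20 = trans (centre-value (A lo) n≡1)
        (sym (trans (cong (λ v → 1ℤ ℤ.* v ℤ.* (1ℤ ℤ.* (+ 2 ℤ.* + quot (A (lo + 0)) 1 ℤ.+ 1ℤ))) (trans (cong u n≡1) u1))
          (trans (alg _) (cong (λ i → + 2 ℤ.* + quot (A i) 1 ℤ.+ 1ℤ) (+-identityʳ lo)))))
        where
        alg : ∀ v → 1ℤ ℤ.* 1ℤ ℤ.* (1ℤ ℤ.* v) ≡ v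
        alg = solve-∀
        double : ∀ k → k + k ≡ 2 → k ≡ 1
        double 1 _ = refl
        double (suc (suc k)) e = contradiction (trans (sym (+-suc k (suc k))) (suc-injective (suc-injective e))) (λ ())
        n≡1 : n lo ≡ 1
        n≡1 = double (n lo) (pairs lo lo (suc-injective (trans (+-comm 1 (lo + lo)) eq)))
      blocks-value (suc (suc m)) lo eq u20 = begin
        block m (A lo) (A hi) ℤ.* blocks m (suc lo) A
          ≡⟨ cong₂ ℤ._*_ (block-value m (A lo) (A hi) u20' (A-desc lo) (A-desc hi) (pairs lo hi lo+hi)) (blocks-value m (suc lo) (interval-inner lo m eq) u20') ⟩
        upperSign hi ℤ.* (u (n lo) ℤ.* u (n hi)) ℤ.* pairValue (A lo) (A hi) ℤ.*
          (upperProd m (suc lo) upperSign ℤ.* outerProd m (suc lo) (u ∘ n) ℤ.* (P ℤ.* centreFactor m (suc lo)))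
          ≡⟨ cong₂ (λ i c → upperSign hi ℤ.* (u (n lo) ℤ.* u (n hi)) ℤ.* pairValue (A lo) (A i) ℤ.*
               (upperProd m (suc lo) upperSign ℤ.* outerProd m (suc lo) (u ∘ n) ℤ.* (P ℤ.* c))) hi≡ centre≡ ⟩
        upperSign hi ℤ.* (u (n lo) ℤ.* u (n hi)) ℤ.* pairFactor lo ℤ.*
          (upperProd m (suc lo) upperSign ℤ.* outerProd m (suc lo) (u ∘ n) ℤ.* (P ℤ.* centreFactor (2 + m) lo))
          ≡⟨ alg (upperSign hi) (u (n lo) ℤ.* u (n hi)) (pairFactor lo) (upperProd m (suc lo) upperSign) (outerProd m (suc lo) (u ∘ n)) P (centreFactor (2 + m) lo) ⟩
        upperProd (2 + m) lo upperSign ℤ.* outerProd (2 + m) lo (u ∘ n) ℤ.* (pairFactor lo ℤ.* P ℤ.* centreFactor (2 + m) lo) ∎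
        where
        open ≡-Reasoning
        hi = lo + suc m
        P = productℤ (map pairFactor (segment (suc lo) ⌊ m /2⌋))
        u20' : u 2 ℤ.* u 0 ≡ negOnePow m
        u20' = trans u20 (ℤₚ.neg-involutive (negOnePow m))
        lo+hi : lo + hi ≡ S
        lo+hi = interval-ends lo m eq
        hi≡ : hi ≡ S ∸ lo
        hi≡ = sym (trans (cong (_∸ lo) (sym lo+hi)) (m+n∸m≡n lo hi))
        centre≡ : centreFactor m (suc lo) ≡ centreFactor (2 + m) lo
        centre≡ = cong (λ i → if isEven (suc m) then + 2 ℤ.* + quot (A i) 1 ℤ.+ 1ℤ else 1ℤ) (sym (+-suc lo ⌊ m /2⌋))
        alg : ∀ s w v H O P c → s ℤ.* w ℤ.* v ℤ.* (H ℤ.* O ℤ.* (P ℤ.* c)) ≡ (s ℤ.* H) ℤ.* (w ℤ.* O) ℤ.* (v ℤ.* P ℤ.* c)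
        alg = solve-∀

  -- For even `t` every block has an odd number of columns between its two, and the resulting -1 is
  -- charged to the residue of count 2; truncation gives the counts 0 and 1 the sign +1. For odd `t`
  -- there is no sign to charge.
  rankSign : Bool → ℕ → ℤ
  rankSign e k = if e then negOnePow (k ∸ 1) else 1ℤ

  rankSign-one : ∀ e → rankSign e 1 ≡ 1ℤ
  rankSign-one true  = refl
  rankSign-one false = refl

  rankSign-pair : ∀ m → rankSign (isEven m) 2 ℤ.* rankSign (isEven m) 0 ≡ negOnePow (suc m)
  rankSign-pair m = trans (go (isEven m)) (cong ℤ.-_ (sym (negOnePow-parity m)))
    where
    go : ∀ e → rankSign e 2 ℤ.* rankSign e 0 ≡ ℤ.- (if e then 1ℤ else ℤ.- 1ℤ)
    go true  = refl
    go false = refl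

  upper-list : filter (λ i → i ≤? S) (map (λ k → t / 2 + k) (upTo t)) ≡ segment (t / 2) ⌊ suc S /2⌋
  upper-list = trans (cong (filter (λ i → i ≤? S)) (trans (Listₚ.map-upTo (λ k → t / 2 + k) t) (applyUpTo-segment t (t / 2) (λ k → t / 2 + k) (λ _ → refl))))
    (filter-segment (λ i → i ≤? S) (t / 2) ⌊ suc S /2⌋ t (≤-trans (⌊n/2⌋≤n (suc S)) (n≤1+n (suc S)))
      (λ i i≤S → ≤-trans (s≤s i≤S) (≤-reflexive (sym total))) (λ i _ i< → s≤s⁻¹ (≤-trans i< (≤-reflexive total))))
    where
    total : t / 2 + ⌊ suc S /2⌋ ≡ suc S
    total = trans (cong (_+ ⌊ suc S /2⌋) (n/2≡⌊n/2⌋ t)) (trans (+-comm ⌈ suc S /2⌉ ⌊ suc S /2⌋) (⌊n/2⌋+⌈n/2⌉≡n (suc S)))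

  pair-list : filter (λ i → 2 ℕ.* i + 3 ≤? t) (upTo t) ≡ segment 0 ⌊ suc S /2⌋
  pair-list = trans (cong (filter (λ i → 2 ℕ.* i + 3 ≤? t)) (upTo-segment t))
    (filter-segment (λ i → 2 ℕ.* i + 3 ≤? t) 0 ⌊ suc S /2⌋ t (≤-trans (⌊n/2⌋≤n (suc S)) (n≤1+n (suc S)))
      (λ i le → ⇒<⌊/2⌋ i (suc S) (s≤s⁻¹ (subst (_≤ t) (+-suc (2 ℕ.* i) 2) le)))
      (λ i _ i< → subst (_≤ t) (sym (+-suc (2 ℕ.* i) 2)) (s≤s (<⌊/2⌋⇒ i (suc S) i<))))

  module _ (bal : BalancedCounts) where
    open BalancedCounts bal

    private
      u : ℕ → ℤ
      u = rankSign (isEven t)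

      r : ℕ
      r = rank (core t β)

      parityFactor : ℤ
      parityFactor = if isEven t then negOnePow (suc r) else 1ℤ

      H O P Q M : ℤ
      H = upperProd (suc S) 0 (upperSign)
      O = outerProd (suc S) 0 (u ∘ n)
      P = productℤ (map (pairFactor) (segment 0 ⌊ suc S /2⌋))
      M = centreFactor (suc S) 0
      Q = + quot (A (suc S)) 1 ℤ.+ 1ℤ

    epsilon-sign : negOnePowℤ (epsilon t β) ≡ H ℤ.* parityFactor
    epsilon-sign = trans (negOnePowℤ-+ (ℤ.- total) tail) (cong₂ ℤ._*_ first (second (isEven t)))
      where
      f : ℕ → ℕ
      f i = suc (n i) C 2
      total = sumℤ (map (λ i → + f i) (filter (λ i → i ≤? S) (map (λ k → t / 2 + k) (upTo t))))
      tail = if isEven t then + suc r else 0ℤ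
      first : negOnePowℤ (ℤ.- total) ≡ H
      first = trans (negOnePowℤ-neg total) (trans (cong (λ l → negOnePowℤ (sumℤ (map (λ i → + f i) l))) upper-list)
        (trans (negOnePowℤ-sum f (t / 2) ⌊ suc S /2⌋) (trans (cong (λ o → prodFrom o ⌊ suc S /2⌋ (negOnePow ∘ f)) (n/2≡⌊n/2⌋ t))
          (sym (upperProd-prodFrom (suc S) 0 (negOnePow ∘ f))))))
      second : ∀ e → negOnePowℤ (if e then + suc r else 0ℤ) ≡ (if e then negOnePow (suc r) else 1ℤ)
      second true  = refl
      second false = refl

    -- The source of `1 + r` in `epsilon`: for even `t` the first column contributes -1 and the
    -- residues of count 2 contribute `(-1)^r`; for odd `t` both are 1.
    parity-sign : negOnePow (suc S) ℤ.* O ≡ parityFactor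
    parity-sign = trans (cong (λ s → ℤ.- s ℤ.* O) (negOnePow-parity S)) (go (isEven S))
      where
      go : ∀ e → ℤ.- (if e then 1ℤ else ℤ.- 1ℤ) ℤ.* outerProd (suc S) 0 (rankSign e ∘ n) ≡ (if e then negOnePow (suc r) else 1ℤ)
      go true  = trans (ℤₚ.-1*i≡-i _) (cong ℤ.-_ (trans (outerProd-prodFrom (suc S) 0 (λ i → negOnePow (n i ∸ 1))) (sym (negOnePow-rank bal))))
      go false = trans (ℤₚ.*-identityˡ _) (outerProd-one (suc S) 0 (λ _ → refl))

    top-value : ∀ L → length L ≡ 1 → top L ≡ + quot L 1 ℤ.+ 1ℤ
    top-value (x ∷ []) _ = trans (ℤₚ.+-comm 1ℤ (+ κ x)) (cong (ℤ._+ 1ℤ) (sym (only-one (κ x))))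

    middle-value : M ≡ (if isEven t then + 2 ℤ.* + quotPart t β (t / 2 ∸ 1) 1 ℤ.+ 1ℤ else 1ℤ)
    middle-value = go (isEven S) refl
      where
      go : ∀ e → isEven S ≡ e → (if e then + 2 ℤ.* + quot (A ⌊ suc S /2⌋) 1 ℤ.+ 1ℤ else 1ℤ) ≡
                                (if e then + 2 ℤ.* + quotPart t β (t / 2 ∸ 1) 1 ℤ.+ 1ℤ else 1ℤ)
      go true  ev = cong (λ i → + 2 ℤ.* + quot (A i) 1 ℤ.+ 1ℤ) (trans (⌊suc/2⌋-even S ev) (cong (_∸ 1) (sym (n/2≡⌊n/2⌋ t))))
      go false _  = refl

    D-value : D E₀ β ≡ + 2 ℤ.* rhs t β
    D-value = begin
      D E₀ β
        ≡⟨ trans (cong (ℤ._* D E₀ β) (negOnePow-square (inversions (map (_% t) β)))) (ℤₚ.*-identityˡ (D E₀ β)) ⟨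
      I ℤ.* I ℤ.* D E₀ β
        ≡⟨ ℤₚ.*-assoc I I (D E₀ β) ⟩
      I ℤ.* (I ℤ.* D E₀ β)
        ≡⟨ cong (I ℤ.*_) (signed-D₀ β len-β) ⟩
      I ℤ.* (+ 2 ℤ.* (negOnePow (suc S) ℤ.* (top (A (suc S)) ℤ.* blocks (suc S) 0 A)))
        ≡⟨ cong₂ (λ x y → I ℤ.* (+ 2 ℤ.* (negOnePow (suc S) ℤ.* (x ℤ.* y)))) (top-value (A (suc S)) last)
             (blocks-value u (rankSign-one (isEven t)) bal (suc S) 0 refl (rankSign-pair S)) ⟩
      I ℤ.* (+ 2 ℤ.* (negOnePow (suc S) ℤ.* (Q ℤ.* (H ℤ.* O ℤ.* (P ℤ.* M)))))
        ≡⟨ alg I (negOnePow (suc S)) Q H O P M ⟩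
      + 2 ℤ.* (H ℤ.* (negOnePow (suc S) ℤ.* O) ℤ.* I ℤ.* Q ℤ.* P ℤ.* M)
        ≡⟨ cong (λ x → + 2 ℤ.* (H ℤ.* x ℤ.* I ℤ.* Q ℤ.* P ℤ.* M)) parity-sign ⟩
      + 2 ℤ.* (H ℤ.* parityFactor ℤ.* I ℤ.* Q ℤ.* P ℤ.* M)
        ≡⟨ cong₂ (λ x y → + 2 ℤ.* (x ℤ.* y ℤ.* Q ℤ.* P ℤ.* M)) epsilon-sign (sgn-sortPerm t β) ⟨
      + 2 ℤ.* (negOnePowℤ (epsilon t β) ℤ.* sgn (sortPerm t β) ℤ.* Q ℤ.* P ℤ.* M)
        ≡⟨ cong₂ (λ l y → + 2 ℤ.* (negOnePowℤ (epsilon t β) ℤ.* sgn (sortPerm t β) ℤ.* Q ℤ.* productℤ (map (pairFactor) l) ℤ.* y))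
             (sym pair-list) middle-value ⟩
      + 2 ℤ.* rhs t β ∎
      where
      open ≡-Reasoning
      I = negOnePow (inversions (map (_% t) β))
      alg : ∀ I s Q H O P M → I ℤ.* (+ 2 ℤ.* (s ℤ.* (Q ℤ.* (H ℤ.* O ℤ.* (P ℤ.* M))))) ≡ + 2 ℤ.* (H ℤ.* (s ℤ.* O) ℤ.* I ℤ.* Q ℤ.* P ℤ.* M)
      alg = solve-∀

    -- Two rows of the same residue have different heights, and for rows of dual residues
    -- `κ x + κ y + 1` is positive.
    block-nonzero : ∀ m L L' → Desc L → Desc L' → length L + length L' ≡ 2 → block m L L' ≢ 0ℤ
    block-nonzero m []           (x ∷ y ∷ []) _ ((κ< ∷ []) ∷ _) _ = *-nonzero (negOnePow-nonzero m) (λ eq → <⇒≢ κ< (ℤₚ.+-injective (ℤₚ.i-j≡0⇒i≡j (+ κ y) (+ κ x) eq)))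
    block-nonzero m (x ∷ [])     (y ∷ [])     _ _ _ eq = 1+n≢0 (trans (+-comm 1 (κ x + κ y)) (ℤₚ.+-injective (ℤₚ.neg-injective {+ (κ x + κ y + 1)} {0ℤ} eq)))
    block-nonzero m (x ∷ y ∷ []) []           ((κ< ∷ []) ∷ _) _ _ = *-nonzero (negOnePow-nonzero m) (λ eq → <⇒≢ κ< (sym (ℤₚ.+-injective (ℤₚ.i-j≡0⇒i≡j (+ κ x) (+ κ y) eq))))
    block-nonzero m []               []               _ _ ()
    block-nonzero m []               (_ ∷ [])         _ _ ()
    block-nonzero m []               (_ ∷ _ ∷ _ ∷ _)  _ _ ()
    block-nonzero m (_ ∷ [])         []               _ _ ()
    block-nonzero m (_ ∷ [])         (_ ∷ _ ∷ _)      _ _ ()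
    block-nonzero m (_ ∷ _ ∷ [])     (_ ∷ _)          _ _ ()
    block-nonzero m (_ ∷ _ ∷ _ ∷ _)  _                _ _ ()

    blocks-nonzero : ∀ m lo → lo + lo + m ≡ suc S → blocks m lo A ≢ 0ℤ
    blocks-nonzero zero lo eq ()
    blocks-nonzero (suc zero) lo eq b≡0 with A lo | pairs lo lo (suc-injective (trans (+-comm 1 (lo + lo)) eq))
    blocks-nonzero (suc zero) lo eq () | x ∷ [] | _
    ... | [] | ()
    ... | _ ∷ _ ∷ [] | ()
    ... | _ ∷ _ ∷ _ ∷ _ | ()
    blocks-nonzero (suc (suc m)) lo eq = *-nonzero
      (block-nonzero m (A lo) (A (lo + suc m)) (A-desc lo) (A-desc (lo + suc m)) (pairs lo (lo + suc m) (interval-ends lo m eq)))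
      (blocks-nonzero m (suc lo) (interval-inner lo m eq))

    D-nonzero : D E₀ β ≢ 0ℤ
    D-nonzero D≡0 = *-nonzero {+ 2} (λ ()) (*-nonzero (negOnePow-nonzero (suc S)) (*-nonzero top≢0 (blocks-nonzero (suc S) 0 refl)))
      (trans (sym (signed-D₀ β len-β)) (trans (cong (negOnePow (inversions (map (_% t) β)) ℤ.*_) D≡0) (ℤₚ.*-zeroʳ (negOnePow (inversions (map (_% t) β))))))
      where
      top≢0 : top (A (suc S)) ≢ 0ℤ
      top≢0 eq with A (suc S) | last
      top≢0 () | x ∷ [] | _

  D-nonzero⇒counts : D E₀ β ≢ 0ℤ → BalancedCounts
  D-nonzero⇒counts D≢0 = record { last = top-length (A (suc S)) top≢0 ; pairs = λ a a' eq → all-pairs (suc S) 0 refl blocks≢0 a a' eq z≤n z≤n }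
    where
    product≢0 : + 2 ℤ.* (negOnePow (suc S) ℤ.* (top (A (suc S)) ℤ.* blocks (suc S) 0 A)) ≢ 0ℤ
    product≢0 eq = *-nonzero (negOnePow-nonzero (inversions (map (_% t) β))) D≢0 (trans (signed-D₀ β len-β) eq)
    top≢0 : top (A (suc S)) ≢ 0ℤ
    top≢0 eq = product≢0 (trans (cong (λ x → + 2 ℤ.* (negOnePow (suc S) ℤ.* (x ℤ.* blocks (suc S) 0 A))) eq) (cong (+ 2 ℤ.*_) (ℤₚ.*-zeroʳ (negOnePow (suc S)))))
    blocks≢0 : blocks (suc S) 0 A ≢ 0ℤ
    blocks≢0 eq = product≢0 (trans (cong (λ x → + 2 ℤ.* (negOnePow (suc S) ℤ.* (top (A (suc S)) ℤ.* x))) eq)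
      (cong (+ 2 ℤ.*_) (trans (cong (negOnePow (suc S) ℤ.*_) (ℤₚ.*-zeroʳ (top (A (suc S))))) (ℤₚ.*-zeroʳ (negOnePow (suc S))))))
    top-length : ∀ L → top L ≢ 0ℤ → length L ≡ 1
    top-length []          ≢0 = contradiction refl ≢0
    top-length (x ∷ [])    ≢0 = refl
    top-length (_ ∷ _ ∷ _) ≢0 = contradiction refl ≢0
    centre-length : ∀ L → centre L ≢ 0ℤ → length L ≡ 1
    centre-length []          ≢0 = contradiction refl ≢0
    centre-length (x ∷ [])    ≢0 = refl
    centre-length (_ ∷ _ ∷ _) ≢0 = contradiction refl ≢0
    block-length : ∀ m L L' → block m L L' ≢ 0ℤ → length L + length L' ≡ 2
    block-length m L L' ≢0 with length L + length L' ≟ 2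
    ... | yes eq = eq
    ... | no neq = contradiction (block-zero m L L' neq) ≢0
    outer-length : ∀ m lo → blocks (2 + m) lo A ≢ 0ℤ → n lo + n (lo + suc m) ≡ 2
    outer-length m lo ≢0 = block-length m (A lo) (A (lo + suc m)) (λ b≡0 → ≢0 (cong (ℤ._* blocks m (suc lo) A) b≡0))
    all-pairs : ∀ m lo → lo + lo + m ≡ suc S → blocks m lo A ≢ 0ℤ → ∀ a a' → a + a' ≡ S → lo ≤ a → lo ≤ a' → n a + n a' ≡ 2
    all-pairs zero lo eq ≢0 a a' a+a' lo≤a lo≤a' = contradiction (≤-trans (+-mono-≤ lo≤a lo≤a') (≤-reflexive a+a')) (<⇒≱ (≤-reflexive (trans (sym eq) (+-identityʳ (lo + lo)))))
    all-pairs (suc zero) lo eq ≢0 a a' a+a' lo≤a lo≤a' = cong₂ _+_ (trans (cong n a≡) one) (trans (cong n a'≡) one)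
      where
      one : n lo ≡ 1
      one = centre-length (A lo) ≢0
      sum≡ : a + a' ≡ lo + lo
      sum≡ = trans a+a' (suc-injective (trans (sym eq) (+-comm (lo + lo) 1)))
      a≡ : a ≡ lo
      a≡ = ≤-antisym (+-cancelʳ-≤ lo a lo (≤-trans (+-monoʳ-≤ a lo≤a') (≤-reflexive sum≡))) lo≤a
      a'≡ : a' ≡ lo
      a'≡ = +-cancelˡ-≡ lo a' lo (trans (cong (_+ a') (sym a≡)) sum≡)
    all-pairs (suc (suc m)) lo eq ≢0 a a' a+a' lo≤a lo≤a' with a ≟ lo | a' ≟ lo
    ... | yes refl | _ = trans (cong (λ i → n a + n i) (+-cancelˡ-≡ a a' (a + suc m) (trans a+a' (sym (interval-ends lo m eq)))))
      (outer-length m lo ≢0)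
    ... | no _ | yes refl = trans (trans (+-comm (n a) (n a'))
      (cong (λ i → n a' + n i) (+-cancelˡ-≡ a' a (a' + suc m) (trans (trans (+-comm a' a) a+a') (sym (interval-ends lo m eq))))))
      (outer-length m lo ≢0)
    ... | no a≢ | no a'≢ = all-pairs m (suc lo) (interval-inner lo m eq)
      (λ b≡0 → ≢0 (trans (cong (block m (A lo) (A (lo + suc m)) ℤ.*_) b≡0) (ℤₚ.*-zeroʳ (block m (A lo) (A (lo + suc m))))))
      a a' a+a' (≤∧≢⇒< lo≤a (a≢ ∘ sym)) (≤∧≢⇒< lo≤a' (a'≢ ∘ sym))

-- Beta-sets of partitions and the character at the powers of `ω`

when-cong : ∀ {P Q : Set} (d : Dec P) (d' : Dec Q) {x} → (P → Q) → (Q → P) → when d x ≡ when d' x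
when-cong (yes p) d' to from = sym (when-yes d' (to p))
when-cong (no ¬p) d' to from = sym (when-no d' (¬p ∘ from))

toList-desc : ∀ {m} (f : Fin m → ℕ) → (∀ i j → i Fin.< j → f j < f i) → AllPairs _>_ (Vec.toList (Vec.tabulate f))
toList-desc {zero}  f desc = []
toList-desc {suc m} f desc = all (f ∘ Fin.suc) (λ j → desc Fin.zero (Fin.suc j) (s≤s z≤n)) ∷ toList-desc (f ∘ Fin.suc) (λ i j i<j → desc (Fin.suc i) (Fin.suc j) (s≤s i<j))
  where
  all : ∀ {m x} (g : Fin m → ℕ) → (∀ j → g j < x) → All (_< x) (Vec.toList (Vec.tabulate g))
  all {zero}  g lt = []
  all {suc m} g lt = lt Fin.zero ∷ all (g ∘ Fin.suc) (lt ∘ Fin.suc)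

beta-desc : ∀ m (lam : Vec ℕ m) → IsPartition lam → AllPairs _>_ (beta m lam)
beta-desc m lam part = toList-desc _ (λ i j i<j → +-mono-≤-< (part i j (<⇒≤ i<j)) (∸-monoʳ-< (s<s i<j) (Finₚ.toℕ<n j)))

length-beta : ∀ m (lam : Vec ℕ m) → length (beta m lam) ≡ m
length-beta m lam = Vecₚ.length-toList (Vec.tabulate (λ j → lookup lam j + (m ∸ suc (toℕ j))))

module Specialise {c ℓ : Level} (R : CommutativeRing c ℓ) where
  open CommutativeRing R using (Carrier; _≈_; 0#; 1#; ring) renaming
    (_+_ to _⊞_; _*_ to _⊠_; -_ to ⊟_; refl to ≈-refl; sym to ≈-sym; trans to ≈-trans; reflexive to ≈-reflexive;
     +-cong to ⊞-cong; *-cong to ⊠-cong; -‿cong to ⊟-cong; +-identityˡ to ⊞-identityˡ; +-identityʳ to ⊞-identityʳ;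
     *-identityˡ to ⊠-identityˡ; *-identityʳ to ⊠-identityʳ; *-assoc to ⊠-assoc; *-comm to ⊠-comm; zeroˡ to ⊠-zeroˡ; zeroʳ to ⊠-zeroʳ)
  open RingProperties ring using (x∙y⁻¹≈ε⇒x≈y; -0#≈0#)
  open CommutativeSemigroupProperties (CommutativeRing.*-commutativeSemigroup R) using (interchange)
  open SetoidReasoning (CommutativeRing.setoid R)
  open OverRing R

  pow-one : ∀ k → pow R 1# k ≈ 1#
  pow-one zero    = ≈-refl
  pow-one (suc k) = ≈-trans (⊠-identityˡ _) (pow-one k)

  pow-cong : ∀ {x y} k → x ≈ y → pow R x k ≈ pow R y k
  pow-cong zero    eq = ≈-refl
  pow-cong (suc k) eq = ⊠-cong eq (pow-cong k eq)

  pow-⊠ : ∀ x y k → pow R (x ⊠ y) k ≈ pow R x k ⊠ pow R y k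
  pow-⊠ x y zero    = ≈-sym (⊠-identityˡ 1#)
  pow-⊠ x y (suc k) = ≈-trans (⊠-cong ≈-refl (pow-⊠ x y k)) (interchange x y (pow R x k) (pow R y k))

  module Roots (inv : Carrier → Carrier) (inv-law : (x : Carrier) → ¬ (x ≈ 0#) → x ⊠ inv x ≈ 1#)
    (char0 : (n : ℕ) → ¬ (natR R (suc n) ≈ 0#)) (S : ℕ) (ω : Carrier)
    (ωᵗ≈1 : pow R ω (suc (suc S)) ≈ 1#) (prim : (k : ℕ) → 0 < k → k < suc (suc S) → ¬ (pow R ω k ≈ 1#)) where

    private
      t = suc (suc S)

    1≉0 : ¬ (1# ≈ 0#)
    1≉0 eq = char0 0 (≈-trans (⊞-identityʳ 1#) eq)

    -- The inverse of `ω`, written as a power of `ω`. As `inv` is not assumed to respect `≈`, each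
    -- `inv (pow R ω k)` is identified separately with a power of `ω⁻`, by cancellation.
    ω⁻ : Carrier
    ω⁻ = pow R ω (suc S)

    cancel : ∀ k → pow R ω k ⊠ pow R ω⁻ k ≈ 1#
    cancel k = ≈-trans (≈-sym (pow-⊠ ω ω⁻ k)) (≈-trans (pow-cong k ωᵗ≈1) (pow-one k))

    inv-pow : ∀ k → inv (pow R ω k) ≈ pow R ω⁻ k
    inv-pow k = begin
      inv p             ≈⟨ ⊠-identityˡ _ ⟨
      1# ⊠ inv p        ≈⟨ ⊠-cong (≈-trans (⊠-comm q p) (cancel k)) ≈-refl ⟨
      (q ⊠ p) ⊠ inv p   ≈⟨ ⊠-assoc q p (inv p) ⟩
      q ⊠ (p ⊠ inv p)   ≈⟨ ⊠-cong ≈-refl (inv-law p (λ p≈0 → 1≉0 (≈-trans (≈-sym (cancel k)) (≈-trans (⊠-cong p≈0 ≈-refl) (⊠-zeroˡ q))))) ⟩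
      q ⊠ 1#            ≈⟨ ⊠-identityʳ q ⟩
      q                 ∎
      where
      p = pow R ω k
      q = pow R ω⁻ k

    unit : ∀ x → ¬ (x ≈ 1#) → Σ Carrier λ y → y ⊠ (1# ⊞ ⊟ x) ≈ 1#
    unit x x≉1 = inv (1# ⊞ ⊟ x) , ≈-trans (⊠-comm _ _) (inv-law _ (λ eq → x≉1 (≈-sym (x∙y⁻¹≈ε⇒x≈y 1# x eq))))

    private
      module P⁺ = Primitive (suc S) ω ωᵗ≈1 (λ k 0<k k<t → unit (pow R ω k) (prim k 0<k k<t))
      module P⁻ = Primitive (suc S) ω⁻
        (≈-trans (≈-sym (⊠-identityˡ _)) (≈-trans (⊠-cong (≈-sym ωᵗ≈1) ≈-refl) (cancel t)))
        (λ k 0<k k<t → unit (pow R ω⁻ k) (λ eq → prim k 0<k k<t (≈-trans (≈-sym (⊠-identityʳ _)) (≈-trans (⊠-cong ≈-refl (≈-sym eq)) (cancel k)))))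

    vars : List Carrier
    vars = range t (pow R ω) ++ range t (λ k → inv (pow R ω k))

    open DoublePole (suc S) (range t (pow R ω)) (range t (λ k → inv (pow R ω k))) P⁺.p-cyc
      (≋-trans (mulAll-range-cong t δ inv-pow) P⁻.p-cyc) using (hN-value)

    hN-zero : ∀ m r → 0 < r → r < t → hN R (m ℕ.* t + r) vars ≈ 0#
    hN-zero m (suc r) _ r<t = ≈-trans (hN-value m r<t) (⊠-zeroʳ _)

    -- Both `ρ` and `x` are below `t`, so `t` divides the index only if they are equal.
    h-value : ∀ c ρ x → ρ < t → x < t → h R (+ (ρ + c ℕ.* t) ℤ.- + x) vars ≈ fromℤ R (when (ρ ≟ x) (+ suc c))
    h-value c ρ x ρ<t x<t with ρ ≟ x
    ... | yes refl = ≈-trans (≈-reflexive (cong (λ k → h R k vars) arg)) (≈-trans (hN-value c {0} z<s) (⊠-identityʳ _))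
      where
      arg : + (ρ + c ℕ.* t) ℤ.- + ρ ≡ + (c ℕ.* t + 0)
      arg = trans (ℤₚ.m-n≡m⊖n (ρ + c ℕ.* t) ρ) (trans (ℤₚ.⊖-≥ (m≤m+n ρ (c ℕ.* t))) (cong +_ (trans (m+n∸m≡n ρ (c ℕ.* t)) (sym (+-identityʳ (c ℕ.* t))))))
    ... | no ρ≢x with x ≤? ρ
    ...   | yes x≤ρ = ≈-trans (≈-reflexive (cong (λ k → h R k vars) arg)) (hN-zero c (ρ ∸ x) (m<n⇒0<n∸m (≤∧≢⇒< x≤ρ (ρ≢x ∘ sym))) (≤-<-trans (m∸n≤m ρ x) ρ<t))
      where
      arg : + (ρ + c ℕ.* t) ℤ.- + x ≡ + (c ℕ.* t + (ρ ∸ x))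
      arg = trans (ℤₚ.m-n≡m⊖n (ρ + c ℕ.* t) x) (trans (ℤₚ.⊖-≥ (≤-trans x≤ρ (m≤m+n ρ (c ℕ.* t)))) (cong +_ (trans (cong (_∸ x) (+-comm ρ (c ℕ.* t))) (+-∸-assoc (c ℕ.* t) x≤ρ))))
    -- For `ρ < x` one multiple of `t` is borrowed to get the remainder `t - (x - ρ)`; when `c` is 0
    -- there is none, and the index is negative.
    ...   | no x≰ρ = below c
      where
      ρ<x = ≰⇒> x≰ρ
      below : ∀ c → h R (+ (ρ + c ℕ.* t) ℤ.- + x) vars ≈ 0#
      below zero = ≈-reflexive (cong (λ k → h R k vars) (trans (ℤₚ.m-n≡m⊖n (ρ + 0) x) (trans (cong (ℤ._⊖ x) (+-identityʳ ρ))
        (trans (ℤₚ.⊖-< ρ<x) (cong (λ k → ℤ.- + k) (sym (suc-pred (x ∸ ρ) {{>-nonZero (m<n⇒0<n∸m ρ<x)}})))))))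
      below (suc c) = ≈-trans (≈-reflexive (cong (λ k → h R k vars) arg))
        (hN-zero c (t ∸ (x ∸ ρ)) (m<n⇒0<n∸m (≤-<-trans (m∸n≤m x ρ) x<t)) (∸-monoʳ-< {t} {x ∸ ρ} {0} (m<n⇒0<n∸m ρ<x) (≤-trans (m∸n≤m x ρ) (<⇒≤ x<t))))
        where
        x-ρ = x ∸ ρ
        x≡ : + x ≡ + x-ρ ℤ.+ + ρ
        x≡ = cong +_ (sym (m∸n+n≡m (<⇒≤ ρ<x)))
        t≡ : + t ≡ + (t ∸ x-ρ) ℤ.+ + x-ρ
        t≡ = cong +_ (sym (m∸n+n≡m (≤-trans (m∸n≤m x ρ) (<⇒≤ x<t))))
        alg : ∀ r a b ct → r ℤ.+ ((a ℤ.+ b) ℤ.+ ct) ℤ.- (b ℤ.+ r) ≡ ct ℤ.+ a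
        alg = solve-∀
        arg : + (ρ + suc c ℕ.* t) ℤ.- + x ≡ + (c ℕ.* t + (t ∸ x-ρ))
        arg = trans (cong₂ (λ u v → + ρ ℤ.+ (u ℤ.+ + (c ℕ.* t)) ℤ.- v) t≡ x≡) (alg (+ ρ) (+ (t ∸ x-ρ)) (+ x-ρ) (+ (c ℕ.* t)))

    -- Lowering the index by `t` turns `c + 1` into `c`. For `c = 0` the index becomes negative, and
    -- the value 0 still fits.
    h-value-shifted : ∀ c ρ x → ρ < t → x < t → h R (+ (ρ + c ℕ.* t) ℤ.- + x ℤ.- + t) vars ≈ fromℤ R (when (ρ ≟ x) (+ c))
    h-value-shifted zero ρ x ρ<t x<t = ≈-trans (≈-reflexive (cong (λ k → h R k vars) arg)) (≈-reflexive (cong (fromℤ R) (sym (when-zero (ρ ≟ x)))))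
      where
      when-zero : ∀ {P : Set} (d : Dec P) → when d (+ 0) ≡ 0ℤ
      when-zero (yes _) = refl
      when-zero (no _)  = refl
      gap = x + t ∸ ρ
      alg : ∀ r x t → r ℤ.+ 0ℤ ℤ.- x ℤ.- t ≡ r ℤ.- (x ℤ.+ t)
      alg = solve-∀
      ρ<x+t : ρ < x + t
      ρ<x+t = <-≤-trans ρ<t (m≤n+m t x)
      arg : + (ρ + 0) ℤ.- + x ℤ.- + t ≡ -[1+ pred gap ]
      arg = trans (alg (+ ρ) (+ x) (+ t)) (trans (ℤₚ.m-n≡m⊖n ρ (x + t)) (trans (ℤₚ.⊖-< ρ<x+t)
        (cong (λ k → ℤ.- + k) (sym (suc-pred gap {{>-nonZero (m<n⇒0<n∸m ρ<x+t)}})))))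
    h-value-shifted (suc c) ρ x ρ<t x<t = ≈-trans (≈-reflexive (cong (λ k → h R k vars) (alg (+ ρ) (+ t) (+ (c ℕ.* t)) (+ x)))) (h-value c ρ x ρ<t x<t)
      where
      alg : ∀ r t ct x → r ℤ.+ (t ℤ.+ ct) ℤ.- x ℤ.- t ≡ r ℤ.+ ct ℤ.- x
      alg = solve-∀

    module Character (lam : Vec ℕ t) (part : IsPartition lam) where

      open Columns S using (E₀; entry)

      β : List ℕ
      β = beta t lam

      open Evaluate S β (length-beta t lam) (beta-desc t lam part) using (D-value; D-nonzero; D-nonzero⇒counts)
      open Core S β (length-beta t lam) using (counts⇒symplectic; symplectic⇒counts)

      key : Fin t → ℕ
      key i = lookup lam i + (t ∸ suc (toℕ i))

      private
        shift-λ : ∀ i → + lookup lam i ℤ.- + suc (toℕ i) ≡ + key i ℤ.- + t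
        shift-λ i = trans (alg (+ lookup lam i) (+ suc (toℕ i)) (+ (t ∸ suc (toℕ i)))) (cong (λ u → + key i ℤ.- u) (cong +_ (m+[n∸m]≡n (Finₚ.toℕ<n i))))
          where
          alg : ∀ l i d → l ℤ.- i ≡ l ℤ.+ d ℤ.- (i ℤ.+ d)
          alg = solve-∀

        h-key : ∀ x {a} y → y < t → a ≡ + x ℤ.- + y → h R a vars ≈ fromℤ R (when (x % t ≟ y) (+ suc (x / t)))
        h-key x y y<t refl = ≈-trans (≈-reflexive (cong (λ k → h R (+ k ℤ.- + y) vars) (m≡m%n+[m/n]*n x t))) (h-value (x / t) (x % t) y (m%n<n x t) y<t)

        h-key-shifted : ∀ x {a} y → y < t → a ≡ + x ℤ.- + y ℤ.- + t → h R a vars ≈ fromℤ R (when (x % t ≟ y) (+ (x / t)))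
        h-key-shifted x y y<t refl = ≈-trans (≈-reflexive (cong (λ k → h R (+ k ℤ.- + y ℤ.- + t) vars) (m≡m%n+[m/n]*n x t))) (h-value-shifted (x / t) (x % t) y (m%n<n x t) y<t)

      -- In column 0 both indices are `x - suc S`. In column `suc q` they are `x - (S - q)` and
      -- `x - q - t`, which yield the two terms of `entry`.
      entry-value : ∀ x j → j < t → h R (+ x ℤ.- + t ℤ.+ + suc j) vars ⊞ h R (+ x ℤ.- + t ℤ.- + suc j ℤ.+ + 2) vars ≈ fromℤ R (E₀ x j)
      entry-value x zero j<t = ≈-trans
        (⊞-cong (h-key x (suc S) ≤-refl (alg (+ x) (+ S))) (h-key x (suc S) ≤-refl (alg' (+ x) (+ S))))
        (≈-sym (fromℤ-+ (when (x % t ≟ suc S) (+ suc (x / t))) (when (x % t ≟ suc S) (+ suc (x / t)))))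
        where
        alg : ∀ x S → x ℤ.- (+ 2 ℤ.+ S) ℤ.+ + 1 ≡ x ℤ.- (+ 1 ℤ.+ S)
        alg = solve-∀
        alg' : ∀ x S → x ℤ.- (+ 2 ℤ.+ S) ℤ.- + 1 ℤ.+ + 2 ≡ x ℤ.- (+ 1 ℤ.+ S)
        alg' = solve-∀
      entry-value x (suc q) (s≤s (s≤s q≤S)) = ≈-trans
        (⊞-cong (≈-trans (h-key x (S ∸ q) (≤-<-trans (m∸n≤m S q) (m<n⇒m<1+n (n<1+n S))) arg) (≈-reflexive (cong (fromℤ R) dual)))
                (h-key-shifted x q (s≤s (m≤n⇒m≤1+n q≤S)) (alg' (+ x) (+ t) (+ q))))
        (≈-sym (fromℤ-+ (when (x % t + q ≟ S) (+ suc (x / t))) (when (x % t ≟ q) (+ (x / t)))))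
        where
        S≡ : + S ≡ + (S ∸ q) ℤ.+ + q
        S≡ = cong +_ (sym (m∸n+n≡m q≤S))
        alg : ∀ x s q → x ℤ.- (+ 2 ℤ.+ (s ℤ.+ q)) ℤ.+ (+ 2 ℤ.+ q) ≡ x ℤ.- s
        alg = solve-∀
        alg' : ∀ x t q → x ℤ.- t ℤ.- (+ 2 ℤ.+ q) ℤ.+ + 2 ≡ x ℤ.- q ℤ.- t
        alg' = solve-∀
        arg : + x ℤ.- + t ℤ.+ + suc (suc q) ≡ + x ℤ.- + (S ∸ q)
        arg = trans (cong (λ u → + x ℤ.- (+ 2 ℤ.+ u) ℤ.+ (+ 2 ℤ.+ + q)) S≡) (alg (+ x) (+ (S ∸ q)) (+ q))
        dual : when (x % t ≟ S ∸ q) (+ suc (x / t)) ≡ when (x % t + q ≟ S) (+ suc (x / t))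
        dual = when-cong (x % t ≟ S ∸ q) (x % t + q ≟ S)
          (λ eq → trans (cong (_+ q) eq) (m∸n+n≡m q≤S))
          (λ eq → trans (sym (m+n∸n≡m (x % t) q)) (cong (_∸ q) eq))

      character : Carrier
      character = sp R inv t lam (λ i → pow R ω (toℕ i))

      character-D : character ≈ inv (1# ⊞ 1#) ⊠ fromℤ R (D E₀ β)
      character-D = ⊠-cong ≈-refl (≈-trans
        (fromℤ-det t {N = λ i j → E₀ (key i) (toℕ j)} (λ i j → ≈-trans
          (≈-reflexive (cong (λ a → h R (a ℤ.+ + suc (toℕ j)) vars ⊞ h R (a ℤ.- + suc (toℕ j) ℤ.+ + 2) vars) (shift-λ i)))
          (entry-value (key i) (toℕ j) (Finₚ.toℕ<n j))))
        (≈-reflexive (cong (fromℤ R) (det-D t (Vec.tabulate key) E₀ (λ i j → E₀ (key i) (toℕ j)) (λ i j → cong (λ k → E₀ k (toℕ j)) (sym (Vecₚ.lookup∘tabulate key i)))))))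

      2≉0 : ¬ (1# ⊞ 1# ≈ 0#)
      2≉0 eq = char0 1 (≈-trans (⊞-cong ≈-refl (⊞-identityʳ 1#)) eq)

      half : inv (1# ⊞ 1#) ⊠ (1# ⊞ 1#) ≈ 1#
      half = ≈-trans (⊠-comm _ _) (inv-law _ 2≉0)

      fromℤ-injective₀ : ∀ x → fromℤ R x ≈ 0# → x ≡ 0ℤ
      fromℤ-injective₀ (+ zero)  _  = refl
      fromℤ-injective₀ (+ suc n) eq = contradiction eq (char0 n)
      fromℤ-injective₀ -[1+ n ]  eq = contradiction (≈-trans (fromℤ-neg -[1+ n ]) (≈-trans (⊟-cong eq) -0#≈0#)) (char0 n)

      nonzero⇒symplectic : ¬ (character ≈ 0#) → Symplectic (core t β)
      nonzero⇒symplectic ≉0 = counts⇒symplectic (D-nonzero⇒counts (λ D≡0 → ≉0 (≈-trans character-D (≈-trans (⊠-cong ≈-refl (≈-reflexive (cong (fromℤ R) D≡0))) (⊠-zeroʳ _)))))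

      symplectic⇒nonzero : Symplectic (core t β) → ¬ (character ≈ 0#)
      symplectic⇒nonzero symp eq = D-nonzero (symplectic⇒counts symp) (fromℤ-injective₀ (D E₀ β) (begin
        d                                     ≈⟨ ⊠-identityˡ d ⟨
        1# ⊠ d                                ≈⟨ ⊠-cong (inv-law (1# ⊞ 1#) 2≉0) ≈-refl ⟨
        ((1# ⊞ 1#) ⊠ inv (1# ⊞ 1#)) ⊠ d       ≈⟨ ⊠-assoc _ _ d ⟩
        (1# ⊞ 1#) ⊠ (inv (1# ⊞ 1#) ⊠ d)       ≈⟨ ⊠-cong ≈-refl (≈-trans (≈-sym character-D) eq) ⟩
        (1# ⊞ 1#) ⊠ 0#                        ≈⟨ ⊠-zeroʳ _ ⟩
        0#                                    ∎))
        where d = fromℤ R (D E₀ β)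

      character-value : Symplectic (core t β) → character ≈ fromℤ R (rhs t β)
      character-value symp = begin
        character                                          ≈⟨ character-D ⟩
        inv (1# ⊞ 1#) ⊠ fromℤ R (D E₀ β)                   ≡⟨ cong (λ d → inv (1# ⊞ 1#) ⊠ fromℤ R d) (D-value (symplectic⇒counts symp)) ⟩
        inv (1# ⊞ 1#) ⊠ fromℤ R (+ 2 ℤ.* rhs t β)          ≈⟨ ⊠-cong ≈-refl (≈-trans (fromℤ-* (+ 2) (rhs t β)) (⊠-cong (⊞-cong ≈-refl (⊞-identityʳ 1#)) ≈-refl)) ⟩
        inv (1# ⊞ 1#) ⊠ ((1# ⊞ 1#) ⊠ fromℤ R (rhs t β))    ≈⟨ ⊠-assoc _ _ _ ⟨
        (inv (1# ⊞ 1#) ⊠ (1# ⊞ 1#)) ⊠ fromℤ R (rhs t β)    ≈⟨ ⊠-cong half ≈-refl ⟩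
        1# ⊠ fromℤ R (rhs t β)                             ≈⟨ ⊠-identityˡ _ ⟩
        fromℤ R (rhs t β)                                  ∎

theorem7p2 : {c ℓ : Level} (R : CommutativeRing c ℓ) →
    let open CommutativeRing R in
    (inv : Carrier → Carrier) →
    ((x : Carrier) → ¬ (x ≈ 0#) → x * inv x ≈ 1#) →
    ((n : ℕ) → ¬ (natR R (suc n) ≈ 0#)) →
    (t : ℕ) .{{_ : NonZero t}} → 2 ≤ t →
    (ω : Carrier) → pow R ω t ≈ 1# → ((k : ℕ) → 0 < k → k < t → ¬ (pow R ω k ≈ 1#)) →
    (lam : Vec ℕ t) → IsPartition lam →
    ((¬ (sp R inv t lam (λ i → pow R ω (toℕ i)) ≈ 0#)) ⇔ Symplectic (core t (beta t lam)))
    × (Symplectic (core t (beta t lam)) →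
    sp R inv t lam (λ i → pow R ω (toℕ i)) ≈ fromℤ R (rhs t (beta t lam)))
theorem7p2 R inv inv-law char0 (suc zero) (s≤s ())
theorem7p2 R inv inv-law char0 (suc (suc S)) _ ω ωᵗ≈1 prim lam part =
  mk⇔ nonzero⇒symplectic symplectic⇒nonzero , character-value
  where
  open Specialise R
  open Roots inv inv-law char0 S ω ωᵗ≈1 prim
  open Character lam part
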